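{- Let $\Delta \ge 3$ be an integer and let $\lambda_c(\Delta) = \frac{(\Delta-1)^{\Delta-1}}{(\Delta-2)^{\Delta}}$. For any $n$-vertex graph $G=(V,E)$ of maximum degree $\Delta$, the Glauber dynamics for the hardcore model on $G$ with fugacity $\lambda = \lambda_c(\Delta)$ has mixing time $$T_{\mathrm{mix}}(P_{\mathrm{GD}}) = O\left( n^{4+\frac{4}{\Delta-2}} \log \Delta\right),$$ where the implied constant does not depend on $n$ or $G$.
   Context: For a graph $G=(V,E)$, let $\mathcal{I}(G)$ be the set of independent sets of $G$. The hardcore model on $G$ with fugacity $\lambda>0$ is the Gibbs distribution $\mu_{G,\lambda}(\sigma) = \lambda^{|\sigma|}/Z_{G,\lambda}$ for $\sigma\in\mathcal{I}(G)$, where $Z_{G,\lambda}=\sum_{\sigma\in\mathcal{I}(G)}\lambda^{|\sigma|}$. The Glauber dynamics $P_{\mathrm{GD}}$ is the Markov chain on $\mathcal{I}(G)$ which, from the current set $\sigma_t$, picks $v\in V$ uniformly at random, sets $S=\sigma_t\setminus\{v\}$; if $S\cup\{v\}\notin\mathcal{I}(G)$ then $\sigma_{t+1}=S$; otherwise $\sigma_{t+1}=S\cup\{v\}$ with probability $\lambda/(1+\lambda)$ and $\sigma_{t+1}=S$ with probability $1/(1+\lambda)$. Its mixing time is $T_{\mathrm{mix}}(P_{\mathrm{GD}}) = \max_{\sigma_0\in\mathcal{I}(G)}\min\{t\in\mathbb{N} : d_{\mathrm{TV}}(P_{\mathrm{GD}}^t(\sigma_0,\cdot),\mu_{G,\lambda})\le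 1/4\}$, where $d_{\mathrm{TV}}$ is total variation distance. -}

module Defs where

open import Data.Bool using (Bool; true; false; if_then_else_; _∧_; not; T)
open import Data.Nat as ℕ using (ℕ; zero; suc; _∸_)
open import Data.Fin using (Fin)
open import Data.Vec using (Vec; []; _∷_; lookup; _[_]≔_; count)
open import Data.Vec.Properties using (≡-dec)
open import Data.List using (List; []; _∷_; map; _++_; foldr; allFin; all)
open import Data.Product using (_×_; Σ; ∃)
import Data.Integer
open import Data.Rational using (ℚ; 0ℚ; 1ℚ; _+_; _*_; _-_; ∣_∣; _≤_; _÷_; ½; ≢-nonZero)
open import Data.Rational.Properties using (_≟_)
import Data.Rational as Q
open import Relation.Nullary using (yes; no; ⌊_⌋)
open import Relation.Binary.PropositionalEquality using (_≡_)
import Data.Bool.Properties as BP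

record Graph (n : ℕ) : Set where
  field
    adj   : Fin n → Fin n → Bool
    sym   : ∀ u v → adj u v ≡ adj v u
    irrefl : ∀ v → adj v v ≡ false
open Graph public

degree : ∀ {n} → Graph n → Fin n → ℕ
degree {n} G v = foldr (λ u acc → if adj G v u then suc acc else acc) 0 (allFin n)

HasMaxDegree : ∀ {n} → Graph n → ℕ → Set
HasMaxDegree {n} G Δ = (∀ v → degree G v ℕ.≤ Δ) × ∃ λ v → degree G v ≡ Δ

-- Configurations = subsets of V as indicator vectors

Config : ℕ → Set
Config n = Vec Bool n

allConfigs : (n : ℕ) → List (Config n)
allConfigs zero    = [] ∷ []
allConfigs (suc n) = map (false ∷_) (allConfigs n) ++ map (true ∷_) (allConfigs n)

allB : ∀ {A : Set} → (A → Bool) → List A → Bool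
allB p xs = foldr (λ x acc → p x ∧ acc) true xs

isIndep : ∀ {n} → Graph n → Config n → Bool
isIndep {n} G σ =
  allB (λ u → allB (λ v → not (adj G u v ∧ lookup σ u ∧ lookup σ v)) (allFin n)) (allFin n)

Independent : ∀ {n} → Graph n → Config n → Set
Independent G σ = T (isIndep G σ)

size : ∀ {n} → Config n → ℕ
size σ = count T? σ
  where
  T? : (b : Bool) → _
  T? b = BP.T? b

-- total division, with the convention x ÷' 0 = 0 (only used with
-- nonzero denominators in the statement)
_÷'_ : ℚ → ℚ → ℚ
p ÷' q with q ≟ 0ℚ
... | yes _ = 0ℚ
... | no q≢0 = _÷_ p q {{≢-nonZero q≢0}}

fromℕ : ℕ → ℚ
fromℕ k = Data.Integer.+ k Q./ 1

_^ℚ_ : ℚ → ℕ → ℚ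
q ^ℚ zero  = 1ℚ
q ^ℚ suc k = q * (q ^ℚ k)

Σ[_]_ : ∀ {A : Set} → List A → (A → ℚ) → ℚ
Σ[ xs ] f = foldr (λ x acc → f x + acc) 0ℚ xs

indicator : ∀ {n} → Config n → Config n → ℚ
indicator σ τ with ≡-dec BP._≟_ σ τ
... | yes _ = 1ℚ
... | no _  = 0ℚ

λc : ℕ → ℚ
λc Δ = fromℕ ((Δ ∸ 1) ℕ.^ (Δ ∸ 1)) ÷' fromℕ ((Δ ∸ 2) ℕ.^ Δ)

weight : ∀ {n} → Graph n → ℚ → Config n → ℚ
weight G lam σ = if isIndep G σ then lam ^ℚ size σ else 0ℚ

partitionFn : ∀ {n} → Graph n → ℚ → ℚ
partitionFn {n} G lam = Σ[ allConfigs n ] (weight G lam)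

gibbs : ∀ {n} → Graph n → ℚ → Config n → ℚ
gibbs G lam σ = weight G lam σ ÷' partitionFn G lam

updateAt : ∀ {n} → Graph n → ℚ → Config n → Fin n → Config n → ℚ
updateAt G lam σ v τ =
  let S  = σ [ v ]≔ false
      S+ = S [ v ]≔ true
  in if isIndep G S+
     then ((lam ÷' (1ℚ + lam)) * indicator S+ τ + (1ℚ ÷' (1ℚ + lam)) * indicator S τ)
     else indicator S τ

glauber : ∀ {n} → Graph n → ℚ → Config n → Config n → ℚ
glauber {n} G lam σ τ = (Σ[ allFin n ] (λ v → updateAt G lam σ v τ)) ÷' fromℕ n

glauberPow : ∀ {n} → Graph n → ℚ → ℕ → Config n → Config n → ℚ
glauberPow G lam zero    σ₀ τ = indicator σ₀ τ
glauberPow {n} G lam (suc t) σ₀ τ =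
  Σ[ allConfigs n ] (λ σ → glauberPow G lam t σ₀ σ * glauber G lam σ τ)

dTV : ∀ {n} → (Config n → ℚ) → (Config n → ℚ) → ℚ
dTV {n} p q = ½ * Σ[ allConfigs n ] (λ τ → ∣ p τ - q τ ∣)

-- T_mix(P_GD) ≤ T, i.e. max over σ₀ ∈ I(G) of min{t : dTV ≤ 1/4} is ≤ T
MixingTimeAtMost : ∀ {n} → Graph n → ℚ → ℕ → Set
MixingTimeAtMost {n} G lam T =
  ∀ (σ₀ : Config n) → Independent G σ₀ →
    Σ ℕ λ t → (t ℕ.≤ T) × (dTV (glauberPow G lam t σ₀) (gibbs G lam) ≤ (Data.Integer.+ 1 Q./ 4))

-- T ≤ C · n^(4 + 4/(Δ-2)) · log Δ, stated exactly in ℕ by raising both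
-- sides to the power Δ-2 (n^(4+4/(Δ-2)) = n^((4Δ-4)/(Δ-2))); log Δ is
-- taken as ⌈log₂ Δ⌉ (same up to a constant factor for Δ ≥ 3).
open import Data.Nat.Logarithm using (⌈log₂_⌉)

BoundedBy : (Δ C n T : ℕ) → Set
BoundedBy Δ C n T =
  T ℕ.^ (Δ ∸ 2) ℕ.≤ ((C ℕ.* ⌈log₂ Δ ⌉) ℕ.^ (Δ ∸ 2)) ℕ.* (n ℕ.^ (4 ℕ.* Δ ∸ 4))

{-# OPTIONS --safe #-}
-- Spectral independence.  Write d = Δ - 1 and take r with λ ≤ r (1 + r)^d and (d - 1) r < 1.  Deleting the neighbours of
-- v one at a time expresses the influences of v through those of its neighbours in smaller induced subgraphs, and an
-- induction shows that the total influence of a vertex of degree at most d and marginal p is at most K min(1, p̂ / p),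
-- where p̂ = r / (1 + r) and K = 1 / (1 - d p̂).  This invariant is closed because ∏ (1 + eᵢ) (1 - ∑ eᵢ) ≤ 1.  Hence
-- covariances are bounded with constant η = 1 + (d + 1) r / (1 - (d - 1) r), which is 1 + O(1/s) at λ = (1 - s) λ_c.
--
-- Localisation.  Place the vertices of a random independent set into m distinct slots and reveal one slot: at most one
-- vertex v is pinned, the remaining measure lives on m - 1 slots of G - N[v] (or of G), and spectral independence bounds
-- the variance lost by a fraction about η/m while the Dirichlet form loses exactly 1/m.  Starting from a sparse measure
-- with Poincaré constant 4, the constants multiply up to ∏ (1 + (η - 1)/m) = O(n^(2 + 4/(Δ-2))) at (1 - 1/(4n)) λ_c,
-- which is comparable to λ_c up to a constant factor in the weights.  A Poincaré constant B gives mixing in O(n · B · n)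
-- steps by L² contraction of the reversible kernel.
module Submission where

open import Algebra.Bundles using (CommutativeRing)
import Algebra.Solver.Ring as RingSolver
open import Algebra.Solver.Ring.AlmostCommutativeRing using (AlmostCommutativeRing; fromCommutativeRing; _-Raw-AlmostCommutative⟶_)
open import Algebra.Structures using (IsCommutativeRing)
open import Data.Bool.Base using (Bool; true; false; not; _∧_; _∨_; T; if_then_else_)
import Data.Bool.Properties as Bool
open import Data.Empty using (⊥; ⊥-elim)
open import Data.Fin.Base using (Fin; zero; suc)
import Data.Fin.Properties as Fin
open import Data.Integer.Base as ℤ using (ℤ)
import Data.Integer.Properties as ℤₚ
import Data.Integer.Solver
open import Data.List.Base using (List; []; _∷_; map; _++_; foldr; allFin; tabulate)
open import Data.List.Membership.Propositional using (_∈_)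
open import Data.List.Membership.Propositional.Properties using (∈-allFin)
open import Data.List.Relation.Unary.Any using (here; there)
open import Data.Maybe.Base using (Maybe; just; nothing)
open import Data.Nat.Base as ℕ using (ℕ; zero; suc; pred)
open import Data.Nat.Logarithm using (⌈log₂_⌉; ⌈log₂⌉-mono-≤)
import Data.Nat.Properties as ℕₚ
import Data.Nat.Solver
open import Data.Product using (Σ; ∃; _×_; _,_; proj₁; proj₂)
open import Data.Rational.Base as ℚ using (ℚ; mkℚ; 0ℚ; 1ℚ)
import Data.Rational.Properties as ℚₚ
open import Data.Rational.Unnormalised.Base as ℚᵘ using (mkℚᵘ; *≡*; *≤*)
import Data.Rational.Unnormalised.Properties as ℚᵘₚ
open import Data.Sum.Base using (_⊎_; inj₁; inj₂)
open import Data.Vec.Base using ([]; _∷_; lookup; _[_]≔_; replicate)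
import Data.Vec.Properties as Vec
open import Defs renaming (sym to adj-sym; irrefl to adj-irrefl)
open import Function.Base using (_∘_)
open import Relation.Binary.Definitions using (DecidableEquality)
open import Relation.Binary.PropositionalEquality
open import Relation.Nullary using (yes; no; Dec; ⌊_⌋)


-- Only rational numbers are available: no roots, exponentials or logarithms, and no exact solution
-- of λ = r (1 + r)^d. So r is an explicit fraction satisfying an inequality, eigenvalue bounds
-- become quadratic forms treated by completing squares, and the Poincaré constant is estimated
-- through its power D = Δ - 2.
--
-- The slots turn a differential inequality in the fugacity into a finite product, since revealing
-- one of m slots lowers the fugacity by a factor of about 1 - 1/m. With k of the N slots that would
-- be critical, η - 1 is about 2c k / (N - k) with c = Δ / (Δ - 2), so a step multiplies the
-- constant by about 1 + 2c / (N - k). Stopping at N - k = N / (4n) gives the order n^(2c), and 2c =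
-- 2 + 4/(Δ-2). At N itself the bound on η is infinite, hence the final comparison.
--
-- The price of slots is that the weights are falling factorials instead of powers. Order n² spare
-- slots pay for this and for the second order terms of the product, and k starts so large that the
-- spare slots hardly change the fugacity.

record OrderedField : Set₁ where
  infix  9 _⁻¹
  infix  8 -_
  infixl 7 _*_
  infixl 6 _+_
  infix  4 _≤_
  field
    Carrier : Set
    _+_ _*_ : Carrier → Carrier → Carrier
    -_ _⁻¹  : Carrier → Carrier
    fromℤ   : ℤ → Carrier
    _≤_     : Carrier → Carrier → Set

  0# : Carrier
  0# = fromℤ (ℤ.+ 0)

  1# : Carrier
  1# = fromℤ (ℤ.+ 1)

  field
    isCommutativeRing : IsCommutativeRing _≡_ _+_ _*_ -_ 0# 1#
    _≟_      : DecidableEquality Carrier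
    inverseʳ : ∀ {x} → x ≢ 0# → x * x ⁻¹ ≡ 1#
    1≢0      : 1# ≢ 0#
    fromℤ-+  : ∀ i j → fromℤ (i ℤ.+ j) ≡ fromℤ i + fromℤ j
    fromℤ-*  : ∀ i j → fromℤ (i ℤ.* j) ≡ fromℤ i * fromℤ j
    fromℤ-neg : ∀ i → fromℤ (ℤ.- i) ≡ - fromℤ i
    ≤-refl    : ∀ {x} → x ≤ x
    ≤-trans   : ∀ {x y z} → x ≤ y → y ≤ z → x ≤ z
    ≤-antisym : ∀ {x y} → x ≤ y → y ≤ x → x ≡ y
    ≤-total   : ∀ x y → x ≤ y ⊎ y ≤ x
    +-monoˡ-≤ : ∀ z {x y} → x ≤ y → x + z ≤ y + z
    *-nonneg  : ∀ {x y} → 0# ≤ x → 0# ≤ y → 0# ≤ x * y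
    0≤1       : 0# ≤ 1#
    archimedean : ∀ x → ∃ λ k → x ≤ fromℤ (ℤ.+ k)

-- Arithmetic and order in an Archimedean field

module Analysis (𝔽 : OrderedField) where

  open OrderedField 𝔽 public

  commutativeRing : CommutativeRing _ _
  commutativeRing = record { isCommutativeRing = isCommutativeRing }

  open CommutativeRing commutativeRing public
    using (+-comm; +-assoc; +-identityˡ; +-identityʳ; *-comm; *-assoc; *-identityˡ; *-identityʳ; distribˡ; distribʳ; zeroˡ; zeroʳ; -‿inverseʳ; -‿inverseˡ)

  almostCommutativeRing : AlmostCommutativeRing _ _
  almostCommutativeRing = fromCommutativeRing commutativeRing

  fromℤ-morphism : CommutativeRing.rawRing ℤₚ.+-*-commutativeRing -Raw-AlmostCommutative⟶ almostCommutativeRing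
  fromℤ-morphism = record
    { ⟦_⟧ = fromℤ ; +-homo = fromℤ-+ ; *-homo = fromℤ-* ; -‿homo = fromℤ-neg ; 0-homo = refl ; 1-homo = refl }

  fromℤ-≟ : ∀ i j → Maybe (fromℤ i ≡ fromℤ j)
  fromℤ-≟ i j with i ℤₚ.≟ j
  ... | yes eq = just (cong fromℤ eq)
  ... | no _   = nothing

  module Solver = RingSolver (CommutativeRing.rawRing ℤₚ.+-*-commutativeRing) almostCommutativeRing fromℤ-morphism fromℤ-≟
  open Solver public using (Polynomial; solve; _:=_; _:+_; _:*_; _:-_; :-_; con)

  lit : ∀ {n} → ℕ → Polynomial n
  lit k = con (ℤ.+ k)

  infixl 6 _-_
  _-_ : Carrier → Carrier → Carrier
  x - y = x + (- y)

  infixr 9 #_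
  #_ : ℕ → Carrier
  # k = fromℤ (ℤ.+ k)

  sq : Carrier → Carrier
  sq x = x * x

  module _ where

    private variable x y z w a b e : Carrier

    ≤-reflexive : x ≡ y → x ≤ y
    ≤-reflexive refl = ≤-refl

    infixr 2 step-≤ step-≡
    infix 3 _∎
    infix 1 begin_
    begin_ : x ≤ y → x ≤ y
    begin p = p
    step-≤ : ∀ x {y z} → y ≤ z → x ≤ y → x ≤ z
    step-≤ x q p = ≤-trans p q
    step-≡ : ∀ x {y z} → y ≤ z → x ≡ y → x ≤ z
    step-≡ x q refl = q
    _∎ : ∀ x → x ≤ x
    x ∎ = ≤-refl
    syntax step-≤ x q p = x ≤⟨ p ⟩ q
    syntax step-≡ x q p = x ≡⟨ p ⟩ q

    ≤-by : ∀ e → 0# ≤ e → y ≡ x + e → x ≤ y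
    ≤-by {y} {x} e p refl = subst (_≤ x + e) (+-identityˡ x) (subst (0# + x ≤_) (+-comm e x) (+-monoˡ-≤ x p))

    +-mono : x ≤ y → z ≤ w → x + z ≤ y + w
    +-mono {x} {y} {z} {w} p q = ≤-trans (+-monoˡ-≤ z p) (subst₂ _≤_ (+-comm z y) (+-comm w y) (+-monoˡ-≤ y q))

    ≤⇒0≤- : x ≤ y → 0# ≤ y - x
    ≤⇒0≤- {x} {y} p = subst (_≤ y - x) (-‿inverseʳ x) (+-monoˡ-≤ (- x) p)

    0≤-⇒≤ : 0# ≤ y - x → x ≤ y
    0≤-⇒≤ {y} {x} p = ≤-by (y - x) p (solve 2 (λ y x → y := x :+ (y :- x)) refl y x)

    +-nonneg : 0# ≤ x → 0# ≤ y → 0# ≤ x + y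
    +-nonneg {x} {y} p q = subst (_≤ x + y) (+-identityˡ 0#) (+-mono p q)

    *-monoˡ : ∀ a → 0# ≤ a → x ≤ y → a * x ≤ a * y
    *-monoˡ {x} {y} a p q = ≤-by (a * (y - x)) (*-nonneg p (≤⇒0≤- q)) (solve 3 (λ a x y → a :* y := a :* x :+ a :* (y :- x)) refl a x y)

    *-monoʳ : ∀ a → 0# ≤ a → x ≤ y → x * a ≤ y * a
    *-monoʳ {x} {y} a p q = subst₂ _≤_ (*-comm a x) (*-comm a y) (*-monoˡ a p q)

    *-mono : 0# ≤ x → 0# ≤ w → x ≤ y → z ≤ w → x * z ≤ y * w
    *-mono {x} {w} px pw q r = ≤-trans (*-monoˡ x px r) (*-monoʳ w pw q)

    neg-mono : x ≤ y → - y ≤ - x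
    neg-mono {x} {y} p = ≤-by (y - x) (≤⇒0≤- p) (solve 2 (λ x y → :- x := :- y :+ (y :- x)) refl x y)

    neg-nonneg : x ≤ 0# → 0# ≤ - x
    neg-nonneg {x} p = subst (0# ≤_) (solve 1 (λ x → lit 0 :- x := :- x) refl x) (≤⇒0≤- p)

    sq-nonneg : ∀ x → 0# ≤ sq x
    sq-nonneg x with ≤-total 0# x
    ... | inj₁ p = *-nonneg p p
    ... | inj₂ p = subst (0# ≤_) (solve 1 (λ x → :- x :* :- x := x :* x) refl x) (*-nonneg (neg-nonneg p) (neg-nonneg p))

    Pos : Carrier → Set
    Pos x = 0# ≤ x × x ≢ 0#

    pos-≤ : Pos x → x ≤ y → Pos y
    pos-≤ (p , q) r = ≤-trans p r , λ { refl → q (≤-antisym r p) }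

    1-pos : Pos 1#
    1-pos = 0≤1 , 1≢0

    +-pos : Pos x → 0# ≤ y → Pos (x + y)
    +-pos {x} {y} p q = pos-≤ p (≤-by y q refl)

    ⁻¹-inverseˡ : x ≢ 0# → x ⁻¹ * x ≡ 1#
    ⁻¹-inverseˡ {x} p = trans (*-comm (x ⁻¹) x) (inverseʳ p)

    *-cancel-0 : x ≢ 0# → x * y ≡ 0# → y ≡ 0#
    *-cancel-0 {x} {y} p q = trans (sym (*-identityˡ y)) (trans (cong (_* y) (sym (⁻¹-inverseˡ p)))
      (trans (*-assoc (x ⁻¹) x y) (trans (cong (x ⁻¹ *_) q) (zeroʳ (x ⁻¹)))))

    *-pos : Pos x → Pos y → Pos (x * y)
    *-pos (p , p′) (q , q′) = *-nonneg p q , λ eq → q′ (*-cancel-0 p′ eq)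

    -- Estimates with quotients are mostly proved multiplied through by a positive denominator and
    -- then cancelled here, which leaves polynomial identities.
    *-cancel-≤ : Pos a → a * x ≤ a * y → x ≤ y
    *-cancel-≤ {a} {x} {y} (p , p′) q with ≤-total x y
    ... | inj₁ r = r
    ... | inj₂ r = ≤-reflexive (sym (trans (solve 2 (λ x y → y := x :- (x :- y)) refl x y) (trans (cong (λ t → x - t) d≡0) (solve 1 (λ x → x :- lit 0 := x) refl x))))
      where
      eq : a * (x - y) ≡ 0#
      eq = ≤-antisym (subst₂ _≤_ (solve 3 (λ a x y → a :* x :- a :* y := a :* (x :- y)) refl a x y) (-‿inverseʳ (a * y)) (+-monoˡ-≤ (- (a * y)) q)) (*-nonneg p (≤⇒0≤- r))
      d≡0 : x - y ≡ 0#
      d≡0 = *-cancel-0 p′ eq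

    ⁻¹-pos : Pos x → Pos (x ⁻¹)
    ⁻¹-pos {x} (p , p′) = h , λ eq → 1≢0 (trans (sym (inverseʳ p′)) (trans (cong (x *_) eq) (zeroʳ x)))
      where
      h : 0# ≤ x ⁻¹
      h = *-cancel-≤ (p , p′) (subst₂ _≤_ (sym (zeroʳ x)) (sym (inverseʳ p′)) 0≤1)

    #-suc : ∀ k → # suc k ≡ 1# + # k
    #-suc k = fromℤ-+ (ℤ.+ 1) (ℤ.+ k)

    #-+ : ∀ j k → # (j ℕ.+ k) ≡ # j + # k
    #-+ j k = fromℤ-+ (ℤ.+ j) (ℤ.+ k)

    #-* : ∀ j k → # (j ℕ.* k) ≡ # j * # k
    #-* j k = trans (cong fromℤ (ℤₚ.pos-* j k)) (fromℤ-* (ℤ.+ j) (ℤ.+ k))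

    #-nonneg : ∀ k → 0# ≤ # k
    #-nonneg zero    = ≤-refl
    #-nonneg (suc k) = subst (0# ≤_) (sym (#-suc k)) (+-nonneg 0≤1 (#-nonneg k))

    #-pos : ∀ k → Pos (# suc k)
    #-pos k = subst Pos (sym (#-suc k)) (+-pos 1-pos (#-nonneg k))

    #-mono : ∀ {j k} → j ℕ.≤ k → # j ≤ # k
    #-mono {j} p with ℕₚ.m≤n⇒∃[o]m+o≡n p
    ... | o , refl = ≤-by (# o) (#-nonneg o) (#-+ j o)

    #-∸ : ∀ {j k} → j ℕ.≤ k → # (k ℕ.∸ j) ≡ # k - # j
    #-∸ {j} {k} p = trans (solve 2 (λ x y → x := (y :+ x) :- y) refl (# (k ℕ.∸ j)) (# j))
      (cong (_- # j) (trans (sym (#-+ j (k ℕ.∸ j))) (cong #_ (ℕₚ.m+[n∸m]≡n p))))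

    #-≤-cancel : ∀ j k → # j ≤ # k → j ℕ.≤ k
    #-≤-cancel j k p with j ℕₚ.≤? k
    ... | yes q = q
    ... | no  q = ⊥-elim (proj₂ (#-pos 0) (≤-antisym (subst₂ _≤_ eq (-‿inverseʳ (# k)) (+-monoˡ-≤ (- # k) (≤-trans (#-mono (ℕₚ.≰⇒> q)) p))) 0≤1))
      where eq : # suc k - # k ≡ 1#
            eq = trans (cong (_- # k) (#-suc k)) (solve 1 (λ x → (lit 1 :+ x) :- x := lit 1) refl (# k))

    min : Carrier → Carrier → Carrier
    min x y with ≤-total x y
    ... | inj₁ _ = x
    ... | inj₂ _ = y

    min≤ˡ : ∀ x y → min x y ≤ x
    min≤ˡ x y with ≤-total x y
    ... | inj₁ _ = ≤-refl
    ... | inj₂ p = p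

    min≤ʳ : ∀ x y → min x y ≤ y
    min≤ʳ x y with ≤-total x y
    ... | inj₁ p = p
    ... | inj₂ _ = ≤-refl

    min-case : ∀ {P : Carrier → Set} x y → P x → P y → P (min x y)
    min-case x y p q with ≤-total x y
    ... | inj₁ _ = p
    ... | inj₂ _ = q

    abs : Carrier → Carrier
    abs x with ≤-total 0# x
    ... | inj₁ _ = x
    ... | inj₂ _ = - x

    x≤abs : ∀ x → x ≤ abs x
    x≤abs x with ≤-total 0# x
    ... | inj₁ _ = ≤-refl
    ... | inj₂ p = ≤-trans p (neg-nonneg p)

    -x≤abs : ∀ x → - x ≤ abs x
    -x≤abs x with ≤-total 0# x
    ... | inj₁ p = ≤-trans (≤-by x p (solve 1 (λ x → lit 0 := :- x :+ x) refl x)) p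
    ... | inj₂ _ = ≤-refl

    abs-≤ : x ≤ y → - x ≤ y → abs x ≤ y
    abs-≤ {x} p q with ≤-total 0# x
    ... | inj₁ _ = p
    ... | inj₂ _ = q

    abs-nonneg : ∀ x → 0# ≤ abs x
    abs-nonneg x with ≤-total 0# x
    ... | inj₁ p = p
    ... | inj₂ p = neg-nonneg p

    abs-+ : ∀ x y → abs (x + y) ≤ abs x + abs y
    abs-+ x y = abs-≤ (+-mono (x≤abs x) (x≤abs y))
      (subst (_≤ abs x + abs y) (solve 2 (λ x y → :- x :+ :- y := :- (x :+ y)) refl x y) (+-mono (-x≤abs x) (-x≤abs y)))

    abs-neg : ∀ x → abs (- x) ≡ abs x
    abs-neg x = ≤-antisym (abs-≤ (-x≤abs x) (subst (_≤ abs x) (sym (solve 1 (λ x → :- :- x := x) refl x)) (x≤abs x)))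
      (abs-≤ (subst (_≤ abs (- x)) (solve 1 (λ x → :- :- x := x) refl x) (-x≤abs (- x))) (x≤abs (- x)))

    abs-*-nonneg : 0# ≤ a → ∀ x → abs (a * x) ≡ a * abs x
    abs-*-nonneg {a} p x = ≤-antisym
      (abs-≤ (*-monoˡ a p (x≤abs x)) (subst (_≤ a * abs x) (solve 2 (λ a x → a :* :- x := :- (a :* x)) refl a x) (*-monoˡ a p (-x≤abs x))))
      h
      where
      h : a * abs x ≤ abs (a * x)
      h with ≤-total 0# x
      ... | inj₁ _ = x≤abs (a * x)
      ... | inj₂ _ = subst (_≤ abs (a * x)) (solve 2 (λ a x → :- (a :* x) := a :* :- x) refl a x) (-x≤abs (a * x))

    infixr 8 _^_
    _^_ : Carrier → ℕ → Carrier
    x ^ zero  = 1#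
    x ^ suc k = x * x ^ k

    ^-nonneg : 0# ≤ x → ∀ k → 0# ≤ x ^ k
    ^-nonneg p zero    = 0≤1
    ^-nonneg p (suc k) = *-nonneg p (^-nonneg p k)

    ^-pos : Pos x → ∀ k → Pos (x ^ k)
    ^-pos p zero    = 1-pos
    ^-pos p (suc k) = *-pos p (^-pos p k)

    ^-mono : 0# ≤ x → x ≤ y → ∀ k → x ^ k ≤ y ^ k
    ^-mono p q zero    = ≤-refl
    ^-mono p q (suc k) = *-mono p (^-nonneg (≤-trans p q) k) q (^-mono p q k)

    ^-distrib : ∀ x y k → (x * y) ^ k ≡ x ^ k * y ^ k
    ^-distrib x y zero    = sym (*-identityʳ 1#)
    ^-distrib x y (suc k) = trans (cong (x * y *_) (^-distrib x y k)) (solve 4 (λ x y a b → (x :* y) :* (a :* b) := (x :* a) :* (y :* b)) refl x y (x ^ k) (y ^ k))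

    ^-+ : ∀ x j k → x ^ (j ℕ.+ k) ≡ x ^ j * x ^ k
    ^-+ x zero k    = sym (*-identityˡ (x ^ k))
    ^-+ x (suc j) k = trans (cong (x *_) (^-+ x j k)) (sym (*-assoc x (x ^ j) (x ^ k)))

    ^-* : ∀ x j k → x ^ (j ℕ.* k) ≡ (x ^ k) ^ j
    ^-* x zero k    = refl
    ^-* x (suc j) k = trans (^-+ x k (j ℕ.* k)) (cong (x ^ k *_) (^-* x j k))

    1^ : ∀ k → 1# ^ k ≡ 1#
    1^ zero    = refl
    1^ (suc k) = trans (*-identityˡ (1# ^ k)) (1^ k)

    1≤^ : 1# ≤ x → ∀ k → 1# ≤ x ^ k
    1≤^ {x} p k = subst (_≤ x ^ k) (1^ k) (^-mono 0≤1 p k)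

    #-^ : ∀ j k → # (j ℕ.^ k) ≡ (# j) ^ k
    #-^ j zero    = refl
    #-^ j (suc k) = trans (#-* j (j ℕ.^ k)) (cong (# j *_) (#-^ j k))

    bernoulli : 0# ≤ 1# + x → ∀ k → 1# + # k * x ≤ (1# + x) ^ k
    bernoulli {x} p zero    = ≤-reflexive (solve 1 (λ x → lit 1 :+ lit 0 :* x := lit 1) refl x)
    bernoulli {x} p (suc k) = begin
      1# + # suc k * x ≡⟨ cong (λ t → 1# + t * x) (#-suc k) ⟩
      1# + (1# + # k) * x ≤⟨ ≤-by (# k * sq x) (*-nonneg (#-nonneg k) (sq-nonneg x))
         (solve 2 (λ x k → (lit 1 :+ x) :* (lit 1 :+ k :* x) := (lit 1 :+ (lit 1 :+ k) :* x) :+ k :* (x :* x)) refl x (# k)) ⟩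
      (1# + x) * (1# + # k * x) ≤⟨ *-monoˡ (1# + x) p (bernoulli p k) ⟩
      (1# + x) * (1# + x) ^ k ∎

  -- Sums over vertices and configurations

  sum : {A : Set} → List A → (A → Carrier) → Carrier
  sum xs f = foldr (λ x acc → f x + acc) 0# xs

  module _ {A : Set} where

    sum-cong : ∀ (xs : List A) {f g} → (∀ x → f x ≡ g x) → sum xs f ≡ sum xs g
    sum-cong []       eq = refl
    sum-cong (x ∷ xs) eq = cong₂ _+_ (eq x) (sum-cong xs eq)

    sum-+ : ∀ (xs : List A) f g → sum xs (λ x → f x + g x) ≡ sum xs f + sum xs g
    sum-+ []       f g = sym (+-identityˡ 0#)
    sum-+ (x ∷ xs) f g = trans (cong (f x + g x +_) (sum-+ xs f g))
      (solve 4 (λ a b c d → (a :+ b) :+ (c :+ d) := (a :+ c) :+ (b :+ d)) refl (f x) (g x) (sum xs f) (sum xs g))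

    sum-*ˡ : ∀ (xs : List A) a f → sum xs (λ x → a * f x) ≡ a * sum xs f
    sum-*ˡ []       a f = sym (zeroʳ a)
    sum-*ˡ (x ∷ xs) a f = trans (cong (a * f x +_) (sum-*ˡ xs a f)) (sym (distribˡ a (f x) (sum xs f)))

    sum-*ʳ : ∀ (xs : List A) a f → sum xs (λ x → f x * a) ≡ sum xs f * a
    sum-*ʳ xs a f = trans (sum-cong xs (λ x → *-comm (f x) a)) (trans (sum-*ˡ xs a f) (*-comm a (sum xs f)))

    sum-mono : ∀ (xs : List A) {f g} → (∀ x → f x ≤ g x) → sum xs f ≤ sum xs g
    sum-mono []       p = ≤-refl
    sum-mono (x ∷ xs) p = +-mono (p x) (sum-mono xs p)

    sum-0 : ∀ (xs : List A) → sum xs (λ _ → 0#) ≡ 0#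
    sum-0 []       = refl
    sum-0 (x ∷ xs) = trans (+-identityˡ _) (sum-0 xs)

    sum-nonneg : ∀ (xs : List A) {f} → (∀ x → 0# ≤ f x) → 0# ≤ sum xs f
    sum-nonneg xs {f} p = subst (_≤ sum xs f) (sum-0 xs) (sum-mono xs p)

    sum-++ : ∀ (xs ys : List A) f → sum (xs ++ ys) f ≡ sum xs f + sum ys f
    sum-++ []       ys f = sym (+-identityˡ _)
    sum-++ (x ∷ xs) ys f = trans (cong (f x +_) (sum-++ xs ys f)) (sym (+-assoc _ _ _))

    sum-map : {B : Set} (h : B → A) (xs : List B) (f : A → Carrier) → sum (map h xs) f ≡ sum xs (f ∘ h)
    sum-map h []       f = refl
    sum-map h (x ∷ xs) f = cong (f (h x) +_) (sum-map h xs f)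

    sum-swap : {B : Set} (xs : List A) (ys : List B) (f : A → B → Carrier) →
               sum xs (λ x → sum ys (f x)) ≡ sum ys (λ y → sum xs (λ x → f x y))
    sum-swap {B} []       ys f = sym (zeros ys)
      where
      zeros : (ys : List B) → sum ys (λ _ → 0#) ≡ 0#
      zeros []       = refl
      zeros (y ∷ ys) = trans (+-identityˡ _) (zeros ys)
    sum-swap {B} (x ∷ xs) ys f = trans (cong (sum ys (f x) +_) (sum-swap xs ys f)) (sym (h ys))
      where
      h : (ys : List B) → sum ys (λ y → f x y + sum xs (λ x → f x y)) ≡ sum ys (f x) + sum ys (λ y → sum xs (λ x → f x y))
      h []       = sym (+-identityˡ 0#)
      h (y ∷ ys) = trans (cong (f x y + sum xs (λ x → f x y) +_) (h ys))
        (solve 4 (λ a b c d → (a :+ b) :+ (c :+ d) := (a :+ c) :+ (b :+ d)) refl (f x y) (sum xs (λ x → f x y)) (sum ys (f x)) (sum ys (λ y → sum xs (λ x → f x y))))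

  sumF : ∀ {n} → (Fin n → Carrier) → Carrier
  sumF {n} = sum (allFin n)

  sumC : ∀ {n} → (Config n → Carrier) → Carrier
  sumC {n} = sum (allConfigs n)

  sum-tabulate : ∀ {A : Set} n (h : Fin n → A) f → sum (tabulate h) f ≡ sumF (f ∘ h)
  sum-tabulate zero    h f = refl
  sum-tabulate (suc n) h f = cong (f (h zero) +_) (trans (sum-tabulate n (h ∘ suc) f) (sym (sum-tabulate n suc (f ∘ h))))

  sumF-suc : ∀ {n} (f : Fin (suc n) → Carrier) → sumF f ≡ f zero + sumF (f ∘ suc)
  sumF-suc {n} f = cong (f zero +_) (sum-tabulate n suc f)

  sumC-suc : ∀ {n} (f : Config (suc n) → Carrier) → sumC f ≡ sumC (f ∘ (false ∷_)) + sumC (f ∘ (true ∷_))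
  sumC-suc {n} f = trans (sum-++ (map (false ∷_) (allConfigs n)) _ f)
    (cong₂ _+_ (sum-map (false ∷_) (allConfigs n) f) (sum-map (true ∷_) (allConfigs n) f))

  sumF-const : ∀ n a → sumF {n} (λ _ → a) ≡ # n * a
  sumF-const zero    a = sym (zeroˡ a)
  sumF-const (suc n) a = trans (sumF-suc (λ (_ : Fin (suc n)) → a)) (trans (cong (a +_) (sumF-const n a))
    (trans (solve 2 (λ a k → a :+ k :* a := (lit 1 :+ k) :* a) refl a (# n)) (cong (_* a) (sym (#-suc n)))))

  𝟙 : Bool → Carrier
  𝟙 true  = 1#
  𝟙 false = 0#

  𝟙-nonneg : ∀ b → 0# ≤ 𝟙 b
  𝟙-nonneg true  = 0≤1
  𝟙-nonneg false = ≤-refl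

  𝟙-≤1 : ∀ b → 𝟙 b ≤ 1#
  𝟙-≤1 true  = ≤-refl
  𝟙-≤1 false = 0≤1

  𝟙-∧ : ∀ a b → 𝟙 (a ∧ b) ≡ 𝟙 a * 𝟙 b
  𝟙-∧ true  b = sym (*-identityˡ _)
  𝟙-∧ false b = sym (zeroˡ _)

  δ : ∀ {n} → Fin n → Fin n → Carrier
  δ u v = 𝟙 ⌊ u Fin.≟ v ⌋

  δ-suc : ∀ {n} (u v : Fin n) → δ (suc u) (suc v) ≡ δ u v
  δ-suc u v with u Fin.≟ v
  ... | yes refl = refl
  ... | no _     = refl

  sumF-δ : ∀ {n} (u : Fin n) (f : Fin n → Carrier) → sumF (λ v → δ u v * f v) ≡ f u
  sumF-δ {suc n} zero f = trans (sumF-suc (λ v → δ zero v * f v)) (trans (cong₂ _+_ (*-identityˡ _)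
    (trans (sum-cong (allFin n) (λ v → zeroˡ _)) (sum-0 (allFin n)))) (+-identityʳ _))
  sumF-δ {suc n} (suc u) f = trans (sumF-suc (λ v → δ (suc u) v * f v)) (trans (cong₂ _+_ (zeroˡ _)
    (trans (sum-cong (allFin n) (λ v → cong (_* f (suc v)) (δ-suc u v))) (sumF-δ u (f ∘ suc)))) (+-identityˡ _))

  size-sum : ∀ {n} (σ : Config n) → sumF (λ v → 𝟙 (lookup σ v)) ≡ # size σ
  size-sum []       = refl
  size-sum (true  ∷ σ) = trans (sumF-suc (λ v → 𝟙 (lookup (true ∷ σ) v))) (trans (cong (1# +_) (size-sum σ)) (sym (#-suc (size σ))))
  size-sum (false ∷ σ) = trans (sumF-suc (λ v → 𝟙 (lookup (false ∷ σ) v))) (trans (cong (0# +_) (size-sum σ)) (+-identityˡ _))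

  size≤n : ∀ {n} (σ : Config n) → size σ ℕ.≤ n
  size≤n []          = ℕ.z≤n
  size≤n (true  ∷ σ) = ℕ.s≤s (size≤n σ)
  size≤n (false ∷ σ) = ℕₚ.m≤n⇒m≤1+n (size≤n σ)

  add remove : ∀ {n} → Fin n → Config n → Config n
  add v σ    = σ [ v ]≔ true
  remove v σ = σ [ v ]≔ false

  size-add : ∀ {n} (v : Fin n) σ → lookup σ v ≡ false → size (add v σ) ≡ suc (size σ)
  size-add zero    (false ∷ σ) p = refl
  size-add (suc v) (true  ∷ σ) p = cong suc (size-add v σ p)
  size-add (suc v) (false ∷ σ) p = size-add v σ p

  size-remove : ∀ {n} (v : Fin n) σ → lookup σ v ≡ true → suc (size (remove v σ)) ≡ size σ
  size-remove zero    (true ∷ σ)  p = refl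
  size-remove (suc v) (true  ∷ σ) p = cong suc (size-remove v σ p)
  size-remove (suc v) (false ∷ σ) p = size-remove v σ p

  lookup-add : ∀ {n} (v : Fin n) σ → lookup (add v σ) v ≡ true
  lookup-add v σ = Vec.lookup∘updateAt v σ

  lookup-add′ : ∀ {n} {u v : Fin n} → u ≢ v → ∀ σ → lookup (add v σ) u ≡ lookup σ u
  lookup-add′ p σ = Vec.lookup∘update′ p σ true

  lookup-remove : ∀ {n} (v : Fin n) σ → lookup (remove v σ) v ≡ false
  lookup-remove v σ = Vec.lookup∘update v σ false

  lookup-remove′ : ∀ {n} {u v : Fin n} → u ≢ v → ∀ σ → lookup (remove v σ) u ≡ lookup σ u
  lookup-remove′ p σ = Vec.lookup∘update′ p σ false

  remove-add : ∀ {n} (v : Fin n) σ → lookup σ v ≡ false → remove v (add v σ) ≡ σ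
  remove-add v σ p = trans (Vec.[]≔-idempotent σ v) (trans (cong (σ [ v ]≔_) (sym p)) (Vec.[]≔-lookup σ v))

  -- Inserting `v` is a bijection from the configurations without `v` onto those with `v`. This
  -- change of variables is behind links, conditioning on a vertex and the heat-bath pairs.
  toggle : ∀ {n} (v : Fin n) (g : Config n → Carrier) →
           sumC (λ σ → 𝟙 (lookup σ v) * g σ) ≡ sumC (λ σ → 𝟙 (not (lookup σ v)) * g (add v σ))
  toggle {suc n} zero g =
    trans (sumC-suc {n} (λ σ → 𝟙 (lookup σ zero) * g σ)) (trans (trans (cong₂ _+_ z refl) (+-identityˡ _))
      (sym (trans (sumC-suc {n} (λ σ → 𝟙 (not (lookup σ zero)) * g (add zero σ))) (trans (cong₂ _+_ refl z′) (+-identityʳ _)))))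
    where
    z : sumC {n} (λ σ → 0# * g (false ∷ σ)) ≡ 0#
    z = trans (sum-cong (allConfigs n) (λ σ → zeroˡ _)) (sum-0 (allConfigs n))
    z′ : sumC {n} (λ σ → 0# * g (true ∷ σ)) ≡ 0#
    z′ = trans (sum-cong (allConfigs n) (λ σ → zeroˡ _)) (sum-0 (allConfigs n))
  toggle {suc n} (suc v) g =
    trans (sumC-suc {n} (λ σ → 𝟙 (lookup σ (suc v)) * g σ)) (trans (cong₂ _+_ (toggle v (g ∘ (false ∷_))) (toggle v (g ∘ (true ∷_))))
      (sym (sumC-suc {n} (λ σ → 𝟙 (not (lookup σ (suc v))) * g (add (suc v) σ)))))

  split : ∀ {n} (v : Fin n) (g : Config n → Carrier) →
          sumC g ≡ sumC (λ σ → 𝟙 (not (lookup σ v)) * g σ) + sumC (λ σ → 𝟙 (lookup σ v) * g σ)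
  split {n} v g = trans (sum-cong (allConfigs n) h) (sum-+ (allConfigs n) _ _)
    where
    h : ∀ σ → g σ ≡ 𝟙 (not (lookup σ v)) * g σ + 𝟙 (lookup σ v) * g σ
    h σ with lookup σ v
    ... | true  = solve 1 (λ x → x := lit 0 :* x :+ lit 1 :* x) refl (g σ)
    ... | false = solve 1 (λ x → x := lit 1 :* x :+ lit 0 :* x) refl (g σ)

  -- Integrals, second moments and Dirichlet forms

  I : ∀ {n} → (Config n → Carrier) → (Config n → Carrier) → Carrier
  I w f = sumC (λ σ → w σ * f σ)

  module _ {n : ℕ} (w : Config n → Carrier) where

    I-cong : ∀ {f g} → (∀ σ → f σ ≡ g σ) → I w f ≡ I w g
    I-cong eq = sum-cong (allConfigs n) (λ σ → cong (w σ *_) (eq σ))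

    I-+ : ∀ f g → I w (λ σ → f σ + g σ) ≡ I w f + I w g
    I-+ f g = trans (sum-cong (allConfigs n) (λ σ → distribˡ (w σ) (f σ) (g σ))) (sum-+ (allConfigs n) _ _)

    I-*ˡ : ∀ a f → I w (λ σ → a * f σ) ≡ a * I w f
    I-*ˡ a f = trans (sum-cong (allConfigs n) (λ σ → solve 3 (λ w a f → w :* (a :* f) := a :* (w :* f)) refl (w σ) a (f σ))) (sum-*ˡ (allConfigs n) a _)

    I-sum : ∀ {A : Set} (xs : List A) (f : A → Config n → Carrier) → I w (λ σ → sum xs (λ x → f x σ)) ≡ sum xs (λ x → I w (f x))
    I-sum xs f = trans (sum-cong (allConfigs n) (λ σ → sym (sum-*ˡ xs (w σ) (λ x → f x σ)))) (sum-swap (allConfigs n) xs _)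

    mass : Carrier
    mass = sumC w

    I-const : ∀ a → I w (λ _ → a) ≡ mass * a
    I-const a = sum-*ʳ (allConfigs n) a w

    I-sq-shift : ∀ f a → I w (λ σ → sq (f σ - a)) ≡ I w (λ σ → sq (f σ)) - (# 2 * a) * I w f + mass * sq a
    I-sq-shift f a = trans (I-cong (λ σ → solve 2 (λ f a → (f :- a) :* (f :- a) := f :* f :+ (:- (lit 2 :* a) :* f :+ a :* a)) refl (f σ) a))
      (trans (I-+ (sq ∘ f) _) (trans (cong (I w (sq ∘ f) +_) (trans (I-+ _ _) (cong₂ _+_ (I-*ˡ (- (# 2 * a)) f) (I-const (sq a)))))
        (solve 4 (λ x a y m → x :+ (:- (lit 2 :* a) :* y :+ m) := (x :- (lit 2 :* a) :* y) :+ m) refl (I w (sq ∘ f)) a (I w f) (mass * sq a))))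

  module _ {n : ℕ} {w : Config n → Carrier} (w≥0 : ∀ σ → 0# ≤ w σ) where

    I-mono : ∀ {f g} → (∀ σ → f σ ≤ g σ) → I w f ≤ I w g
    I-mono p = sum-mono (allConfigs n) (λ σ → *-monoˡ (w σ) (w≥0 σ) (p σ))

    I-nonneg : ∀ {f} → (∀ σ → 0# ≤ f σ) → 0# ≤ I w f
    I-nonneg p = sum-nonneg (allConfigs n) (λ σ → *-nonneg (w≥0 σ) (p σ))

    mass-nonneg : 0# ≤ mass w
    mass-nonneg = sum-nonneg (allConfigs n) w≥0

    mass-zero : mass w ≡ 0# → ∀ f → I w f ≡ 0#
    mass-zero eq f = h (allConfigs n) eq
      where
      h : ∀ xs → sum xs w ≡ 0# → sum xs (λ σ → w σ * f σ) ≡ 0#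
      h []       eq = refl
      h (x ∷ xs) eq = trans (cong₂ _+_ (trans (cong (_* f x) wx) (zeroˡ _)) (h xs rest)) (+-identityˡ 0#)
        where
        rest≥0 : 0# ≤ sum xs w
        rest≥0 = sum-nonneg xs w≥0
        wx : w x ≡ 0#
        wx = ≤-antisym (subst (w x ≤_) eq (≤-by (sum xs w) rest≥0 refl)) (w≥0 x)
        rest : sum xs w ≡ 0#
        rest = ≤-antisym (subst (sum xs w ≤_) eq (≤-by (w x) (w≥0 x) (+-comm _ _))) rest≥0

    mean : (Config n → Carrier) → Carrier
    mean f = I w f * mass w ⁻¹

    -- Zero mass does occur, at the link of a vertex outside the current subgraph. Nonnegative
    -- weights of total 0 all vanish, so both sides are then 0 whatever the inverse of 0 is.
    mean-mass : ∀ f → mean f * mass w ≡ I w f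
    mean-mass f with mass w ≟ 0#
    ... | yes eq = trans (cong (mean f *_) eq) (trans (zeroʳ _) (sym (mass-zero eq f)))
    ... | no ¬p  = trans (*-assoc _ _ _) (trans (cong (I w f *_) (⁻¹-inverseˡ ¬p)) (*-identityʳ _))

    I-centered : ∀ f → I w (λ σ → f σ - mean f) ≡ 0#
    I-centered f = trans (I-+ w f (λ _ → - mean f)) (trans (cong₂ _+_ (sym (mean-mass f)) (I-const w (- mean f)))
      (solve 2 (λ a m → a :* m :+ m :* :- a := lit 0) refl (mean f) (mass w)))

    I-sq-centered : ∀ f a → I w f ≡ 0# → I w (sq ∘ f) ≤ I w (λ σ → sq (f σ - a))
    I-sq-centered f a eq = ≤-by (mass w * sq a) (*-nonneg mass-nonneg (sq-nonneg a))
      (trans (I-sq-shift w f a) (cong (_+ mass w * sq a) (trans (cong (λ t → I w (sq ∘ f) - (# 2 * a) * t) eq)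
        (solve 2 (λ x a → x :- (lit 2 :* a) :* lit 0 := x) refl (I w (sq ∘ f)) a))))

    -- The mean `y` minimises the second moment over all centres; moving the centre to `a` adds mass
    -- · (y - a)².
    I-sq-≤ : ∀ f a y → y * mass w ≡ I w f → I w (sq ∘ f) ≤ I w (λ σ → sq (f σ - a)) + sq y * mass w
    I-sq-≤ f a y eq = ≤-by (mass w * sq (y - a)) (*-nonneg mass-nonneg (sq-nonneg (y - a)))
      (trans (cong (_+ sq y * mass w) (trans (I-sq-shift w f a) (cong (λ t → I w (sq ∘ f) - (# 2 * a) * t + mass w * sq a) (sym eq))))
        (solve 4 (λ s a y m → ((s :- (lit 2 :* a) :* (y :* m)) :+ m :* (a :* a)) :+ (y :* y) :* m := s :+ m :* ((y :- a) :* (y :- a))) refl (I w (sq ∘ f)) a y (mass w)))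

  -- Each edge of the Glauber dynamics is counted once, at the larger of its two configurations.
  grad : ∀ {n} → (Config n → Carrier) → Config n → Carrier
  grad f σ = sumF (λ u → 𝟙 (lookup σ u) * sq (f σ - f (remove u σ)))

  grad-nonneg : ∀ {n} (f : Config n → Carrier) σ → 0# ≤ grad f σ
  grad-nonneg {n} f σ = sum-nonneg (allFin n) (λ u → *-nonneg (𝟙-nonneg (lookup σ u)) (sq-nonneg _))

  grad-shift : ∀ {n} (f : Config n → Carrier) a σ → grad (λ τ → f τ - a) σ ≡ grad f σ
  grad-shift {n} f a σ = sum-cong (allFin n) (λ u → cong (λ t → 𝟙 (lookup σ u) * sq t)
    (solve 3 (λ x y a → (x :- a) :- (y :- a) := x :- y) refl (f σ) (f (remove u σ)) a))

  -- The centre is existential, so that no mean has to be formed; `I-sq-≤` and `I-sq-centered` pass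
  -- to the mean.
  Poincaré : ∀ {n} → (Config n → Carrier) → Carrier → Set
  Poincaré w B = ∀ f → ∃ λ a → I w (λ σ → sq (f σ - a)) ≤ B * I w (grad f)

  -- Localisation: revealing one slot at a time

  Family : ℕ → Set
  Family n = Config n → Bool

  link : ∀ {n} → Family n → Fin n → Family n
  link X v τ = not (lookup τ v) ∧ X (add v τ)

  wt : ∀ {n} → Family n → (ℕ → Carrier) → Config n → Carrier
  wt X c σ = 𝟙 (X σ) * c (size σ)

  wt-nonneg : ∀ {n} (X : Family n) {c} → (∀ j → 0# ≤ c j) → ∀ σ → 0# ≤ wt X c σ
  wt-nonneg X c≥0 σ = *-nonneg (𝟙-nonneg (X σ)) (c≥0 (size σ))

  occ : ∀ {n} → Fin n → Config n → Carrier
  occ v σ = 𝟙 (lookup σ v)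

  -- The link lives on configurations without `v`, so `h` has to agree with `f` only there; `pred`
  -- undoes the growth in size caused by inserting `v`.
  I-link : ∀ {n} (X : Family n) v c {h f : Config n → Carrier} →
           (∀ τ → lookup τ v ≡ false → h τ ≡ f (add v τ)) →
           I (wt (link X v) c) h ≡ sumC (λ σ → occ v σ * (wt X (c ∘ pred) σ * f σ))
  I-link {n} X v c {h} {f} eq = trans (sum-cong (allConfigs n) pt) (sym (toggle v (λ σ → wt X (c ∘ pred) σ * f σ)))
    where
    pt : ∀ τ → wt (link X v) c τ * h τ ≡ 𝟙 (not (lookup τ v)) * (wt X (c ∘ pred) (add v τ) * f (add v τ))
    pt τ with lookup τ v in p
    ... | true  = solve 3 (λ c h w → (lit 0 :* c) :* h := lit 0 :* w) refl (c (size τ)) (h τ) _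
    ... | false rewrite size-add v τ p | eq τ p = sym (*-identityˡ _)

  -- slot ρ m j is the weight of a configuration of size j when its vertices occupy distinct slots among m, each slot having fugacity ρ.
  slot : Carrier → ℕ → ℕ → Carrier
  slot ρ m       zero    = 1#
  slot ρ zero    (suc j) = 0#
  slot ρ (suc m) (suc j) = ρ * # suc m * slot ρ m j

  slot-nonneg : ∀ {ρ} → 0# ≤ ρ → ∀ m j → 0# ≤ slot ρ m j
  slot-nonneg p m       zero    = 0≤1
  slot-nonneg p zero    (suc j) = ≤-refl
  slot-nonneg p (suc m) (suc j) = *-nonneg (*-nonneg p (#-nonneg (suc m))) (slot-nonneg p m j)

  -- After j vertices are placed, the next one has m - j slots to choose from. The factor is
  -- negative for j > m, but both sides vanish there.
  slot-sucʳ : ∀ ρ m j → slot ρ m (suc j) ≡ ρ * (# m - # j) * slot ρ m j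
  slot-sucʳ ρ zero    zero    = solve 1 (λ ρ → lit 0 := ρ :* (lit 0 :- lit 0) :* lit 1) refl ρ
  slot-sucʳ ρ zero    (suc j) = solve 2 (λ ρ x → lit 0 := ρ :* x :* lit 0) refl ρ (# 0 - # suc j)
  slot-sucʳ ρ (suc m) zero    = solve 2 (λ ρ x → ρ :* x :* lit 1 := ρ :* (x :- lit 0) :* lit 1) refl ρ (# suc m)
  slot-sucʳ ρ (suc m) (suc j) = trans (cong (ρ * # suc m *_) (slot-sucʳ ρ m j)) (trans
    (solve 5 (λ ρ x m j s → ρ :* x :* (ρ :* (m :- j) :* s) := ρ :* ((lit 1 :+ m) :- (lit 1 :+ j)) :* (ρ :* x :* s)) refl ρ (# suc m) (# m) (# j) (slot ρ m j))
    (cong₂ (λ a b → ρ * (a - b) * (ρ * # suc m * slot ρ m j)) (sym (#-suc m)) (sym (#-suc j))))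

  -- The additional slot is either empty or holds one of the j vertices.
  slot-sucˡ : ∀ ρ m j → slot ρ (suc m) j ≡ slot ρ m j + ρ * # j * slot ρ m (pred j)
  slot-sucˡ ρ m zero    = solve 1 (λ ρ → lit 1 := lit 1 :+ ρ :* lit 0 :* lit 1) refl ρ
  slot-sucˡ ρ m (suc j) = trans (trans (cong (λ t → ρ * t * slot ρ m j) (#-suc m))
      (trans (solve 4 (λ ρ m j s → ρ :* (lit 1 :+ m) :* s := ρ :* (m :- j) :* s :+ ρ :* (lit 1 :+ j) :* s) refl ρ (# m) (# j) (slot ρ m j))
        (cong (λ t → ρ * (# m - # j) * slot ρ m j + ρ * t * slot ρ m j) (sym (#-suc j)))))
    (cong (_+ ρ * # suc j * slot ρ m j) (sym (slot-sucʳ ρ m j)))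

  add-remove : ∀ {n} {u v : Fin n} → u ≢ v → ∀ τ → add v (remove u τ) ≡ remove u (add v τ)
  add-remove {u = u} {v} u≢v τ = Vec.[]≔-commutes τ u v u≢v

  size≡0⇒lookup : ∀ {n} (σ : Config n) → size σ ≡ 0 → ∀ u → lookup σ u ≡ false
  size≡0⇒lookup σ eq u with lookup σ u in p
  ... | false = refl
  ... | true with trans (size-remove u σ p) eq
  ...   | ()

  grad-∅ : ∀ {n} (f : Config n → Carrier) σ → size σ ≡ 0 → grad f σ ≡ 0#
  grad-∅ {n} f σ eq = trans (sum-cong (allFin n) (λ u → trans (cong (λ b → 𝟙 b * sq (f σ - f (remove u σ))) (size≡0⇒lookup σ eq u)) (zeroˡ _))) (sum-0 (allFin n))

  module Reveal {n : ℕ} (X : Family n) (ρ : Carrier) (m : ℕ) where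

    w w₀ : Config n → Carrier
    w  = wt X (slot ρ (suc m))
    w₀ = wt X (slot ρ m)

    wᵥ : Fin n → Config n → Carrier
    wᵥ v = wt (link X v) (slot ρ m)

    w⁻ : Config n → Carrier
    w⁻ = wt X (slot ρ m ∘ pred)

    -- Total probability over the content of the revealed slot: nothing, or a vertex `v` of fugacity
    -- `ρ` that leaves its link on m slots.
    I-decompose : ∀ f → I w f ≡ I w₀ f + ρ * sumF (λ v → I (wᵥ v) (f ∘ add v))
    I-decompose f = trans (trans (sum-cong (allConfigs n) pt) (trans (sum-+ (allConfigs n) _ _) (cong (I w₀ f +_) (sum-*ˡ (allConfigs n) ρ _))))
      (cong (λ t → I w₀ f + ρ * t) (sym links))
      where
      links : sumF (λ v → I (wᵥ v) (f ∘ add v)) ≡ sumC (λ σ → # size σ * (w⁻ σ * f σ))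
      links = trans (sum-cong (allFin n) (λ v → I-link X v (slot ρ m) {f = f} (λ _ _ → refl)))
        (trans (sum-swap (allFin n) (allConfigs n) (λ v σ → occ v σ * (w⁻ σ * f σ)))
          (sum-cong (allConfigs n) (λ σ → trans (sum-*ʳ (allFin n) (w⁻ σ * f σ) (λ v → occ v σ)) (cong (_* (w⁻ σ * f σ)) (size-sum σ)))))
      pt : ∀ σ → w σ * f σ ≡ w₀ σ * f σ + ρ * (# size σ * (w⁻ σ * f σ))
      pt σ = trans (cong (λ t → 𝟙 (X σ) * t * f σ) (slot-sucˡ ρ m (size σ)))
        (solve 6 (λ x s ρ j t f → (x :* (s :+ ρ :* j :* t)) :* f := (x :* s) :* f :+ ρ :* (j :* ((x :* t) :* f))) refl
          (𝟙 (X σ)) (slot ρ m (size σ)) ρ (# size σ) (slot ρ m (pred (size σ))) (f σ))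

    -- By symmetry a present `v` is equally likely to sit in each of the m + 1 slots. Conditioning
    -- on `v` in the revealed slot is therefore the same as conditioning on `v` in the
    -- configuration, which is where spectral independence applies.
    I-occ : ∀ v f → I w (λ σ → occ v σ * f σ) ≡ ρ * # suc m * I (wᵥ v) (f ∘ add v)
    I-occ v f = trans (sum-cong (allConfigs n) pt) (trans (sum-*ˡ (allConfigs n) (ρ * # suc m) _)
      (cong (ρ * # suc m *_) (sym (I-link X v (slot ρ m) {f = f} (λ _ _ → refl)))))
      where
      pt : ∀ σ → w σ * (occ v σ * f σ) ≡ ρ * # suc m * (occ v σ * (w⁻ σ * f σ))
      pt σ with lookup σ v in p
      ... | false = solve 4 (λ w f a b → w :* (lit 0 :* f) := a :* (lit 0 :* b)) refl (w σ) (f σ) (ρ * # suc m) (w⁻ σ * f σ)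
      ... | true rewrite sym (size-remove v σ p) = solve 4 (λ x a s f → (x :* (a :* s)) :* (lit 1 :* f) := a :* (lit 1 :* ((x :* s) :* f))) refl (𝟙 (X σ)) (ρ * # suc m) (slot ρ m (size (remove v σ))) (f σ)

    -- A vertex of the configuration survives the revelation of a uniform slot with probability 1 - 1/(m+1).
    I-grad : ∀ f → # suc m * (I w₀ (grad f) + ρ * sumF (λ v → I (wᵥ v) (grad (f ∘ add v)))) ≡ # m * I w (grad f)
    I-grad f = trans (cong (λ t → # suc m * (I w₀ (grad f) + ρ * t)) links)
      (trans (cong (# suc m *_) (trans (cong (I w₀ (grad f) +_) (sym (sum-*ˡ (allConfigs n) ρ _))) (sym (sum-+ (allConfigs n) _ _))))
        (trans (sym (sum-*ˡ (allConfigs n) (# suc m) _)) (trans (sum-cong (allConfigs n) pt) (sum-*ˡ (allConfigs n) (# m) _))))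
      where
      g : Fin n → Config n → Carrier
      g u σ = sq (f σ - f (remove u σ))

      others : Fin n → Config n → Carrier
      others v σ = sumF (λ u → (1# - δ u v) * (occ u σ * g u σ))

      grad-add : ∀ v τ → lookup τ v ≡ false → grad (f ∘ add v) τ ≡ others v (add v τ)
      grad-add v τ p = sum-cong (allFin n) q
        where
        q : ∀ u → occ u τ * sq (f (add v τ) - f (add v (remove u τ))) ≡ (1# - δ u v) * (occ u (add v τ) * g u (add v τ))
        q u with u Fin.≟ v
        ... | yes refl rewrite p = solve 2 (λ a b → lit 0 :* a := (lit 1 :- lit 1) :* b) refl _ _
        ... | no u≢v rewrite lookup-add′ u≢v τ | add-remove u≢v τ = solve 1 (λ a → a := (lit 1 :- lit 0) :* a) refl _

      -- Each vertex of σ is counted once for every other vertex of σ that may be the revealed one.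
      count-others : ∀ σ → sumF (λ v → occ v σ * others v σ) ≡ (# size σ - 1#) * grad f σ
      count-others σ = trans (sum-cong (allFin n) (λ v → sym (sum-*ˡ (allFin n) (occ v σ) _)))
        (trans (sum-swap (allFin n) (allFin n) (λ v u → occ v σ * ((1# - δ u v) * (occ u σ * g u σ))))
          (trans (sum-cong (allFin n) inner) (sum-*ˡ (allFin n) (# size σ - 1#) _)))
        where
        inner : ∀ u → sumF (λ v → occ v σ * ((1# - δ u v) * (occ u σ * g u σ))) ≡ (# size σ - 1#) * (occ u σ * g u σ)
        inner u = trans (sum-cong (allFin n) (λ v → solve 3 (λ o d k → o :* ((lit 1 :- d) :* k) := o :* k :+ d :* (:- (o :* k))) refl (occ v σ) (δ u v) (occ u σ * g u σ)))
          (trans (sum-+ (allFin n) _ _) (trans (cong₂ _+_ (trans (sum-*ʳ (allFin n) _ (λ v → occ v σ)) (cong (_* (occ u σ * g u σ)) (size-sum σ))) (sumF-δ u (λ v → - (occ v σ * (occ u σ * g u σ)))))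
            fin))
          where
          fin : # size σ * (occ u σ * g u σ) + (- (occ u σ * (occ u σ * g u σ))) ≡ (# size σ - 1#) * (occ u σ * g u σ)
          fin with lookup σ u
          ... | true  = solve 2 (λ j g → j :* (lit 1 :* g) :+ (:- (lit 1 :* (lit 1 :* g))) := (j :- lit 1) :* (lit 1 :* g)) refl (# size σ) (g u σ)
          ... | false = solve 2 (λ j g → j :* (lit 0 :* g) :+ (:- (lit 0 :* (lit 0 :* g))) := (j :- lit 1) :* (lit 0 :* g)) refl (# size σ) (g u σ)

      links : sumF (λ v → I (wᵥ v) (grad (f ∘ add v))) ≡ sumC (λ σ → w⁻ σ * ((# size σ - 1#) * grad f σ))
      links = trans (sum-cong (allFin n) (λ v → I-link X v (slot ρ m) {f = others v} (grad-add v)))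
        (trans (sum-swap (allFin n) (allConfigs n) (λ v σ → occ v σ * (w⁻ σ * others v σ)))
          (sum-cong (allConfigs n) (λ σ → trans (sum-cong (allFin n) (λ v → solve 3 (λ o w t → o :* (w :* t) := w :* (o :* t)) refl (occ v σ) (w⁻ σ) (others v σ)))
            (trans (sum-*ˡ (allFin n) (w⁻ σ) _) (cong (w⁻ σ *_) (count-others σ))))))

      pt : ∀ σ → # suc m * (w₀ σ * grad f σ + ρ * (w⁻ σ * ((# size σ - 1#) * grad f σ))) ≡ # m * (w σ * grad f σ)
      pt σ with size σ in eq
      ... | zero rewrite grad-∅ f σ eq = solve 7 (λ M a ρ b c m e → M :* (a :* lit 0 :+ ρ :* (b :* (c :* lit 0))) := m :* (e :* lit 0)) refl (# suc m) _ ρ _ _ (# m) _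
      -- At size j + 1 the empty revealed slot contributes m - j and the occupied one contributes j,
      -- which add up to m.
      ... | suc j = trans (cong₂ (λ s k → # suc m * ((𝟙 (X σ) * s) * grad f σ + ρ * ((𝟙 (X σ) * slot ρ m j) * ((k - 1#) * grad f σ)))) (slot-sucʳ ρ m j) (#-suc j))
        (solve 7 (λ M x ρ m j s D → M :* ((x :* (ρ :* (m :- j) :* s)) :* D :+ ρ :* ((x :* s) :* (((lit 1 :+ j) :- lit 1) :* D))) := m :* ((x :* (ρ :* M :* s)) :* D)) refl
          (# suc m) (𝟙 (X σ)) ρ (# m) (# j) (slot ρ m j) (grad f σ))

  -- Spectral independence and one localisation step

  lin : ∀ {n} → (Fin n → Carrier) → Config n → Carrier
  lin a σ = sumF (λ v → a v * occ v σ)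

  -- Up to normalisation, the covariance matrix is at most η times the diagonal matrix of the
  -- marginals, as a quadratic form.
  SpectrallyIndependent : ∀ {n} → (Config n → Carrier) → Carrier → Set
  SpectrallyIndependent w η = ∀ a → ∃ λ b → I w (λ σ → sq (lin a σ - b)) ≤ η * sumF (λ v → sq (a v) * I w (occ v))

  -- Duality: the operator f ↦ (E[f | v])ᵥ and its adjoint a ↦ lin a have the same norm on centred functions.
  spectral-dual : ∀ {n} {w : Config n → Carrier} → (∀ σ → 0# ≤ w σ) → ∀ {η} → Pos η → SpectrallyIndependent w η →
    ∀ f → I w f ≡ 0# → ∀ y → (∀ v → y v * I w (occ v) ≡ I w (λ σ → occ v σ * f σ)) →
    sumF (λ v → sq (y v) * I w (occ v)) ≤ η * I w (sq ∘ f)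
  spectral-dual {n} {w} w≥0 {η} η>0 si f cen y cond = *-cancel-≤ η>0 (begin
      -- The integral of (η f - (lin y - b))² is η² F - 2 η x + V, because its cross term is x;
      -- spectral independence gives V ≤ η x.
      η * x ≤⟨ ≤-by _ (I-nonneg w≥0 (λ σ → sq-nonneg (η * f σ - (lin y σ - b)))) expand ⟩
      η * (η * F) + (V - η * x) ≤⟨ +-mono ≤-refl (+-monoˡ-≤ (- (η * x)) hb) ⟩
      η * (η * F) + (η * x - η * x) ≡⟨ solve 2 (λ a b → a :+ (b :- b) := a) refl (η * (η * F)) (η * x) ⟩
      η * (η * F) ∎)
    where
    b = proj₁ (si y)
    hb = proj₂ (si y)
    x = sumF (λ v → sq (y v) * I w (occ v))
    F = I w (sq ∘ f)
    V = I w (λ σ → sq (lin y σ - b))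
    cross : I w (λ σ → f σ * (lin y σ - b)) ≡ x
    cross = trans (I-cong w (λ σ → solve 3 (λ f l b → f :* (l :- b) := f :* l :+ (:- b) :* f) refl (f σ) (lin y σ) b))
      (trans (I-+ w _ _) (trans (cong₂ _+_
        (trans (I-cong w (λ σ → trans (sym (sum-*ˡ (allFin n) (f σ) _)) (sum-cong (allFin n) (λ v → solve 3 (λ f y o → f :* (y :* o) := y :* (o :* f)) refl (f σ) (y v) (occ v σ)))))
          (trans (I-sum w (allFin n) (λ v σ → y v * (occ v σ * f σ))) (sum-cong (allFin n) (λ v → trans (I-*ˡ w (y v) _) (trans (cong (y v *_) (sym (cond v))) (sym (*-assoc _ _ _)))))))
        (trans (I-*ˡ w (- b) f) (trans (cong (- b *_) cen) (zeroʳ _)))) (+-identityʳ _)))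
    expand : η * (η * F) + (V - η * x) ≡ η * x + I w (λ σ → sq (η * f σ - (lin y σ - b)))
    expand = sym (trans (cong (η * x +_) (trans (I-cong w (λ σ → solve 3 (λ η f l → (η :* f :- l) :* (η :* f :- l) := (η :* η) :* (f :* f) :+ ((:- (lit 2 :* η)) :* (f :* l) :+ l :* l)) refl η (f σ) (lin y σ - b)))
      (trans (I-+ w _ _) (cong₂ _+_ (I-*ˡ w (η * η) (sq ∘ f)) (trans (I-+ w _ _) (cong (_+ V) (trans (I-*ˡ w (- (# 2 * η)) _) (cong (- (# 2 * η) *_) cross))))))))
      (solve 4 (λ η F V x → η :* x :+ ((η :* η) :* F :+ ((:- (lit 2 :* η)) :* x :+ V)) := η :* (η :* F) :+ (V :- η :* x)) refl η F V x))

  -- The variance E splits into conditional variances, controlled by `B`, and the variance y₀² Q₀ +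
  -- x of the conditional means. The latter is at most η E / (M - N), and `I-grad` leaves m / M of
  -- the Dirichlet form; the last hypothesis is the resulting ratio, cleared of denominators.
  localise : ∀ {n} (X : Family (suc n)) {ρ} → 0# ≤ ρ → ∀ m {B B′ η} → 0# ≤ B → Pos η →
    let N = # suc n ; M = # suc m in
    SpectrallyIndependent (wt X (slot ρ (suc m))) η →
    Poincaré (wt X (slot ρ m)) B → (∀ v → Poincaré (wt (link X v) (slot ρ m)) B) →
    Pos (M - N) → Pos (M - N - η) → B * # m * (M - N) ≤ B′ * (M * (M - N - η)) →
    Poincaré (wt X (slot ρ (suc m))) B′
  localise {n} X {ρ} ρ≥0 m {B} {B′} {η} B≥0 η>0 si pc₀ pcᵥ gap gapη BB f = a , *-cancel-≤ (*-pos (#-pos m) gapη) (begin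
      M * (M - N - η) * E ≡⟨ solve 4 (λ M g η E → M :* (g :- η) :* E := M :* (g :* E :- η :* E)) refl M (M - N) η E ⟩
      M * ((M - N) * E - η * E) ≤⟨ *-monoˡ M (#-nonneg (suc m)) upper ⟩
      M * ((M - N) * (B * G)) ≡⟨ solve 4 (λ M g B G → M :* (g :* (B :* G)) := B :* g :* (M :* G)) refl M (M - N) B G ⟩
      B * (M - N) * (M * G) ≡⟨ cong (B * (M - N) *_) (trans (I-grad f̄) (cong (# m *_) (I-cong w (grad-shift f a)))) ⟩
      B * (M - N) * (# m * D) ≡⟨ solve 4 (λ B g m D → B :* g :* (m :* D) := B :* m :* g :* D) refl B (M - N) (# m) D ⟩
      B * # m * (M - N) * D ≤⟨ *-monoʳ D (I-nonneg w≥0 (grad-nonneg f)) BB ⟩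
      B′ * (M * (M - N - η)) * D ≡⟨ solve 3 (λ B k D → B :* k :* D := k :* (B :* D)) refl B′ (M * (M - N - η)) D ⟩
      M * (M - N - η) * (B′ * D) ∎)
    where
    open Reveal X ρ m
    N = # suc n
    M = # suc m
    w≥0 = wt-nonneg X (slot-nonneg ρ≥0 (suc m))
    w₀≥0 = wt-nonneg X (slot-nonneg ρ≥0 m)
    wᵥ≥0 = λ v → wt-nonneg (link X v) (slot-nonneg ρ≥0 m)
    a = mean w≥0 f
    f̄ = λ σ → f σ - a
    E = I w (sq ∘ f̄)
    D = I w (grad f)
    G = I w₀ (grad f̄) + ρ * sumF (λ v → I (wᵥ v) (grad (f̄ ∘ add v)))
    y₀ = mean w₀≥0 f̄
    y : Fin (suc n) → Carrier
    y v = mean (wᵥ≥0 v) (f̄ ∘ add v)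
    Q₀ = mass w₀
    Q : Fin (suc n) → Carrier
    Q v = mass (wᵥ v)
    x = ρ * sumF (λ v → sq (y v) * Q v)
    q = ρ * sumF Q
    s = ρ * sumF (λ v → y v * Q v)
    W : Fin (suc n) → Carrier
    W v = I w (occ v)
    W≡ : ∀ v → W v ≡ ρ * M * Q v
    W≡ v = trans (I-cong w (λ σ → sym (*-identityʳ (occ v σ)))) (trans (I-occ v (λ _ → 1#)) (cong (ρ * M *_) (trans (I-const (wᵥ v) 1#) (*-identityʳ _))))
    y-cond : ∀ v → y v * W v ≡ I w (λ σ → occ v σ * f̄ σ)
    y-cond v = trans (trans (cong (y v *_) (W≡ v)) (solve 3 (λ y r Q → y :* (r :* Q) := r :* (y :* Q)) refl (y v) (ρ * M) (Q v)))
      (trans (cong (ρ * M *_) (mean-mass (wᵥ≥0 v) (f̄ ∘ add v))) (sym (I-occ v f̄)))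
    Mx≤ : M * x ≤ η * E
    Mx≤ = subst (_≤ η * E) (trans (sum-cong (allFin (suc n)) (λ v → trans (cong (sq (y v) *_) (W≡ v)) (solve 3 (λ a r Q → a :* (r :* Q) := r :* (a :* Q)) refl (sq (y v)) (ρ * M) (Q v))))
        (trans (sum-*ˡ (allFin (suc n)) (ρ * M) _) (solve 3 (λ r M S → r :* M :* S := M :* (r :* S)) refl ρ M (sumF (λ v → sq (y v) * Q v)))))
      (spectral-dual w≥0 η>0 si f̄ (I-centered w≥0 f) y y-cond)
    y₀Q₀ : y₀ * Q₀ ≡ - s
    y₀Q₀ = trans (mean-mass w₀≥0 f̄) (trans (trans (solve 2 (λ a s → a := (a :+ s) :- s) refl (I w₀ f̄) s)
      (cong (_- s) (trans (cong (λ t → I w₀ f̄ + ρ * t) (sum-cong (allFin (suc n)) (λ v → mean-mass (wᵥ≥0 v) (f̄ ∘ add v)))) (trans (sym (I-decompose f̄)) (I-centered w≥0 f)))))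
      (solve 1 (λ s → lit 0 :- s := :- s) refl s))
    mass≡ : mass w ≡ Q₀ + q
    mass≡ = trans (sym (trans (I-const w 1#) (*-identityʳ _))) (trans (I-decompose (λ _ → 1#))
      (cong₂ (λ a b → a + ρ * b) (trans (I-const w₀ 1#) (*-identityʳ _)) (sum-cong (allFin (suc n)) (λ v → trans (I-const (wᵥ v) 1#) (*-identityʳ _)))))
    -- `M * q` is the integral of the size of a configuration, which is at most `N`.
    q≤ : (M - N) * q ≤ N * Q₀
    q≤ = ≤-by (N * mass w - M * q) (≤⇒0≤- h) (trans (solve 4 (λ M N q Q → N :* Q := (M :- N) :* q :+ (N :* (Q :+ q) :- M :* q)) refl M N q Q₀) (cong (λ t → (M - N) * q + (N * t - M * q)) (sym mass≡)))
      where
      h : M * q ≤ N * mass w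
      h = subst₂ _≤_ (trans (sum-cong (allFin (suc n)) W≡) (trans (sum-*ˡ (allFin (suc n)) (ρ * M) Q) (solve 3 (λ r M S → r :* M :* S := M :* (r :* S)) refl ρ M (sumF Q)))) (sumF-const (suc n) (mass w))
        (sum-mono (allFin (suc n)) (λ v → ≤-trans (I-mono w≥0 (λ σ → 𝟙-≤1 (lookup σ v))) (≤-reflexive (trans (I-const w 1#) (*-identityʳ _)))))
    -- Centring gives y₀ Q₀ = - s, and Cauchy-Schwarz would give s² ≤ q x. Both are used at once
    -- through the nonnegative sum of the Q v (N y v + g y₀)², whose weights N and g fit the bound g
    -- q ≤ N Q₀.
    y₀≤ : (M - N) * (sq y₀ * Q₀) ≤ N * x
    y₀≤ = *-cancel-≤ (#-pos n) (begin
      N * ((M - N) * (sq y₀ * Q₀)) ≤⟨ ≤-by _ (*-nonneg ρ≥0 (sum-nonneg (allFin (suc n)) (λ v → *-nonneg (mass-nonneg (wᵥ≥0 v)) (sq-nonneg (N * y v + g * y₀))))) expand ⟩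
      N * (N * x) + (g * (g * sq y₀ * q) - N * (g * (sq y₀ * Q₀))) ≤⟨ +-mono ≤-refl (+-monoˡ-≤ _ (*-monoˡ g (proj₁ gap) (≤-trans (≤-reflexive (solve 3 (λ g y q → g :* y :* q := y :* (g :* q)) refl g (sq y₀) q)) (*-monoˡ (sq y₀) (sq-nonneg y₀) q≤)))) ⟩
      N * (N * x) + (g * (sq y₀ * (N * Q₀)) - N * (g * (sq y₀ * Q₀))) ≡⟨ solve 5 (λ N x g y Q → N :* (N :* x) :+ (g :* (y :* (N :* Q)) :- N :* (g :* (y :* Q))) := N :* (N :* x)) refl N x g (sq y₀) Q₀ ⟩
      N * (N * x) ∎)
      where
      g = M - N
      expand : N * (N * x) + (g * (g * sq y₀ * q) - N * (g * (sq y₀ * Q₀))) ≡ N * (g * (sq y₀ * Q₀)) + ρ * sumF (λ v → Q v * sq (N * y v + g * y₀))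
      expand = sym (trans (cong (λ t → N * (g * (sq y₀ * Q₀)) + ρ * t) (trans (sum-cong (allFin (suc n)) (λ v → solve 5 (λ Q N y g z → Q :* ((N :* y :+ g :* z) :* (N :* y :+ g :* z)) := (N :* N) :* (y :* y :* Q) :+ ((lit 2 :* (N :* (g :* z))) :* (y :* Q) :+ (g :* g :* (z :* z)) :* Q)) refl (Q v) N (y v) g y₀))
        (trans (sum-+ (allFin (suc n)) _ _) (cong₂ _+_ (sum-*ˡ (allFin (suc n)) (N * N) _) (trans (sum-+ (allFin (suc n)) _ _) (cong₂ _+_ (sum-*ˡ (allFin (suc n)) (# 2 * (N * (g * y₀))) _) (sum-*ˡ (allFin (suc n)) (g * g * (y₀ * y₀)) Q)))))))
        (trans (solve 8 (λ N g z Q ρ X S q → N :* (g :* (z :* z :* Q)) :+ ρ :* ((N :* N) :* X :+ ((lit 2 :* (N :* (g :* z))) :* S :+ (g :* g :* (z :* z)) :* q))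
              := N :* (g :* (z :* (z :* Q))) :+ (N :* (N :* (ρ :* X)) :+ (lit 2 :* (N :* (g :* z)) :* (ρ :* S) :+ g :* (g :* (z :* z) :* (ρ :* q))))) refl N g y₀ Q₀ ρ (sumF (λ v → sq (y v) * Q v)) (sumF (λ v → y v * Q v)) (sumF Q))
          (trans (cong₂ (λ t u → N * (g * (y₀ * t)) + (N * (N * x) + (# 2 * (N * (g * y₀)) * u + g * (g * sq y₀ * q)))) y₀Q₀ (refl {x = s}))
            (trans (solve 7 (λ N g z s t x k → N :* (g :* (z :* (:- s))) :+ (N :* (N :* x) :+ (lit 2 :* (N :* (g :* z)) :* s :+ k)) := N :* (N :* x) :+ (k :- N :* (g :* (z :* (:- s))))) refl N g y₀ s s x (g * (g * sq y₀ * q)))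
              (trans (cong (λ t → N * (N * x) + (g * (g * sq y₀ * q) - N * (g * (y₀ * t)))) (sym y₀Q₀)) (cong (λ t → N * (N * x) + (g * (g * sq y₀ * q) - N * (g * t))) (sym (*-assoc y₀ y₀ Q₀))))))))
    E≤ : E ≤ B * G + (sq y₀ * Q₀ + x)
    E≤ = begin
      E ≡⟨ I-decompose (sq ∘ f̄) ⟩
      I w₀ (sq ∘ f̄) + ρ * sumF (λ v → I (wᵥ v) (sq ∘ f̄ ∘ add v)) ≤⟨ +-mono p₀ (*-monoˡ ρ ρ≥0 (sum-mono (allFin (suc n)) pv)) ⟩
      (B * I w₀ (grad f̄) + sq y₀ * Q₀) + ρ * sumF (λ v → B * I (wᵥ v) (grad (f̄ ∘ add v)) + sq (y v) * Q v)
        ≡⟨ cong (λ t → (B * I w₀ (grad f̄) + sq y₀ * Q₀) + ρ * t) (trans (sum-+ (allFin (suc n)) _ _) (cong (_+ sumF (λ v → sq (y v) * Q v)) (sum-*ˡ (allFin (suc n)) B _))) ⟩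
      (B * I w₀ (grad f̄) + sq y₀ * Q₀) + ρ * (B * sumF (λ v → I (wᵥ v) (grad (f̄ ∘ add v))) + sumF (λ v → sq (y v) * Q v))
        ≡⟨ solve 6 (λ B a z ρ S X → (B :* a :+ z) :+ ρ :* (B :* S :+ X) := B :* (a :+ ρ :* S) :+ (z :+ ρ :* X)) refl B (I w₀ (grad f̄)) (sq y₀ * Q₀) ρ (sumF (λ v → I (wᵥ v) (grad (f̄ ∘ add v)))) (sumF (λ v → sq (y v) * Q v)) ⟩
      B * G + (sq y₀ * Q₀ + x) ∎
      where
      p₀ : I w₀ (sq ∘ f̄) ≤ B * I w₀ (grad f̄) + sq y₀ * Q₀
      p₀ with pc₀ f̄
      ... | b , h = ≤-trans (I-sq-≤ w₀≥0 f̄ b y₀ (mean-mass w₀≥0 f̄)) (+-monoˡ-≤ _ h)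
      pv : ∀ v → I (wᵥ v) (sq ∘ f̄ ∘ add v) ≤ B * I (wᵥ v) (grad (f̄ ∘ add v)) + sq (y v) * Q v
      pv v with pcᵥ v (f̄ ∘ add v)
      ... | b , h = ≤-trans (I-sq-≤ (wᵥ≥0 v) (f̄ ∘ add v) b (y v) (mean-mass (wᵥ≥0 v) (f̄ ∘ add v))) (+-monoˡ-≤ _ h)
    upper : (M - N) * E - η * E ≤ (M - N) * (B * G)
    upper = begin
      (M - N) * E - η * E ≤⟨ +-monoˡ-≤ _ (*-monoˡ (M - N) (proj₁ gap) E≤) ⟩
      (M - N) * (B * G + (sq y₀ * Q₀ + x)) - η * E ≡⟨ solve 5 (λ g b z x e → g :* (b :+ (z :+ x)) :- e := g :* b :+ ((g :* z :+ g :* x) :- e)) refl (M - N) (B * G) (sq y₀ * Q₀) x (η * E) ⟩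
      (M - N) * (B * G) + (((M - N) * (sq y₀ * Q₀) + (M - N) * x) - η * E) ≤⟨ +-mono ≤-refl (+-mono (+-monoˡ-≤ ((M - N) * x) y₀≤) (≤-refl {x = - (η * E)})) ⟩
      (M - N) * (B * G) + ((N * x + (M - N) * x) - η * E) ≡⟨ solve 5 (λ b N x M e → b :+ ((N :* x :+ (M :- N) :* x) :- e) := b :+ (M :* x :- e)) refl ((M - N) * (B * G)) N x M (η * E) ⟩
      (M - N) * (B * G) + (M * x - η * E) ≤⟨ +-mono ≤-refl (+-monoˡ-≤ (- (η * E)) Mx≤) ⟩
      (M - N) * (B * G) + (η * E - η * E) ≡⟨ solve 2 (λ b e → b :+ (e :- e) := b) refl ((M - N) * (B * G)) (η * E) ⟩
      (M - N) * (B * G) ∎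

  -- Poincaré inequality for sparse weights

  DownClosed : ∀ {n} → Family n → Set
  DownClosed X = ∀ v σ → T (X σ) → T (X (remove v σ))

  -- Take φ = f - f(∅), which vanishes at the only configuration without a vertex to remove.
  -- Splitting φ(σ) at the removal of each v in σ gives S ≤ 2 D + 2 S′. In S′ the set without v can
  -- be extended by at most N vertices, each time with weight at most 1/(4N) of its own, so S′ ≤ S /
  -- 4 is absorbed.
  poincaré-sparse : ∀ {n} (X : Family (suc n)) → DownClosed X → ∀ {c} → (∀ j → 0# ≤ c j) →
    (∀ j → # 4 * # suc n * c (suc j) ≤ c j) → Poincaré (wt X c) (# 4)
  poincaré-sparse {n} X down {c} c≥0 sparse f = f∅ , *-cancel-≤ (#-pos 1) (begin
      # 2 * S ≡⟨ solve 1 (λ s → lit 2 :* s := lit 4 :* s :- lit 2 :* s) refl S ⟩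
      # 4 * S - # 2 * S ≤⟨ +-monoˡ-≤ _ (*-monoˡ (# 4) (#-nonneg 4) S≤) ⟩
      # 4 * (# 2 * D + # 2 * S′) - # 2 * S ≡⟨ solve 3 (λ d s t → lit 4 :* (lit 2 :* d :+ lit 2 :* t) :- lit 2 :* s := lit 8 :* d :+ (lit 2 :* (lit 4 :* t) :- lit 2 :* s)) refl D S S′ ⟩
      # 8 * D + (# 2 * (# 4 * S′) - # 2 * S) ≤⟨ +-mono ≤-refl (+-monoˡ-≤ _ (*-monoˡ (# 2) (#-nonneg 2) S′≤)) ⟩
      # 8 * D + (# 2 * S - # 2 * S) ≡⟨ solve 2 (λ d s → lit 8 :* d :+ (s :- s) := lit 2 :* (lit 4 :* d)) refl D (# 2 * S) ⟩
      # 2 * (# 4 * D) ∎)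
    where
    w = wt X c
    w≥0 = wt-nonneg X c≥0
    f∅ = f (replicate (suc n) false)
    φ : Config (suc n) → Carrier
    φ σ = f σ - f∅
    S = I w (sq ∘ φ)
    D = I w (grad f)
    S′ = sumF (λ v → sumC (λ σ → occ v σ * (w σ * sq (φ (remove v σ)))))
    empty : ∀ {k} (σ : Config k) → size σ ≡ 0 → σ ≡ replicate k false
    empty []          eq = refl
    empty (false ∷ σ) eq = cong (false ∷_) (empty σ eq)
    φ≤ : ∀ σ → sq (φ σ) ≤ sumF (λ v → occ v σ * sq (φ σ))
    φ≤ σ = ≤-trans h (≤-reflexive (trans (cong (_* sq (φ σ)) (sym (size-sum σ))) (sym (sum-*ʳ (allFin (suc n)) (sq (φ σ)) (λ v → occ v σ)))))
      where
      h : sq (φ σ) ≤ # size σ * sq (φ σ)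
      h with size σ in eq
      ... | zero  rewrite empty σ eq = ≤-reflexive (solve 1 (λ a → (a :- a) :* (a :- a) := lit 0 :* ((a :- a) :* (a :- a))) refl f∅)
      ... | suc k = ≤-trans (≤-reflexive (sym (*-identityˡ _))) (*-monoʳ _ (sq-nonneg (φ σ)) (#-mono {1} {suc k} (ℕ.s≤s ℕ.z≤n)))
    two : ∀ σ v → occ v σ * sq (φ σ) ≤ # 2 * (occ v σ * sq (f σ - f (remove v σ))) + # 2 * (occ v σ * sq (φ (remove v σ)))
    two σ v = ≤-by (occ v σ * sq ((f σ - f (remove v σ)) - φ (remove v σ))) (*-nonneg (𝟙-nonneg (lookup σ v)) (sq-nonneg _))
      (solve 4 (λ o x y z → lit 2 :* (o :* ((x :- y) :* (x :- y))) :+ lit 2 :* (o :* ((y :- z) :* (y :- z))) := o :* ((x :- z) :* (x :- z)) :+ o :* (((x :- y) :- (y :- z)) :* ((x :- y) :- (y :- z)))) refl (occ v σ) (f σ) (f (remove v σ)) f∅)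
    S≤ : S ≤ # 2 * D + # 2 * S′
    S≤ = ≤-trans (I-mono w≥0 (λ σ → ≤-trans (φ≤ σ) (sum-mono (allFin (suc n)) (two σ)))) (≤-reflexive
      (trans (I-cong w (λ σ → trans (sum-+ (allFin (suc n)) _ _) (cong₂ _+_ (sum-*ˡ (allFin (suc n)) (# 2) _) (sum-*ˡ (allFin (suc n)) (# 2) _))))
        (trans (I-+ w _ _) (cong₂ _+_ (I-*ˡ w (# 2) (grad f)) (trans (I-*ˡ w (# 2) _) (cong (# 2 *_)
          (trans (I-sum w (allFin (suc n)) (λ v σ → occ v σ * sq (φ (remove v σ)))) (sum-cong (allFin (suc n)) (λ v → sum-cong (allConfigs (suc n)) (λ σ → solve 3 (λ w o s → w :* (o :* s) := o :* (w :* s)) refl (w σ) (occ v σ) (sq (φ (remove v σ)))))))))))))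
    S′≤ : # 4 * S′ ≤ S
    S′≤ = *-cancel-≤ (#-pos n) (begin
      # suc n * (# 4 * S′) ≡⟨ trans (solve 2 (λ N S → N :* (lit 4 :* S) := (lit 4 :* N) :* S) refl (# suc n) S′) (sym (sum-*ˡ (allFin (suc n)) (# 4 * # suc n) _)) ⟩
      sumF (λ v → (# 4 * # suc n) * sumC (λ σ → occ v σ * (w σ * sq (φ (remove v σ))))) ≤⟨ sum-mono (allFin (suc n)) one ⟩
      sumF {suc n} (λ _ → S) ≡⟨ sumF-const (suc n) S ⟩
      # suc n * S ∎)
      where
      one : ∀ v → (# 4 * # suc n) * sumC (λ σ → occ v σ * (w σ * sq (φ (remove v σ)))) ≤ S
      one v = begin
        (# 4 * # suc n) * sumC (λ σ → occ v σ * (w σ * sq (φ (remove v σ)))) ≡⟨ cong (# 4 * # suc n *_) (toggle v (λ σ → w σ * sq (φ (remove v σ)))) ⟩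
        (# 4 * # suc n) * sumC (λ σ → 𝟙 (not (lookup σ v)) * (w (add v σ) * sq (φ (remove v (add v σ))))) ≡⟨ sym (sum-*ˡ (allConfigs (suc n)) (# 4 * # suc n) _) ⟩
        sumC (λ σ → (# 4 * # suc n) * (𝟙 (not (lookup σ v)) * (w (add v σ) * sq (φ (remove v (add v σ)))))) ≤⟨ sum-mono (allConfigs (suc n)) pt ⟩
        S ∎
        where
        pt : ∀ σ → (# 4 * # suc n) * (𝟙 (not (lookup σ v)) * (w (add v σ) * sq (φ (remove v (add v σ))))) ≤ w σ * sq (φ σ)
        pt σ with lookup σ v in p
        ... | true  = ≤-trans (≤-reflexive (solve 2 (λ a b → a :* (lit 0 :* b) := lit 0) refl (# 4 * # suc n) _)) (*-nonneg (w≥0 σ) (sq-nonneg (φ σ)))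
        ... | false rewrite remove-add v σ p | size-add v σ p = ≤-trans (≤-reflexive (solve 4 (λ a x c s → a :* (lit 1 :* ((x :* c) :* s)) := x :* (a :* c) :* s) refl (# 4 * # suc n) (𝟙 (X (add v σ))) (c (suc (size σ))) (sq (φ σ))))
            (*-monoʳ _ (sq-nonneg (φ σ)) (*-mono (𝟙-nonneg (X (add v σ))) (c≥0 (size σ)) 𝟙≤ (sparse (size σ))))
          where
          𝟙≤ : 𝟙 (X (add v σ)) ≤ 𝟙 (X σ)
          𝟙≤ with X (add v σ) in eq | X σ in eq′
          ... | false | b     = 𝟙-nonneg b
          ... | true  | true  = ≤-refl
          ... | true  | false = ⊥-elim (subst T (trans (cong X (remove-add v σ p)) eq′) (down v (add v σ) (subst T (sym eq) _)))

  -- Spectral independence of the hardcore model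

  T⇒≡ : ∀ {b} → T b → b ≡ true
  T⇒≡ {true} _ = refl

  ≡⇒T : ∀ {b} → b ≡ true → T b
  ≡⇒T refl = _

  bool-ext : ∀ {a b} → (T a → T b) → (T b → T a) → a ≡ b
  bool-ext {true}  {true}  f g = refl
  bool-ext {true}  {false} f g = ⊥-elim (f _)
  bool-ext {false} {true}  f g = ⊥-elim (g _)
  bool-ext {false} {false} f g = refl

  ∧-T⁻ : ∀ {a b} → T (a ∧ b) → T a × T b
  ∧-T⁻ {true} p = _ , p

  ∧-T⁺ : ∀ {a b} → T a → T b → T (a ∧ b)
  ∧-T⁺ {true} _ q = q

  allB⁻ : ∀ {A : Set} (p : A → Bool) xs → T (allB p xs) → ∀ {x} → x ∈ xs → T (p x)
  allB⁻ p (x ∷ xs) h (here refl) = proj₁ (∧-T⁻ h)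
  allB⁻ p (x ∷ xs) h (there m)   = allB⁻ p xs (proj₂ (∧-T⁻ {p x} h)) m

  allB⁺ : ∀ {A : Set} (p : A → Bool) xs → (∀ x → T (p x)) → T (allB p xs)
  allB⁺ p []       h = _
  allB⁺ p (x ∷ xs) h = ∧-T⁺ (h x) (allB⁺ p xs h)

  sumC-single : ∀ {n} {g : Config n → Carrier} → (∀ σ → 0# ≤ g σ) → ∀ σ → g σ ≤ sumC g
  sumC-single {g = g} p [] = ≤-reflexive (sym (+-identityʳ (g [])))
  sumC-single {suc n} {g} p (false ∷ σ) = ≤-trans (sumC-single (p ∘ (false ∷_)) σ)
    (≤-by _ (sum-nonneg (allConfigs n) (p ∘ (true ∷_))) (sumC-suc {n} g))
  sumC-single {suc n} {g} p (true ∷ σ) = ≤-trans (sumC-single (p ∘ (true ∷_)) σ)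
    (≤-by _ (sum-nonneg (allConfigs n) (p ∘ (false ∷_))) (trans (sumC-suc {n} g) (+-comm _ _)))

  -- Induced subgraphs, deletion and pinning

  module Hardcore {n : ℕ} (G : Graph n) where

    IsIndep : Config n → Set
    IsIndep σ = ∀ u v → adj G u v ≡ true → lookup σ u ≡ true → lookup σ v ≡ true → ⊥

    indep⁻ : ∀ σ → T (isIndep G σ) → IsIndep σ
    indep⁻ σ h u v p q r = subst T eq (allB⁻ _ (allFin n) (allB⁻ _ (allFin n) h (∈-allFin u)) (∈-allFin v))
      where eq : not (adj G u v ∧ lookup σ u ∧ lookup σ v) ≡ false
            eq rewrite p | q | r = refl

    indep⁺ : ∀ σ → IsIndep σ → T (isIndep G σ)
    indep⁺ σ h = allB⁺ _ (allFin n) (λ u → allB⁺ _ (allFin n) (λ v → pt u v))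
      where
      pt : ∀ u v → T (not (adj G u v ∧ lookup σ u ∧ lookup σ v))
      pt u v with adj G u v in p | lookup σ u in q | lookup σ v in r
      ... | false | _     | _     = _
      ... | true  | false | _     = _
      ... | true  | true  | false = _
      ... | true  | true  | true  = h u v p q r

    _⊆_ : Config n → Config n → Set
    σ ⊆ A = ∀ u → lookup σ u ≡ true → lookup A u ≡ true

    -- The independent sets of the subgraph induced on A remain configurations on all n vertices, so
    -- that deleting or pinning a vertex does not change the type.
    indep : Config n → Family n
    indep A σ = isIndep G σ ∧ allB (λ u → not (lookup σ u) ∨ lookup A u) (allFin n)

    indep-⁻ : ∀ A σ → T (indep A σ) → IsIndep σ × σ ⊆ A
    indep-⁻ A σ h = indep⁻ σ (proj₁ (∧-T⁻ h)) , sub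
      where
      sub : σ ⊆ A
      sub u p with allB⁻ _ (allFin n) (proj₂ (∧-T⁻ {isIndep G σ} h)) (∈-allFin u)
      ... | q rewrite p = T⇒≡ q

    indep-⁺ : ∀ A σ → IsIndep σ → σ ⊆ A → T (indep A σ)
    indep-⁺ A σ h sub = ∧-T⁺ (indep⁺ σ h) (allB⁺ _ (allFin n) pt)
      where
      pt : ∀ u → T (not (lookup σ u) ∨ lookup A u)
      pt u with lookup σ u in p
      ... | false = _
      ... | true  = ≡⇒T (sub u p)

    remove-⊆ : ∀ v (σ : Config n) u → lookup (remove v σ) u ≡ true → lookup σ u ≡ true
    remove-⊆ v σ u p with u Fin.≟ v
    ... | no u≢v   = trans (sym (lookup-remove′ u≢v σ)) p
    ... | yes refl with trans (sym p) (lookup-remove v σ)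
    ...   | ()

    indep-down : ∀ A → DownClosed (indep A)
    indep-down A v σ h with indep-⁻ A σ h
    ... | ind , sub = indep-⁺ A (remove v σ) (λ x y p q r → ind x y p (remove-⊆ v σ x q) (remove-⊆ v σ y r)) (λ u p → sub u (remove-⊆ v σ u p))

    indep-remove : ∀ A v σ → not (lookup σ v) ∧ indep A σ ≡ indep (remove v A) σ
    indep-remove A v σ = bool-ext to from
      where
      to : T (not (lookup σ v) ∧ indep A σ) → T (indep (remove v A) σ)
      to h with lookup σ v in eq
      ... | false with indep-⁻ A σ h
      ...   | ind , sub = indep-⁺ (remove v A) σ ind sub′
        where
        sub′ : σ ⊆ remove v A
        sub′ u p with u Fin.≟ v
        ... | no u≢v   = trans (lookup-remove′ u≢v A) (sub u p)
        ... | yes refl with trans (sym p) eq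
        ...   | ()
      from : T (indep (remove v A) σ) → T (not (lookup σ v) ∧ indep A σ)
      from h with indep-⁻ (remove v A) σ h
      ... | ind , sub with lookup σ v in eq
      ...   | false = indep-⁺ A σ ind (λ u p → remove-⊆ v A u (sub u p))
      ...   | true with trans (sym (sub v eq)) (lookup-remove v A)
      ...     | ()

    -- The deletions are made one at a time because every intermediate subgraph enters the recursion
    -- for the influences; `nbrs` counts those actually made.
    prune : Fin n → List (Fin n) → Config n → Config n
    prune v []       B = B
    prune v (u ∷ us) B = prune v us (if adj G v u ∧ lookup B u then remove u B else B)

    nbrs : Fin n → List (Fin n) → Config n → ℕ
    nbrs v []       B = 0
    nbrs v (u ∷ us) B = if adj G v u ∧ lookup B u then suc (nbrs v us (remove u B)) else nbrs v us B

    prune-⊆ : ∀ v us B x → lookup (prune v us B) x ≡ true → lookup B x ≡ true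
    prune-⊆ v []       B x p = p
    prune-⊆ v (u ∷ us) B x p with adj G v u ∧ lookup B u
    ... | false = prune-⊆ v us B x p
    ... | true  = remove-⊆ u B x (prune-⊆ v us (remove u B) x p)

    prune-adj : ∀ v us B x → x ∈ us → adj G v x ≡ true → lookup (prune v us B) x ≡ true → ⊥
    prune-adj v (u ∷ us) B x (there m)   a p = prune-adj v us _ x m a p
    prune-adj v (u ∷ us) B x (here refl) a p rewrite a with lookup B x in eq
    ... | true  with trans (sym (prune-⊆ v us (remove x B) x p)) (lookup-remove x B)
    ...   | ()
    prune-adj v (u ∷ us) B x (here refl) a p | false with trans (sym (prune-⊆ v us B x p)) eq
    ...   | ()

    prune-keep : ∀ v us B x → adj G v x ≡ false → lookup B x ≡ true → lookup (prune v us B) x ≡ true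
    prune-keep v []       B x a p = p
    prune-keep v (u ∷ us) B x a p with adj G v u in au | lookup B u
    ... | false | _     = prune-keep v us B x a p
    ... | true  | false = prune-keep v us B x a p
    ... | true  | true with x Fin.≟ u
    ...   | no x≢u   = prune-keep v us (remove u B) x a (trans (lookup-remove′ x≢u B) p)
    ...   | yes refl with trans (sym au) a
    ...     | ()

    -- A minus the closed neighbourhood of v
    shrink : Fin n → Config n → Config n
    shrink v A = prune v (allFin n) (remove v A)

    shrink-self : ∀ v A → lookup (shrink v A) v ≡ false
    shrink-self v A with lookup (shrink v A) v in eq
    ... | false = refl
    ... | true with trans (sym (prune-⊆ v (allFin n) (remove v A) v eq)) (lookup-remove v A)
    ...   | ()

    -- The class of hardcore models on induced subgraphs is closed under links, up to the empty
    -- family. This lets an induction over slots treat all `A` at once.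
    indep-link : ∀ A v τ → link (indep A) v τ ≡ lookup A v ∧ indep (shrink v A) τ
    indep-link A v τ = bool-ext to from
      where
      to : T (link (indep A) v τ) → T (lookup A v ∧ indep (shrink v A) τ)
      to h with lookup τ v in eq
      ... | false with indep-⁻ A (add v τ) h
      ...   | ind , sub = ∧-T⁺ (≡⇒T (sub v (lookup-add v τ))) (indep-⁺ (shrink v A) τ ind′ sub′)
        where
        up : ∀ u → lookup τ u ≡ true → lookup (add v τ) u ≡ true
        up u p with u Fin.≟ v
        ... | no u≢v   = trans (lookup-add′ u≢v τ) p
        ... | yes refl = lookup-add v τ
        ind′ : IsIndep τ
        ind′ x y a p q = ind x y a (up x p) (up y q)
        sub′ : τ ⊆ shrink v A
        sub′ u p with adj G v u in a
        ... | true = ⊥-elim (ind v u a (lookup-add v τ) (up u p))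
        ... | false = prune-keep v (allFin n) (remove v A) u a (trans (lookup-remove′ u≢v A) (sub u (up u p)))
          where
          u≢v : u ≢ v
          u≢v refl with trans (sym p) eq
          ... | ()
      from : T (lookup A v ∧ indep (shrink v A) τ) → T (link (indep A) v τ)
      from h with ∧-T⁻ {lookup A v} h
      ... | v∈A , h′ with indep-⁻ (shrink v A) τ h′
      ...   | ind , sub = ∧-T⁺ τv (indep-⁺ A (add v τ) ind′ sub′)
        where
        τv : T (not (lookup τ v))
        τv with lookup τ v in eq
        ... | false = _
        ... | true with trans (sym (sub v eq)) (shrink-self v A)
        ...   | ()
        nonadj : ∀ x → adj G v x ≡ true → lookup τ x ≡ true → ⊥
        nonadj x a p = prune-adj v (allFin n) (remove v A) x (∈-allFin x) a (sub x p)
        ind′ : IsIndep (add v τ)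
        ind′ x y a p q with x Fin.≟ v | y Fin.≟ v
        ... | no x≢v   | no y≢v   = ind x y a (trans (sym (lookup-add′ x≢v τ)) p) (trans (sym (lookup-add′ y≢v τ)) q)
        ... | yes refl | no y≢v   = nonadj y a (trans (sym (lookup-add′ y≢v τ)) q)
        ... | no x≢v   | yes refl = nonadj x (trans (adj-sym G v x) a) (trans (sym (lookup-add′ x≢v τ)) p)
        ... | yes refl | yes refl with trans (sym a) (adj-irrefl G v)
        ...   | ()
        sub′ : add v τ ⊆ A
        sub′ u p with u Fin.≟ v
        ... | yes refl = T⇒≡ v∈A
        ... | no u≢v   = remove-⊆ v A u (prune-⊆ v (allFin n) (remove v A) u (sub u (trans (sym (lookup-add′ u≢v τ)) p)))

    countAdj : Fin n → List (Fin n) → ℕ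
    countAdj v = foldr (λ u acc → if adj G v u then suc acc else acc) 0

    nbrs≤ : ∀ v us B → nbrs v us B ℕ.≤ countAdj v us
    nbrs≤ v []       B = ℕ.z≤n
    nbrs≤ v (u ∷ us) B with adj G v u | lookup B u
    ... | false | _     = nbrs≤ v us B
    ... | true  | true  = ℕ.s≤s (nbrs≤ v us (remove u B))
    ... | true  | false = ℕₚ.m≤n⇒m≤1+n (nbrs≤ v us B)

    -- A neighbour that has already been deleted uses up one unit of the degree. This is why only d
    -- neighbours count everywhere except at the root.
    nbrs< : ∀ v us B x → x ∈ us → adj G v x ≡ true → lookup B x ≡ false → nbrs v us B ℕ.< countAdj v us
    nbrs< v (u ∷ us) B x (here refl) a p rewrite a | p = ℕ.s≤s (nbrs≤ v us B)
    nbrs< v (u ∷ us) B x (there m) a p with adj G v u | lookup B u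
    ... | false | _     = nbrs< v us B x m a p
    ... | true  | false = ℕₚ.m≤n⇒m≤1+n (nbrs< v us B x m a p)
    ... | true  | true  = ℕ.s≤s (nbrs< v us (remove u B) x m a (p′ (x Fin.≟ u)))
      where
      p′ : Dec (x ≡ u) → lookup (remove u B) x ≡ false
      p′ (yes refl) = lookup-remove u B
      p′ (no x≢u)   = trans (lookup-remove′ x≢u B) p

    -- Marginals and influences

    module _ {lam : Carrier} (lam≥0 : 0# ≤ lam) where

      μ : Config n → Config n → Carrier
      μ A = wt (indep A) (lam ^_)

      μ≥0 : ∀ A σ → 0# ≤ μ A σ
      μ≥0 A = wt-nonneg (indep A) (^-nonneg lam≥0)

      Z : Config n → Carrier
      Z A = mass (μ A)

      Z-pos : ∀ A → Pos (Z A)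
      Z-pos A = pos-≤ (subst Pos (sym one) 1-pos) (sumC-single (μ≥0 A) ∅)
        where
        ∅ = replicate n false
        absurd : ∀ {x} → lookup ∅ x ≡ true → ⊥
        absurd {x} p with trans (sym p) (Vec.lookup-replicate x false)
        ... | ()
        size∅ : ∀ k → size (replicate k false) ≡ 0
        size∅ zero    = refl
        size∅ (suc k) = size∅ k
        one : μ A ∅ ≡ 1#
        one rewrite T⇒≡ (indep-⁺ A ∅ (λ x y a p q → absurd p) (λ u p → ⊥-elim (absurd p))) | size∅ n = *-identityˡ 1#

      I-split : ∀ A v → lookup A v ≡ true → ∀ f → I (μ A) f ≡ I (μ (remove v A)) f + lam * I (μ (shrink v A)) (f ∘ add v)
      I-split A v v∈A f = trans (split v (λ σ → μ A σ * f σ)) (cong₂ _+_ (sum-cong (allConfigs n) out)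
        (trans (toggle v (λ σ → μ A σ * f σ)) (trans (sum-cong (allConfigs n) inn) (sum-*ˡ (allConfigs n) lam _))))
        where
        out : ∀ σ → 𝟙 (not (lookup σ v)) * (μ A σ * f σ) ≡ μ (remove v A) σ * f σ
        out σ = trans (solve 4 (λ a x c f → a :* ((x :* c) :* f) := (a :* x) :* c :* f) refl (𝟙 (not (lookup σ v))) (𝟙 (indep A σ)) (lam ^ size σ) (f σ))
          (cong (λ t → t * lam ^ size σ * f σ) (trans (sym (𝟙-∧ (not (lookup σ v)) (indep A σ))) (cong 𝟙 (indep-remove A v σ))))
        inn : ∀ σ → 𝟙 (not (lookup σ v)) * (μ A (add v σ) * f (add v σ)) ≡ lam * (μ (shrink v A) σ * f (add v σ))
        inn σ = trans (solve 4 (λ a x c f → a :* ((x :* c) :* f) := ((a :* x) :* c) :* f) refl (𝟙 (not (lookup σ v))) (𝟙 (indep A (add v σ))) (lam ^ size (add v σ)) (f (add v σ)))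
          (trans (cong (_* f (add v σ)) (trans (cong (_* lam ^ size (add v σ)) (trans (sym (𝟙-∧ (not (lookup σ v)) _)) (cong 𝟙 (trans (indep-link A v σ) (cong (_∧ indep (shrink v A) σ) v∈A))))) pw))
            (*-assoc lam _ _))
          where
          pw : 𝟙 (indep (shrink v A) σ) * lam ^ size (add v σ) ≡ lam * μ (shrink v A) σ
          pw with indep (shrink v A) σ in eq
          ... | false = solve 3 (λ a l b → lit 0 :* a := l :* (lit 0 :* b)) refl _ lam _
          ... | true with lookup σ v in eq′
          ...   | false rewrite size-add v σ eq′ = solve 2 (λ l s → lit 1 :* (l :* s) := l :* (lit 1 :* s)) refl lam _
          ...   | true with trans (sym (proj₂ (indep-⁻ (shrink v A) σ (≡⇒T eq)) v eq′)) (shrink-self v A)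
          ...     | ()

      I-absent : ∀ A v → lookup A v ≡ false → ∀ (f : Config n → Carrier) → I (μ A) (λ σ → occ v σ * f σ) ≡ 0#
      I-absent A v v∉A f = trans (sum-cong (allConfigs n) pt) (sum-0 (allConfigs n))
        where
        pt : ∀ σ → μ A σ * (occ v σ * f σ) ≡ 0#
        pt σ with lookup σ v in eq
        ... | false = solve 2 (λ m f → m :* (lit 0 :* f) := lit 0) refl (μ A σ) (f σ)
        ... | true with indep A σ in eq′
        ...   | false = solve 2 (λ c f → (lit 0 :* c) :* f := lit 0) refl _ _
        ...   | true with trans (sym (proj₂ (indep-⁻ A σ (≡⇒T eq′)) v eq)) v∉A
        ...     | ()

      I-absent₁ : ∀ A v → lookup A v ≡ false → I (μ A) (occ v) ≡ 0#
      I-absent₁ A v p = trans (I-cong (μ A) (λ σ → sym (*-identityʳ (occ v σ)))) (I-absent A v p (λ _ → 1#))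

      I-add : ∀ A v u → I (μ (shrink v A)) (occ u ∘ add v) ≡ δ v u * Z (shrink v A) + I (μ (shrink v A)) (occ u)
      I-add A v u with v Fin.≟ u
      ... | yes refl = trans (I-cong (μ (shrink v A)) (λ σ → cong 𝟙 (lookup-add v σ))) (trans (I-const (μ (shrink v A)) 1#)
          (trans (solve 1 (λ z → z :* lit 1 := lit 1 :* z :+ lit 0) refl (Z (shrink v A))) (cong (1# * Z (shrink v A) +_) (sym (I-absent₁ (shrink v A) v (shrink-self v A))))))
      ... | no v≢u = trans (I-cong (μ (shrink v A)) (λ σ → cong 𝟙 (lookup-add′ (v≢u ∘ sym) σ))) (solve 2 (λ z y → y := lit 0 :* z :+ y) refl (Z (shrink v A)) _)

      P : Config n → Fin n → Carrier
      P A u = I (μ A) (occ u) * Z A ⁻¹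

      P-Z : ∀ A u → P A u * Z A ≡ I (μ A) (occ u)
      P-Z A u = trans (*-assoc _ _ _) (trans (cong (I (μ A) (occ u) *_) (⁻¹-inverseˡ (proj₂ (Z-pos A)))) (*-identityʳ _))

      P-nonneg : ∀ A u → 0# ≤ P A u
      P-nonneg A u = *-nonneg (I-nonneg (μ≥0 A) (λ σ → 𝟙-nonneg (lookup σ u))) (proj₁ (⁻¹-pos (Z-pos A)))

      *-cancelʳ : ∀ {a x y} → a ≢ 0# → x * a ≡ y * a → x ≡ y
      *-cancelʳ {a} {x} {y} p eq = trans (sym (*-identityʳ x)) (trans (cong (x *_) (sym (inverseʳ p))) (trans (sym (*-assoc x a (a ⁻¹)))
        (trans (cong (_* a ⁻¹) eq) (trans (*-assoc y a (a ⁻¹)) (trans (cong (y *_) (inverseʳ p)) (*-identityʳ y))))))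

      -- The change in the probability of `u` when `v` is pinned in rather than out. The term δ
      -- accounts for `v` itself, which `shrink` has removed.
      Inf : Config n → Fin n → Fin n → Carrier
      Inf A v u = δ v u + (P (shrink v A) u - P (remove v A) u)

      module _ (A : Config n) (v : Fin n) (v∈A : lookup A v ≡ true) where

        Z-split : Z A ≡ Z (remove v A) + lam * Z (shrink v A)
        Z-split = trans (sym (m1 A)) (trans (I-split A v v∈A (λ _ → 1#)) (cong₂ (λ a b → a + lam * b) (m1 (remove v A)) (m1 (shrink v A))))
          where m1 : ∀ A → I (μ A) (λ _ → 1#) ≡ Z A
                m1 A = trans (I-const (μ A) 1#) (*-identityʳ _)

        W-split : ∀ u → I (μ A) (occ u) ≡ I (μ (remove v A)) (occ u) + lam * (δ v u * Z (shrink v A) + I (μ (shrink v A)) (occ u))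
        W-split u = trans (I-split A v v∈A (occ u)) (cong (λ t → I (μ (remove v A)) (occ u) + lam * t) (I-add A v u))

        I-occ-μ : ∀ f → I (μ A) (λ σ → occ v σ * f σ) ≡ lam * I (μ (shrink v A)) (f ∘ add v)
        I-occ-μ f = trans (I-split A v v∈A _) (trans (cong₂ _+_ (I-absent (remove v A) v (lookup-remove v A) f)
          (cong (lam *_) (I-cong (μ (shrink v A)) (λ σ → trans (cong (λ b → 𝟙 b * f (add v σ)) (lookup-add v σ)) (*-identityˡ _))))) (+-identityˡ _))

        W-self : I (μ A) (occ v) ≡ lam * Z (shrink v A)
        W-self = trans (I-cong (μ A) (λ σ → sym (*-identityʳ (occ v σ)))) (trans (I-occ-μ (λ _ → 1#)) (cong (lam *_) (trans (I-const (μ (shrink v A)) 1#) (*-identityʳ _))))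

        P-self : P A v * Z A ≡ lam * Z (shrink v A)
        P-self = trans (P-Z A v) W-self

        P-del : (1# - P A v) * Z A ≡ Z (remove v A)
        P-del = trans (solve 2 (λ p z → (lit 1 :- p) :* z := z :- p :* z) refl (P A v) (Z A)) (trans (cong₂ _-_ Z-split P-self)
          (solve 2 (λ a b → (a :+ b) :- b := a) refl (Z (remove v A)) (lam * Z (shrink v A))))

        P-mix : ∀ u → P A u ≡ (1# - P A v) * P (remove v A) u + P A v * (δ v u + P (shrink v A) u)
        P-mix u = *-cancelʳ (proj₂ (Z-pos A)) (trans (P-Z A u) (trans (W-split u) (sym (trans
          (solve 5 (λ p z a d b → ((lit 1 :- p) :* a :+ p :* (d :+ b)) :* z := a :* ((lit 1 :- p) :* z) :+ (d :+ b) :* (p :* z)) refl (P A v) (Z A) (P (remove v A) u) (δ v u) (P (shrink v A) u))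
          (trans (cong₂ (λ s t → P (remove v A) u * s + (δ v u + P (shrink v A) u) * t) P-del P-self)
            (cong₂ _+_ (P-Z (remove v A) u) (trans (solve 4 (λ d b l z → (d :+ b) :* (l :* z) := l :* (d :* z :+ b :* z)) refl (δ v u) (P (shrink v A) u) lam (Z (shrink v A)))
              (cong (λ t → lam * (δ v u * Z (shrink v A) + t)) (P-Z (shrink v A) u)))))))))

        P-≤1 : P A v ≤ 1#
        P-≤1 = 0≤-⇒≤ (*-cancel-≤ (Z-pos A) (subst₂ _≤_ (sym (zeroʳ _)) (trans (sym P-del) (*-comm _ _)) (proj₁ (Z-pos (remove v A)))))

        -- Deletion conditions on the absence of `v` and so moves the marginals by the fraction
        -- `P A v` of the influence. This is why the invariant has to control the product of
        -- marginal and total influence.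
        influence-del : ∀ u → P (remove v A) u - P A u ≡ - (P A v * Inf A v u)
        influence-del u = trans (cong (λ t → P (remove v A) u - t) (P-mix u))
          (solve 4 (λ p a d b → a :- ((lit 1 :- p) :* a :+ p :* (d :+ b)) := :- (p :* (d :+ (b :- a)))) refl (P A v) (P (remove v A) u) (δ v u) (P (shrink v A) u))

        influence-cond : ∀ u → (δ v u + P (shrink v A) u) - P A u ≡ (1# - P A v) * Inf A v u
        influence-cond u = trans (cong (λ t → (δ v u + P (shrink v A) u) - t) (P-mix u))
          (solve 4 (λ p a d b → (d :+ b) :- ((lit 1 :- p) :* a :+ p :* (d :+ b)) := (lit 1 :- p) :* (d :+ (b :- a))) refl (P A v) (P (remove v A) u) (δ v u) (P (shrink v A) u))

      totalInf : Config n → Fin n → Carrier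
      totalInf A v = sumF (λ u → abs (Inf A v u))

      totalInf-≤ : ∀ A v → totalInf A v ≤ 1# + sumF (λ u → abs (P (shrink v A) u - P (remove v A) u))
      totalInf-≤ A v = ≤-trans (sum-mono (allFin n) (λ u → ≤-trans (abs-+ (δ v u) _) (+-monoˡ-≤ _ (abs-≤ (≤-reflexive (sym (*-identityʳ (δ v u)))) (δ-neg u)))))
        (≤-reflexive (trans (sum-+ (allFin n) _ _) (cong (_+ sumF (λ u → abs (P (shrink v A) u - P (remove v A) u))) (sumF-δ v (λ _ → 1#)))))
        where
        δ-neg : ∀ u → - δ v u ≤ δ v u * 1#
        δ-neg u = ≤-by (# 2 * δ v u) (*-nonneg (#-nonneg 2) (𝟙-nonneg ⌊ v Fin.≟ u ⌋)) (solve 1 (λ x → x :* lit 1 := (:- x) :+ lit 2 :* x) refl (δ v u))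

      -- Contraction of influences and spectral independence

      module Contraction {r : Carrier} (r≥0 : 0# ≤ r) (d : ℕ) (lam≤ : lam ≤ r * (1# + r) ^ d) (gap : Pos (1# + r - # d * r)) where

        1+r>0 : Pos (1# + r)
        1+r>0 = +-pos 1-pos r≥0

        K p̂ : Carrier
        K = (1# + r) * (1# + r - # d * r) ⁻¹
        p̂ = r * (1# + r) ⁻¹

        K≥0 : 0# ≤ K
        K≥0 = *-nonneg (proj₁ 1+r>0) (proj₁ (⁻¹-pos gap))

        K-eq : K * (1# + r - # d * r) ≡ 1# + r
        K-eq = trans (*-assoc _ _ _) (trans (cong ((1# + r) *_) (⁻¹-inverseˡ (proj₂ gap))) (*-identityʳ _))

        p̂-eq : (1# + r) * p̂ ≡ r
        p̂-eq = trans (solve 3 (λ a r i → a :* (r :* i) := r :* (a :* i)) refl (1# + r) r ((1# + r) ⁻¹)) (trans (cong (r *_) (inverseʳ (proj₂ 1+r>0))) (*-identityʳ r))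

        -- The potential: total influences are at most K min(1, p̂ / p).
        Bounded : Config n → Fin n → Set
        Bounded B u = totalInf B u ≤ K × (1# + r) * (P B u * totalInf B u) ≤ K * r

        -- The witness Q stands for the sum of min(pᵢ, p̂) over the deleted vertices, with pᵢ the
        -- marginal at the moment of deletion. Then c r - (1 + r) Q is the sum of the eᵢ = r - (1 +
        -- r) min(pᵢ, p̂), and the last clause is the inequality for ∏ (1 + eᵢ) applied to the ratio
        -- of partition functions.
        Chain : Config n → Config n → ℕ → Set
        Chain B B′ c = ∃ λ Q → (1# + r) * Q ≤ # c * r × sumF (λ x → abs (P B′ x - P B x)) ≤ K * Q
          × Z B′ * (1# + r) ^ c * (1# - (# c * r - (1# + r) * Q)) ≤ Z B

        chain : ∀ v k → (∀ B u → adj G v u ≡ true → lookup B u ≡ true → lookup B v ≡ false → size B ℕ.≤ k → Bounded B u) →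
                ∀ us B → lookup B v ≡ false → size B ℕ.≤ k → Chain B (prune v us B) (nbrs v us B)
        chain v k ih [] B v∉B sz = 0# , ≤-reflexive (solve 2 (λ a r → a :* lit 0 := lit 0 :* r) refl (1# + r) r)
          , ≤-reflexive (trans (sum-cong (allFin n) (λ x → ≤-antisym (abs-≤ (≤-reflexive (-‿inverseʳ (P B x))) (≤-reflexive (solve 1 (λ x → :- (x :- x) := lit 0) refl (P B x)))) (abs-nonneg _))) (trans (sum-0 (allFin n)) (sym (zeroʳ K))))
          , ≤-reflexive (solve 3 (λ z a r → z :* lit 1 :* (lit 1 :- (lit 0 :* r :- a :* lit 0)) := z) refl (Z B) (1# + r) r)
        chain v k ih (u ∷ us) B v∉B sz with adj G v u in a | lookup B u in b
        ... | false | _     = chain v k ih us B v∉B sz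
        ... | true  | false = chain v k ih us B v∉B sz
        ... | true  | true  = q + Q , h₁ , h₂ , h₃
          where
          v∉B′ : lookup (remove u B) v ≡ false
          v∉B′ with lookup (remove u B) v in eq
          ... | false = refl
          ... | true  = trans (sym (remove-⊆ u B v eq)) v∉B
          rec = chain v k ih us (remove u B) v∉B′ (ℕₚ.≤-trans (ℕₚ.n≤1+n _) (subst (ℕ._≤ k) (sym (size-remove u B b)) sz))
          bd = ih B u a b v∉B sz
          Q = proj₁ rec
          c = nbrs v us (remove u B)
          B′ = prune v us (remove u B)
          p = P B u
          q = min p p̂
          e = r - (1# + r) * q
          E = # c * r - (1# + r) * Q
          q≤ : (1# + r) * q ≤ r
          q≤ = subst ((1# + r) * q ≤_) p̂-eq (*-monoˡ (1# + r) (proj₁ 1+r>0) (min≤ʳ p p̂))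
          e≥0 = ≤⇒0≤- q≤
          E≥0 = ≤⇒0≤- (proj₁ (proj₂ rec))
          c+1 : # suc c * r ≡ r + # c * r
          c+1 = trans (cong (_* r) (#-suc c)) (solve 2 (λ c r → (lit 1 :+ c) :* r := r :+ c :* r) refl (# c) r)
          h₁ : (1# + r) * (q + Q) ≤ # suc c * r
          h₁ = subst₂ _≤_ (sym (distribˡ _ _ _)) (sym c+1) (+-mono q≤ (proj₁ (proj₂ rec)))
          -- The two halves of `Bounded` prove this for the two candidates p and p̂ of the minimum.
          pT≤ : p * totalInf B u ≤ K * q
          pT≤ = min-case {λ q → p * totalInf B u ≤ K * q} p p̂
            (≤-trans (*-monoˡ p (P-nonneg B u) (proj₁ bd)) (≤-reflexive (*-comm p K)))
            (*-cancel-≤ 1+r>0 (≤-trans (proj₂ bd) (≤-reflexive (sym (trans (solve 3 (λ a k p → a :* (k :* p) := k :* (a :* p)) refl (1# + r) K p̂) (cong (K *_) p̂-eq))))))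
          h₂ : sumF (λ x → abs (P B′ x - P B x)) ≤ K * (q + Q)
          h₂ = begin
            sumF (λ x → abs (P B′ x - P B x)) ≤⟨ sum-mono (allFin n) (λ x → ≤-trans (≤-reflexive (cong abs (solve 3 (λ a b c → a :- b := (a :- c) :+ (c :- b)) refl (P B′ x) (P B x) (P (remove u B) x)))) (abs-+ _ _)) ⟩
            sumF (λ x → abs (P B′ x - P (remove u B) x) + abs (P (remove u B) x - P B x)) ≡⟨ sum-+ (allFin n) _ _ ⟩
            sumF (λ x → abs (P B′ x - P (remove u B) x)) + sumF (λ x → abs (P (remove u B) x - P B x)) ≤⟨ +-mono (proj₁ (proj₂ (proj₂ rec))) (≤-reflexive (trans (sum-cong (allFin n) (λ x → trans (cong abs (influence-del B u b x)) (trans (abs-neg _) (abs-*-nonneg (P-nonneg B u) _)))) (sum-*ˡ (allFin n) p _))) ⟩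
            K * Q + p * totalInf B u ≤⟨ +-mono ≤-refl pT≤ ⟩
            K * Q + K * q ≡⟨ solve 3 (λ k a b → k :* a :+ k :* b := k :* (b :+ a)) refl K Q q ⟩
            K * (q + Q) ∎
          X = Z B′ * (1# + r) ^ c
          X≥0 = *-nonneg (proj₁ (Z-pos B′)) (^-nonneg (proj₁ 1+r>0) c)
          -- Deleting `u` multiplies the partition function by 1 - p, and (1 + r)(1 - p) ≤ 1 + e
          -- because q ≤ p. The factor 1 + e is then paid for by (1 + e)(1 - E - e) ≤ 1 - E, which
          -- holds whatever the sign of 1 - E.
          h₃ : Z B′ * ((1# + r) * (1# + r) ^ c) * (1# - (# suc c * r - (1# + r) * (q + Q))) ≤ Z B
          h₃ = *-cancel-≤ (+-pos 1-pos e≥0) (begin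
            (1# + e) * (Z B′ * ((1# + r) * (1# + r) ^ c) * (1# - (# suc c * r - (1# + r) * (q + Q)))) ≡⟨ trans (cong (λ t → (1# + e) * (Z B′ * ((1# + r) * (1# + r) ^ c) * (1# - (t - (1# + r) * (q + Q))))) c+1)
               (solve 7 (λ z y w r c q Q → (lit 1 :+ (r :- w :* q)) :* (z :* (w :* y) :* (lit 1 :- ((r :+ c) :- w :* (q :+ Q)))) := (w :* (z :* y)) :* ((lit 1 :+ (r :- w :* q)) :* (lit 1 :- (c :- w :* Q) :- (r :- w :* q)))) refl (Z B′) ((1# + r) ^ c) (1# + r) r (# c * r) q Q) ⟩
            ((1# + r) * X) * ((1# + e) * (1# - E - e)) ≤⟨ *-monoˡ _ (*-nonneg (proj₁ 1+r>0) X≥0) (≤-by (e * E + e * e) (+-nonneg (*-nonneg e≥0 E≥0) (*-nonneg e≥0 e≥0)) (solve 2 (λ e E → lit 1 :- E := (lit 1 :+ e) :* (lit 1 :- E :- e) :+ (e :* E :+ e :* e)) refl e E)) ⟩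
            ((1# + r) * X) * (1# - E) ≡⟨ *-assoc _ _ _ ⟩
            (1# + r) * (X * (1# - E)) ≤⟨ *-monoˡ _ (proj₁ 1+r>0) (proj₂ (proj₂ (proj₂ rec))) ⟩
            (1# + r) * Z (remove u B) ≡⟨ trans (cong ((1# + r) *_) (sym (P-del B u b))) (sym (*-assoc _ _ _)) ⟩
            ((1# + r) * (1# - p)) * Z B ≤⟨ *-monoʳ (Z B) (proj₁ (Z-pos B)) (≤-by ((1# + r) * (p - q)) (*-nonneg (proj₁ 1+r>0) (≤⇒0≤- (min≤ˡ p p̂))) (solve 3 (λ r p q → lit 1 :+ (r :- (lit 1 :+ r) :* q) := (lit 1 :+ r) :* (lit 1 :- p) :+ (lit 1 :+ r) :* (p :- q)) refl r p q)) ⟩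
            (1# + e) * Z B ∎)

        -- A missing neighbour is treated as one of marginal 0, for which e = r. This completes the
        -- c factors 1 + r to the d factors in the hypothesis on `lam`.
        pad : ∀ j {X E z} → 0# ≤ X → 0# ≤ E → X * (1# - E) ≤ z → X * (1# + r) ^ j * (1# - (E + # j * r)) ≤ z
        pad zero {X} {E} X≥0 E≥0 h = ≤-trans (≤-reflexive (solve 3 (λ x e r → x :* lit 1 :* (lit 1 :- (e :+ lit 0 :* r)) := x :* (lit 1 :- e)) refl X E r)) h
        pad (suc j) {X} {E} X≥0 E≥0 h = ≤-trans (≤-reflexive (trans (cong (λ t → X * ((1# + r) * (1# + r) ^ j) * (1# - (E + t * r))) (#-suc j))
            (solve 6 (λ x w y e r j → x :* (w :* y) :* (lit 1 :- (e :+ (lit 1 :+ j) :* r)) := (x :* w) :* y :* (lit 1 :- ((e :+ r) :+ j :* r))) refl X (1# + r) ((1# + r) ^ j) E r (# j))))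
          (pad j {X * (1# + r)} {E + r} (*-nonneg X≥0 (proj₁ 1+r>0)) (+-nonneg E≥0 r≥0)
            (≤-trans (≤-by (X * (r * E + r * r)) (*-nonneg X≥0 (+-nonneg (*-nonneg r≥0 E≥0) (*-nonneg r≥0 r≥0))) (solve 3 (λ x e r → x :* (lit 1 :- e) := (x :* (lit 1 :+ r)) :* (lit 1 :- (e :+ r)) :+ x :* (r :* e :+ r :* r)) refl X E r)) h))

        -- With E the sum of the eᵢ over d neighbours, T ≤ 1 + K Q = K (1 + r - E) / (1 + r); this
        -- identity is what determines K. Then T ≤ K is E ≥ 0, while the bound on p T becomes p (1 +
        -- r - E) ≤ r, which follows from p Z(A) = λ Z(A - N[v]) and the partition function clause
        -- of `Chain`.
        bounded : (∀ v → degree G v ℕ.≤ suc d) → ∀ k A → size A ℕ.≤ k → ∀ v → lookup A v ≡ true → nbrs v (allFin n) (remove v A) ℕ.≤ d → Bounded A v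
        neighbours-bounded : (∀ v → degree G v ℕ.≤ suc d) → ∀ k v B u → adj G v u ≡ true → lookup B u ≡ true → lookup B v ≡ false → size B ℕ.≤ k → Bounded B u
        neighbours-bounded deg k v B u a u∈B v∉B sz = bounded deg k B sz u u∈B (ℕₚ.≤-pred (ℕₚ.≤-trans (nbrs< u (allFin n) (remove u B) v (∈-allFin v) (trans (adj-sym G u v) a) v∉) (deg u)))
          where
          v∉ : lookup (remove u B) v ≡ false
          v∉ with lookup (remove u B) v in eq
          ... | false = refl
          ... | true  = trans (sym (remove-⊆ u B v eq)) v∉B
        bounded deg zero A sz v v∈A c≤d with trans (size-remove v A v∈A) (ℕₚ.n≤0⇒n≡0 sz)
        ... | ()
        bounded deg (suc k) A sz v v∈A c≤d = T≤K , pT≤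
          where
          B = remove v A
          c = nbrs v (allFin n) B
          ch = chain v k (neighbours-bounded deg k v) (allFin n) B (lookup-remove v A) (ℕₚ.≤-pred (subst (ℕ._≤ suc k) (sym (size-remove v A v∈A)) sz))
          Q = proj₁ ch
          tot = totalInf A v
          E = # d * r - (1# + r) * Q
          T≤ : tot ≤ 1# + K * Q
          T≤ = ≤-trans (totalInf-≤ A v) (+-mono ≤-refl (proj₁ (proj₂ (proj₂ ch))))
          scaled : (1# + r) * (1# + K * Q) ≡ K * (1# + r - E)
          scaled = trans (solve 3 (λ a k q → a :* (lit 1 :+ k :* q) := a :+ k :* (a :* q)) refl (1# + r) K Q) (trans (cong (_+ K * ((1# + r) * Q)) (sym K-eq))
            (solve 4 (λ k a d q → k :* (a :- d) :+ k :* (a :* q) := k :* (a :- (d :- a :* q))) refl K (1# + r) (# d * r) Q))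
          E≥0 : 0# ≤ E
          E≥0 = ≤⇒0≤- (≤-trans (proj₁ (proj₂ ch)) (*-monoʳ r r≥0 (#-mono c≤d)))
          T≤K : tot ≤ K
          T≤K = ≤-trans T≤ (*-cancel-≤ 1+r>0 (≤-trans (≤-reflexive scaled) (≤-by (K * E) (*-nonneg K≥0 E≥0) (solve 3 (λ a k e → a :* k := k :* (a :- e) :+ k :* e) refl (1# + r) K E))))
          Zs = Z (shrink v A)
          p = P A v
          full : Zs * (1# + r) ^ d * (1# - E) ≤ Z B
          full = subst (_≤ Z B) eq (pad (d ℕ.∸ c) (*-nonneg (proj₁ (Z-pos (shrink v A))) (^-nonneg (proj₁ 1+r>0) c)) (≤⇒0≤- (proj₁ (proj₂ ch))) (proj₂ (proj₂ (proj₂ ch))))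
            where
            eq : Zs * (1# + r) ^ c * (1# + r) ^ (d ℕ.∸ c) * (1# - ((# c * r - (1# + r) * Q) + # (d ℕ.∸ c) * r)) ≡ Zs * (1# + r) ^ d * (1# - E)
            eq = cong₂ (λ s t → s * (1# - t)) (trans (*-assoc _ _ _) (cong (Zs *_) (trans (sym (^-+ (1# + r) c (d ℕ.∸ c))) (cong ((1# + r) ^_) (ℕₚ.m+[n∸m]≡n c≤d)))))
              (trans (cong (λ t → (# c * r - (1# + r) * Q) + t * r) (#-∸ c≤d)) (solve 4 (λ c r q d → (c :* r :- q) :+ (d :- c) :* r := d :* r :- q) refl (# c) r ((1# + r) * Q) (# d)))
          -- The hypothesis on `lam` may be inserted only when 1 - E ≥ 0; otherwise the left side is
          -- at most 0.
          core : lam * Zs * (1# - E) ≤ r * Z B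
          core with ≤-total 0# (1# - E)
          ... | inj₁ pos = ≤-trans (*-monoʳ _ pos (*-monoʳ Zs (proj₁ (Z-pos (shrink v A))) lam≤)) (≤-trans (≤-reflexive (solve 4 (λ r y z e → r :* y :* z :* e := r :* (z :* y :* e)) refl r ((1# + r) ^ d) Zs (1# - E))) (*-monoˡ r r≥0 full))
          ... | inj₂ neg = ≤-trans (≤-trans (*-monoˡ (lam * Zs) (*-nonneg lam≥0 (proj₁ (Z-pos (shrink v A)))) neg) (≤-reflexive (zeroʳ _))) (*-nonneg r≥0 (proj₁ (Z-pos B)))
          p≤ : p * (1# + r - E) ≤ r
          p≤ = *-cancel-≤ (Z-pos A) (begin
            Z A * (p * (1# + r - E)) ≡⟨ trans (solve 3 (λ z p t → z :* (p :* t) := (p :* z) :* t) refl (Z A) p (1# + r - E)) (cong (_* (1# + r - E)) (P-self A v v∈A)) ⟩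
            lam * Zs * (1# + r - E) ≡⟨ solve 3 (λ y r e → y :* (lit 1 :+ r :- e) := y :* (lit 1 :- e) :+ y :* r) refl (lam * Zs) r E ⟩
            lam * Zs * (1# - E) + lam * Zs * r ≤⟨ +-monoˡ-≤ _ core ⟩
            r * Z B + lam * Zs * r ≡⟨ trans (solve 3 (λ r a b → r :* a :+ b :* r := (a :+ b) :* r) refl r (Z B) (lam * Zs)) (cong (_* r) (sym (Z-split A v v∈A))) ⟩
            Z A * r ∎)
          pT≤ : (1# + r) * (p * tot) ≤ K * r
          pT≤ = begin
            (1# + r) * (p * tot) ≤⟨ *-monoˡ _ (proj₁ 1+r>0) (*-monoˡ p (P-nonneg A v) T≤) ⟩
            (1# + r) * (p * (1# + K * Q)) ≡⟨ trans (solve 3 (λ a p t → a :* (p :* t) := p :* (a :* t)) refl (1# + r) p (1# + K * Q)) (cong (p *_) scaled) ⟩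
            p * (K * (1# + r - E)) ≡⟨ solve 3 (λ p k t → p :* (k :* t) := k :* (p :* t)) refl p K (1# + r - E) ⟩
            K * (p * (1# + r - E)) ≤⟨ *-monoˡ K K≥0 p≤ ⟩
            K * r ∎

        η : Carrier
        η = 1# + # suc d * r * (1# + r - # d * r) ⁻¹

        -- The root may still have all d + 1 neighbours, so it does not satisfy `Bounded` but only
        -- (1 + r) Q ≤ (d + 1) r.
        totalInf-bound : (∀ v → degree G v ℕ.≤ suc d) → ∀ A v → totalInf A v ≤ η
        totalInf-bound deg A v = ≤-trans (totalInf-≤ A v) (+-mono ≤-refl (≤-trans (proj₁ (proj₂ (proj₂ ch))) (begin
            K * Q ≡⟨ solve 3 (λ a i q → a :* i :* q := (a :* q) :* i) refl (1# + r) ((1# + r - # d * r) ⁻¹) Q ⟩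
            (1# + r) * Q * (1# + r - # d * r) ⁻¹ ≤⟨ *-monoʳ _ (proj₁ (⁻¹-pos gap)) (≤-trans (proj₁ (proj₂ ch)) (*-monoʳ r r≥0 (#-mono (ℕₚ.≤-trans (nbrs≤ v (allFin n) (remove v A)) (deg v))))) ⟩
            # suc d * r * (1# + r - # d * r) ⁻¹ ∎)))
          where
          ch = chain v n (neighbours-bounded deg n v) (allFin n) (remove v A) (lookup-remove v A) (size≤n (remove v A))
          Q = proj₁ ch

        -- Schur test. The covariances are symmetric and equal W v (1 - P v) Inf v u, so 2 a_v a_u C
        -- ≤ (a_v² + a_u²) |C| reduces the quadratic form to row sums, and these are total
        -- influences times W v.
        spectralIndependence : (∀ v → degree G v ℕ.≤ suc d) → ∀ A → SpectrallyIndependent (μ A) η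
        spectralIndependence deg A a = b , *-cancel-≤ (#-pos 1) (begin
            # 2 * I (μ A) (λ σ → sq (lin a σ - b)) ≡⟨ cong (# 2 *_) expand ⟩
            # 2 * sumF (λ v → sumF (λ u → a v * a u * C v u)) ≡⟨ trans (sym (sum-*ˡ (allFin n) (# 2) _)) (sum-cong (allFin n) (λ v → sym (sum-*ˡ (allFin n) (# 2) _))) ⟩
            sumF (λ v → sumF (λ u → # 2 * (a v * a u * C v u))) ≤⟨ sum-mono (allFin n) (λ v → sum-mono (allFin n) (λ u → young (a v) (a u) (C v u))) ⟩
            sumF (λ v → sumF (λ u → sq (a v) * abs (C v u) + sq (a u) * abs (C v u))) ≡⟨ trans (sum-cong (allFin n) (λ v → sum-+ (allFin n) _ _)) (sum-+ (allFin n) _ _) ⟩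
            S + sumF (λ v → sumF (λ u → sq (a u) * abs (C v u))) ≡⟨ cong (S +_) (trans (sum-swap (allFin n) (allFin n) _) (sum-cong (allFin n) (λ u → sum-cong (allFin n) (λ v → cong (λ t → sq (a u) * abs t) (C-sym v u))))) ⟩
            S + S ≡⟨ solve 1 (λ s → s :+ s := lit 2 :* s) refl S ⟩
            # 2 * S ≤⟨ *-monoˡ (# 2) (#-nonneg 2) (≤-trans (sum-mono (allFin n) (λ v → ≤-trans (≤-reflexive (sum-*ˡ (allFin n) (sq (a v)) _)) (≤-trans (*-monoˡ (sq (a v)) (sq-nonneg (a v)) (row v)) (≤-reflexive (solve 3 (λ s e w → s :* (e :* w) := e :* (s :* w)) refl (sq (a v)) η (W v)))))) (≤-reflexive (sum-*ˡ (allFin n) η _))) ⟩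
            # 2 * (η * sumF (λ v → sq (a v) * W v)) ∎)
          where
          b = sumF (λ v → a v * P A v)
          W : Fin n → Carrier
          W v = I (μ A) (occ v)
          ō : Fin n → Config n → Carrier
          ō v σ = occ v σ - P A v
          C : Fin n → Fin n → Carrier
          C v u = I (μ A) (λ σ → ō v σ * ō u σ)
          S = sumF (λ v → sumF (λ u → sq (a v) * abs (C v u)))
          C-sym : ∀ v u → C v u ≡ C u v
          C-sym v u = I-cong (μ A) (λ σ → *-comm _ _)
          lin-ō : ∀ σ → lin a σ - b ≡ sumF (λ v → a v * ō v σ)
          lin-ō σ = sym (trans (sum-cong (allFin n) (λ v → solve 3 (λ a o p → a :* (o :- p) := a :* o :+ (:- lit 1) :* (a :* p)) refl (a v) (occ v σ) (P A v)))
            (trans (sum-+ (allFin n) _ _) (cong (lin a σ +_) (trans (sum-*ˡ (allFin n) (- 1#) _) (solve 1 (λ b → (:- lit 1) :* b := :- b) refl b)))))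
          expand : I (μ A) (λ σ → sq (lin a σ - b)) ≡ sumF (λ v → sumF (λ u → a v * a u * C v u))
          expand = trans (I-cong (μ A) (λ σ → trans (cong sq (lin-ō σ)) (trans (sym (sum-*ʳ (allFin n) _ _)) (sum-cong (allFin n) (λ v → sym (sum-*ˡ (allFin n) (a v * ō v σ) _))))))
            (trans (I-sum (μ A) (allFin n) _) (sum-cong (allFin n) (λ v → trans (I-sum (μ A) (allFin n) _) (sum-cong (allFin n) (λ u →
              trans (I-cong (μ A) (λ σ → solve 4 (λ a x b y → (a :* x) :* (b :* y) := a :* b :* (x :* y)) refl (a v) (ō v σ) (a u) (ō u σ))) (I-*ˡ (μ A) (a v * a u) _))))))
          young : ∀ x y c → # 2 * (x * y * c) ≤ sq x * abs c + sq y * abs c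
          young x y c with ≤-total 0# c
          ... | inj₁ p = ≤-by (sq (x - y) * c) (*-nonneg (sq-nonneg (x - y)) p) (solve 3 (λ x y c → x :* x :* c :+ y :* y :* c := lit 2 :* (x :* y :* c) :+ ((x :- y) :* (x :- y)) :* c) refl x y c)
          ... | inj₂ p = ≤-by (sq (x + y) * (- c)) (*-nonneg (sq-nonneg (x + y)) (neg-nonneg p)) (solve 3 (λ x y c → x :* x :* (:- c) :+ y :* y :* (:- c) := lit 2 :* (x :* y :* c) :+ ((x :+ y) :* (x :+ y)) :* (:- c)) refl x y c)
          ō-centered : ∀ u → I (μ A) (ō u) ≡ 0#
          ō-centered u = trans (I-+ (μ A) (occ u) (λ _ → - P A u)) (trans (cong₂ _+_ (sym (P-Z A u)) (I-const (μ A) (- P A u))) (solve 2 (λ p z → p :* z :+ z :* (:- p) := lit 0) refl (P A u) (Z A)))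
          C-occ : ∀ v u → C v u ≡ I (μ A) (λ σ → occ v σ * ō u σ)
          C-occ v u = trans (I-cong (μ A) (λ σ → solve 3 (λ o p x → (o :- p) :* x := o :* x :+ (:- p) :* x) refl (occ v σ) (P A v) (ō u σ)))
            (trans (I-+ (μ A) _ _) (trans (cong (I (μ A) (λ σ → occ v σ * ō u σ) +_) (trans (I-*ˡ (μ A) (- P A v) (ō u)) (trans (cong (- P A v *_) (ō-centered u)) (zeroʳ _)))) (+-identityʳ _)))
          row : ∀ v → sumF (λ u → abs (C v u)) ≤ η * W v
          row v with lookup A v in eq
          ... | false = ≤-reflexive (trans (sum-cong (allFin n) (λ u → trans (cong abs (trans (C-occ v u) (I-absent A v eq (ō u)))) (≤-antisym (abs-≤ ≤-refl (≤-reflexive (solve 0 (:- lit 0 := lit 0) refl))) (abs-nonneg 0#))))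
              (trans (sum-0 (allFin n)) (sym (trans (cong (η *_) (I-absent₁ A v eq)) (zeroʳ η)))))
          ... | true = begin
              sumF (λ u → abs (C v u)) ≤⟨ sum-mono (allFin n) (λ u → ≤-trans (≤-reflexive (trans (cong abs (C≡ u)) (abs-*-nonneg Wc≥0 _))) (*-monoʳ _ (abs-nonneg _) Wc≤)) ⟩
              sumF (λ u → W v * abs (Inf A v u)) ≡⟨ sum-*ˡ (allFin n) (W v) _ ⟩
              W v * totalInf A v ≤⟨ *-monoˡ (W v) W≥0 (totalInf-bound deg A v) ⟩
              W v * η ≡⟨ *-comm _ _ ⟩
              η * W v ∎
            where
            W≥0 : 0# ≤ W v
            W≥0 = I-nonneg (μ≥0 A) (λ σ → 𝟙-nonneg (lookup σ v))
            Wc≥0 : 0# ≤ W v * (1# - P A v)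
            Wc≥0 = *-nonneg W≥0 (≤⇒0≤- (P-≤1 A v eq))
            Wc≤ : W v * (1# - P A v) ≤ W v
            Wc≤ = ≤-by (W v * P A v) (*-nonneg W≥0 (P-nonneg A v)) (solve 2 (λ w p → w := w :* (lit 1 :- p) :+ w :* p) refl (W v) (P A v))
            Zs = Z (shrink v A)
            C≡ : ∀ u → C v u ≡ W v * (1# - P A v) * Inf A v u
            C≡ u = trans (C-occ v u) (trans (I-occ-μ A v eq (ō u)) (trans (cong (lam *_) (trans (I-+ (μ (shrink v A)) _ _) (cong₂ _+_ (I-add A v u) (I-const (μ (shrink v A)) _))))
              (trans (cong (λ t → lam * ((δ v u * Zs + t) + Zs * (- P A u))) (sym (P-Z (shrink v A) u)))
                (trans (solve 5 (λ l d z p q → l :* ((d :* z :+ p :* z) :+ z :* (:- q)) := (l :* z) :* ((d :+ p) :- q)) refl lam (δ v u) Zs (P (shrink v A) u) (P A u))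
                  (trans (cong₂ _*_ (sym (W-self A v eq)) (influence-cond A v eq u)) (sym (*-assoc _ _ _)))))))

  -- The critical fugacity

  -- Convexity: the power lies above its tangent at x. Multiplying the tangent by m exceeds the next
  -- tangent by a multiple of (m - x)².
  pow-tangent : ∀ {x m} → 0# ≤ x → 0# ≤ m → ∀ k → x ^ suc k + # suc k * x ^ k * (m - x) ≤ m ^ suc k
  pow-tangent {x} {m} px pm zero = ≤-reflexive (solve 2 (λ x m → x :* lit 1 :+ lit 1 :* lit 1 :* (m :- x) := m :* lit 1) refl x m)
  pow-tangent {x} {m} px pm (suc k) = ≤-trans
    (≤-by (# suc k * x ^ k * sq (m - x)) (*-nonneg (*-nonneg (#-nonneg (suc k)) (^-nonneg px k)) (sq-nonneg (m - x)))
      (trans (solve 4 (λ x m c y → m :* (x :* y :+ c :* y :* (m :- x)) := x :* (x :* y) :+ (lit 1 :+ c) :* (x :* y) :* (m :- x) :+ c :* y :* ((m :- x) :* (m :- x))) refl x m (# suc k) (x ^ k))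
        (cong (λ t → x * (x * x ^ k) + t * (x * x ^ k) * (m - x) + # suc k * x ^ k * sq (m - x)) (sym (#-suc (suc k))))))
    (*-monoˡ m pm (pow-tangent px pm k))

  am-gm : ∀ {x m} → 0# ≤ x → 0# ≤ m → ∀ k → # suc k * m ≡ # k * x + 1# → x ^ k ≤ m ^ suc k
  am-gm {x} {m} px pm k eq = ≤-trans (≤-reflexive (sym (trans (solve 4 (λ x y c m → x :* y :+ c :* y :* (m :- x) := y :* (x :+ (c :* m :- c :* x))) refl x (x ^ k) (# suc k) m)
    (trans (cong₂ (λ s t → x ^ k * (x + (s - t * x))) eq (#-suc k)) (solve 3 (λ x y k → y :* (x :+ ((k :* x :+ lit 1) :- (lit 1 :+ k) :* x)) := y) refl x (x ^ k) (# k)))))) (pow-tangent px pm k)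

  ⁻¹-unique : ∀ {x y} → Pos x → x * y ≡ 1# → x ⁻¹ ≡ y
  ⁻¹-unique {x} {y} p eq = trans (sym (*-identityʳ (x ⁻¹))) (trans (cong (x ⁻¹ *_) (sym eq)) (trans (sym (*-assoc _ _ _)) (trans (cong (_* y) (⁻¹-inverseˡ (proj₂ p))) (*-identityˡ y))))

  pos-*⁻ : ∀ {a x} → Pos a → Pos (a * x) → Pos x
  pos-*⁻ {a} {x} pa (p , q) = *-cancel-≤ pa (subst (_≤ a * x) (sym (zeroʳ a)) p) , λ { refl → q (zeroʳ a) }

  SpectrallyIndependent-mono : ∀ {n} {w : Config n → Carrier} → (∀ σ → 0# ≤ w σ) → ∀ {η η′} → η ≤ η′ → SpectrallyIndependent w η → SpectrallyIndependent w η′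
  SpectrallyIndependent-mono {n} w≥0 p si a = proj₁ (si a) , ≤-trans (proj₂ (si a)) (*-monoʳ _ (sum-nonneg (allFin n) (λ v → *-nonneg (sq-nonneg (a v)) (I-nonneg w≥0 (λ σ → 𝟙-nonneg (lookup σ v))))) p)

  module Compare {n : ℕ} {w₁ w₂ : Config n → Carrier} (w₁≥0 : ∀ σ → 0# ≤ w₁ σ) {κ : Carrier}
                 (lower : ∀ σ → w₁ σ ≤ w₂ σ) (upper : ∀ σ → w₂ σ ≤ κ * w₁ σ) where

    I-lower : ∀ {f} → (∀ σ → 0# ≤ f σ) → I w₁ f ≤ I w₂ f
    I-lower {f} p = sum-mono (allConfigs n) (λ σ → *-monoʳ (f σ) (p σ) (lower σ))

    I-upper : ∀ {f} → (∀ σ → 0# ≤ f σ) → I w₂ f ≤ κ * I w₁ f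
    I-upper {f} p = ≤-trans (sum-mono (allConfigs n) (λ σ → *-monoʳ (f σ) (p σ) (upper σ)))
      (≤-reflexive (trans (sum-cong (allConfigs n) (λ σ → *-assoc κ (w₁ σ) (f σ))) (sum-*ˡ (allConfigs n) κ _)))

    -- Second moments about a fixed constant are monotone in the weight, so the old centre `b`
    -- serves again and only the marginals cost a factor `κ`.
    compare-SI : ∀ {η} → 0# ≤ η → SpectrallyIndependent w₂ η → SpectrallyIndependent w₁ (η * κ)
    compare-SI {η} η≥0 si a = b , (begin
      I w₁ (λ σ → sq (lin a σ - b)) ≤⟨ I-lower (λ σ → sq-nonneg (lin a σ - b)) ⟩
      I w₂ (λ σ → sq (lin a σ - b)) ≤⟨ proj₂ (si a) ⟩
      η * sumF (λ v → sq (a v) * I w₂ (occ v)) ≤⟨ *-monoˡ η η≥0 (sum-mono (allFin n) (λ v → ≤-trans (*-monoˡ (sq (a v)) (sq-nonneg (a v)) (I-upper (λ σ → 𝟙-nonneg (lookup σ v))))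
          (≤-reflexive (solve 3 (λ s k x → s :* (k :* x) := k :* (s :* x)) refl (sq (a v)) κ (I w₁ (occ v)))))) ⟩
      η * sumF (λ v → κ * (sq (a v) * I w₁ (occ v))) ≡⟨ trans (cong (η *_) (sum-*ˡ (allFin n) κ _)) (sym (*-assoc _ _ _)) ⟩
      η * κ * sumF (λ v → sq (a v) * I w₁ (occ v)) ∎)
      where b = proj₁ (si a)

    compare-Poincaré : 0# ≤ κ → ∀ {B} → 0# ≤ B → Poincaré w₁ B → Poincaré w₂ (κ * B)
    compare-Poincaré κ≥0 {B} B≥0 pc f = a , (begin
      I w₂ (λ σ → sq (f σ - a)) ≤⟨ I-upper (λ σ → sq-nonneg (f σ - a)) ⟩
      κ * I w₁ (λ σ → sq (f σ - a)) ≤⟨ *-monoˡ κ κ≥0 (≤-trans (proj₂ (pc f)) (*-monoˡ B B≥0 (I-lower (grad-nonneg f)))) ⟩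
      κ * (B * I w₂ (grad f)) ≡⟨ sym (*-assoc _ _ _) ⟩
      κ * B * I w₂ (grad f) ∎)
      where a = proj₁ (pc f)

  Poincaré-cong : ∀ {n} {w w′ : Config n → Carrier} → (∀ σ → w σ ≡ w′ σ) → ∀ {B} → Poincaré w B → Poincaré w′ B
  Poincaré-cong {n} eq {B} pc f = proj₁ (pc f) , subst₂ _≤_ (sum-cong (allConfigs n) (λ σ → cong (_* _) (eq σ))) (cong (B *_) (sum-cong (allConfigs n) (λ σ → cong (_* _) (eq σ)))) (proj₂ (pc f))

  Poincaré-zero : ∀ {n} {w : Config n → Carrier} → (∀ σ → w σ ≡ 0#) → ∀ {B} → Poincaré w B
  Poincaré-zero {n} {w} eq {B} f = 0# , ≤-reflexive (trans (z _) (sym (trans (cong (B *_) (z (grad f))) (zeroʳ B))))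
    where z : ∀ g → I w g ≡ 0#
          z g = trans (sum-cong (allConfigs n) (λ σ → trans (cong (_* g σ) (eq σ)) (zeroˡ _))) (sum-0 (allConfigs n))

  Poincaré-mono : ∀ {n} {w : Config n → Carrier} → (∀ σ → 0# ≤ w σ) → ∀ {B B′} → B ≤ B′ → Poincaré w B → Poincaré w B′
  Poincaré-mono w≥0 p pc f = proj₁ (pc f) , ≤-trans (proj₂ (pc f)) (*-monoʳ _ (I-nonneg w≥0 (grad-nonneg f)) p)

  slot-≤ : ∀ {ρ} → 0# ≤ ρ → ∀ m j → slot ρ m j ≤ (ρ * # m) ^ j
  slot-≤ p m       zero    = ≤-refl
  slot-≤ p zero    (suc j) = ^-nonneg (*-nonneg p ≤-refl) (suc j)
  slot-≤ {ρ} p (suc m) (suc j) = *-monoˡ (ρ * # suc m) (*-nonneg p (#-nonneg (suc m)))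
    (≤-trans (slot-≤ p m j) (^-mono (*-nonneg p (#-nonneg m)) (*-monoˡ ρ p (#-mono (ℕₚ.n≤1+n m))) j))

  -- The falling factorial is (ρ m)^j times the product of 1 - i/m over i < j, and for m > n that
  -- product is at least 1 - j n / (m - n): a bound linear in j that survives the induction.
  slot-≥ : ∀ {ρ} → 0# ≤ ρ → ∀ {n m} → n ℕ.≤ m → ∀ j → j ℕ.≤ n →
    (# m - # n - # j * # n) * (ρ * # m) ^ j ≤ (# m - # n) * slot ρ m j
  slot-≥ p {n} {m} n≤m zero j≤n = ≤-reflexive (solve 2 (λ m n → (m :- n :- lit 0 :* n) :* lit 1 := (m :- n) :* lit 1) refl (# m) (# n))
  slot-≥ {ρ} p {n} {m} n≤m (suc j) j≤n = begin
    (M - N - # suc j * N) * (ρ * M * y) ≡⟨ trans (cong (λ t → (M - N - t * N) * (ρ * M * y)) (#-suc j)) (solve 5 (λ M N j ρ y → (M :- N :- (lit 1 :+ j) :* N) :* (ρ :* M :* y) := ρ :* y :* (M :* ((M :- N :- j :* N) :- N))) refl M N (# j) ρ y) ⟩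
    ρ * y * (M * (Y - N)) ≤⟨ *-monoˡ (ρ * y) (*-nonneg p (^-nonneg (*-nonneg p (#-nonneg m)) j)) (≤-by (# j * (N + # j * N) + M * (N - # j)) (+-nonneg (*-nonneg (#-nonneg j) (+-nonneg (#-nonneg n) (*-nonneg (#-nonneg j) (#-nonneg n)))) (*-nonneg (#-nonneg m) (≤⇒0≤- (#-mono j≤n′))))
       (solve 3 (λ M N j → (M :- N :- j :* N) :* (M :- j) := M :* ((M :- N :- j :* N) :- N) :+ (j :* (N :+ j :* N) :+ M :* (N :- j))) refl M N (# j))) ⟩
    ρ * y * (Y * (M - # j)) ≡⟨ solve 4 (λ ρ y Y x → ρ :* y :* (Y :* x) := ρ :* x :* (Y :* y)) refl ρ y Y (M - # j) ⟩
    ρ * (M - # j) * (Y * y) ≤⟨ *-monoˡ (ρ * (M - # j)) (*-nonneg p (≤⇒0≤- (#-mono (ℕₚ.≤-trans j≤n′ n≤m)))) (slot-≥ p n≤m j j≤n′) ⟩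
    ρ * (M - # j) * ((M - N) * slot ρ m j) ≡⟨ trans (solve 4 (λ ρ x g s → ρ :* x :* (g :* s) := g :* (ρ :* x :* s)) refl ρ (M - # j) (M - N) (slot ρ m j)) (cong ((M - N) *_) (sym (slot-sucʳ ρ m j))) ⟩
    (M - N) * slot ρ m (suc j) ∎
    where
    M = # m
    N = # n
    y = (ρ * M) ^ j
    Y = M - N - # j * N
    j≤n′ : j ℕ.≤ n
    j≤n′ = ℕₚ.≤-trans (ℕₚ.n≤1+n j) j≤n

  module Critical (D′ : ℕ) where

    D d : ℕ
    D = suc D′
    d = suc D

    λᶜ : Carrier
    λᶜ = # (d ℕ.^ d) * (# (D ℕ.^ suc d)) ⁻¹

    D^>0 : ∀ k → Pos (# (D ℕ.^ k))
    D^>0 k = subst Pos (sym (#-^ D k)) (^-pos (#-pos D′) k)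

    λᶜ>0 : Pos λᶜ
    λᶜ>0 = *-pos (subst Pos (sym (#-^ d d)) (^-pos (#-pos D) d)) (⁻¹-pos (D^>0 (suc d)))

    Λ a : ℕ
    Λ = suc (proj₁ (archimedean λᶜ))
    a = 2 ℕ.* (suc d ℕ.* Λ)

    λᶜ≤Λ : λᶜ ≤ # Λ
    λᶜ≤Λ = ≤-trans (proj₂ (archimedean λᶜ)) (#-mono (ℕₚ.n≤1+n _))

    -- This is Δ / (Δ - 2); twice it is the exponent 2 + 4/(Δ-2) of the Poincaré constant.
    c : Carrier
    c = # suc d * (# D) ⁻¹

    c≥0 : 0# ≤ c
    c≥0 = *-nonneg (#-nonneg (suc d)) (proj₁ (⁻¹-pos (#-pos D′)))

    a≡ : # a ≡ # 2 * (# suc d * # Λ)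
    a≡ = trans (#-* 2 (suc d ℕ.* Λ)) (cong (# 2 *_) (#-* (suc d) Λ))

    module _ {n : ℕ} (G : Graph n) (deg : ∀ v → degree G v ℕ.≤ suc d) where

      open Hardcore G

      -- Here x / N is the relative distance to criticality. For small k / N the choice r = λᶜ k / N
      -- has D r ≤ 1/2 and gives η - 1 ≤ a k / N. Otherwise D r = 1 - x / (2N) gives η - 1 = 2 c k /
      -- x + c, and the constant c is absorbed into a k / N. The split is made to obtain the overall
      -- factor k, because the iteration multiplies by 1 + (η - 1) / k.
      critical-SI : ∀ {lam} (lam≥0 : 0# ≤ lam) {k x N} → 0# ≤ k → Pos x → N ≡ k + x → lam * N ≤ λᶜ * k →
        ∀ A → SpectrallyIndependent (μ lam≥0 A) (1# + k * (# 2 * c * x ⁻¹ + # a * N ⁻¹))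
      critical-SI {lam} lam≥0 {k} {x} {N} k≥0 x>0 refl lam≤ A with ≤-total (# 2 * # D * # Λ * k) N
      ... | inj₁ small = SpectrallyIndependent-mono (μ≥0 lam≥0 A) η≤ (Contraction.spectralIndependence lam≥0 r≥0 d lam≤r gap deg A)
        where
        N>0 : Pos N
        N>0 = pos-≤ x>0 (≤-by k k≥0 (+-comm k x))
        N⁻¹≥0 = proj₁ (⁻¹-pos N>0)
        r = λᶜ * k * N ⁻¹
        r≥0 : 0# ≤ r
        r≥0 = *-nonneg (*-nonneg (proj₁ λᶜ>0) k≥0) N⁻¹≥0
        rN : r * N ≡ λᶜ * k
        rN = trans (*-assoc _ _ _) (trans (cong (λᶜ * k *_) (⁻¹-inverseˡ (proj₂ N>0))) (*-identityʳ _))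
        lam≤r : lam ≤ r * (1# + r) ^ d
        lam≤r = ≤-trans (*-cancel-≤ N>0 (subst₂ _≤_ (*-comm lam N) (trans (sym rN) (*-comm r N)) lam≤))
          (subst (_≤ r * (1# + r) ^ d) (*-identityʳ r) (*-monoˡ r r≥0 (1≤^ (≤-by r r≥0 refl) d)))
        y = 1# + r - # d * r
        y≡ : y ≡ 1# - # D * r
        y≡ = trans (cong (λ t → 1# + r - t * r) (#-suc D)) (solve 2 (λ r D → lit 1 :+ r :- (lit 1 :+ D) :* r := lit 1 :- D :* r) refl r (# D))
        r≤ : r * N ≤ # Λ * k
        r≤ = ≤-trans (≤-reflexive rN) (*-monoʳ k k≥0 λᶜ≤Λ)
        1≤2y : 1# ≤ # 2 * y
        1≤2y = subst (λ t → 1# ≤ # 2 * t) (sym y≡) (*-cancel-≤ N>0 (begin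
          N * 1# ≡⟨ solve 1 (λ N → N :* lit 1 := lit 2 :* N :- N) refl N ⟩
          # 2 * N - N ≤⟨ +-mono ≤-refl (neg-mono small) ⟩
          # 2 * N - # 2 * # D * # Λ * k ≡⟨ solve 4 (λ N D L k → lit 2 :* N :- lit 2 :* D :* L :* k := lit 2 :* (N :- D :* (L :* k))) refl N (# D) (# Λ) k ⟩
          # 2 * (N - # D * (# Λ * k)) ≤⟨ *-monoˡ (# 2) (#-nonneg 2) (+-mono ≤-refl (neg-mono (*-monoˡ (# D) (#-nonneg D) r≤))) ⟩
          # 2 * (N - # D * (r * N)) ≡⟨ solve 3 (λ N D r → lit 2 :* (N :- D :* (r :* N)) := N :* (lit 2 :* (lit 1 :- D :* r))) refl N (# D) r ⟩
          N * (# 2 * (1# - # D * r)) ∎))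
        gap : Pos y
        gap = pos-*⁻ (#-pos 1) (pos-≤ 1-pos 1≤2y)
        y⁻¹≤2 : y ⁻¹ ≤ # 2
        y⁻¹≤2 = *-cancel-≤ gap (subst₂ _≤_ (sym (inverseʳ (proj₂ gap))) (*-comm (# 2) y) 1≤2y)
        r≤′ : r ≤ # Λ * (k * N ⁻¹)
        r≤′ = ≤-trans (≤-reflexive (*-assoc _ _ _)) (*-monoʳ _ (*-nonneg k≥0 N⁻¹≥0) λᶜ≤Λ)
        η≤ : 1# + # suc d * r * y ⁻¹ ≤ 1# + k * (# 2 * c * x ⁻¹ + # a * N ⁻¹)
        η≤ = +-mono ≤-refl (begin
          # suc d * r * y ⁻¹ ≤⟨ *-monoˡ (# suc d * r) (*-nonneg (#-nonneg (suc d)) r≥0) y⁻¹≤2 ⟩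
          # suc d * r * # 2 ≤⟨ *-monoʳ (# 2) (#-nonneg 2) (*-monoˡ (# suc d) (#-nonneg (suc d)) r≤′) ⟩
          # suc d * (# Λ * (k * N ⁻¹)) * # 2 ≡⟨ trans (solve 4 (λ s L k i → s :* (L :* (k :* i)) :* lit 2 := k :* (lit 2 :* (s :* L) :* i)) refl (# suc d) (# Λ) k (N ⁻¹)) (cong (λ t → k * (t * N ⁻¹)) (sym a≡)) ⟩
          k * (# a * N ⁻¹) ≤⟨ *-monoˡ k k≥0 (≤-by (# 2 * c * x ⁻¹) (*-nonneg (*-nonneg (#-nonneg 2) c≥0) (proj₁ (⁻¹-pos x>0))) (+-comm _ _)) ⟩
          k * (# 2 * c * x ⁻¹ + # a * N ⁻¹) ∎)
      ... | inj₂ large = SpectrallyIndependent-mono (μ≥0 lam≥0 A) η≤ (Contraction.spectralIndependence lam≥0 r≥0 d lam≤r gap deg A)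
        where
        N>0 : Pos N
        N>0 = pos-≤ x>0 (≤-by k k≥0 (+-comm k x))
        N⁻¹≥0 = proj₁ (⁻¹-pos N>0)
        2DN>0 : Pos (# 2 * # D * N)
        2DN>0 = *-pos (*-pos (#-pos 1) (#-pos D′)) N>0
        i = (# 2 * # D * N) ⁻¹
        r = (N + k) * i
        r≥0 : 0# ≤ r
        r≥0 = *-nonneg (+-nonneg (proj₁ N>0) k≥0) (proj₁ (⁻¹-pos 2DN>0))
        r-eq : # 2 * # D * N * r ≡ N + k
        r-eq = trans (solve 3 (λ a b i → a :* (b :* i) := b :* (a :* i)) refl (# 2 * # D * N) (N + k) i) (trans (cong ((N + k) *_) (inverseʳ (proj₂ 2DN>0))) (*-identityʳ _))
        y = 1# + r - # d * r
        y≡ : y ≡ 1# - # D * r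
        y≡ = trans (cong (λ t → 1# + r - t * r) (#-suc D)) (solve 2 (λ r D → lit 1 :+ r :- (lit 1 :+ D) :* r := lit 1 :- D :* r) refl r (# D))
        2N>0 = *-pos (#-pos 1) N>0
        2Ny : # 2 * N * y ≡ x
        2Ny = trans (cong (# 2 * N *_) y≡) (trans (solve 3 (λ N D r → lit 2 :* N :* (lit 1 :- D :* r) := lit 2 :* N :- lit 2 :* D :* N :* r) refl N (# D) r)
          (trans (cong (λ t → # 2 * N - t) r-eq) (solve 2 (λ k x → lit 2 :* (k :+ x) :- ((k :+ x) :+ k) := x) refl k x)))
        gap : Pos y
        gap = pos-*⁻ 2N>0 (subst Pos (sym 2Ny) x>0)
        y⁻¹≡ : y ⁻¹ ≡ # 2 * N * x ⁻¹
        y⁻¹≡ = ⁻¹-unique gap (trans (solve 3 (λ y a i → y :* (a :* i) := (a :* y) :* i) refl y (# 2 * N) (x ⁻¹)) (trans (cong (_* x ⁻¹) 2Ny) (inverseʳ (proj₂ x>0))))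
        -- With u = 1 - D r the fugacity is r (1 + r)^d = λᶜ (1 - u) (1 - u/d)^d ≥ λᶜ (1 - u)² by Bernoulli.
        lam≤r : lam ≤ r * (1# + r) ^ d
        lam≤r = *-cancel-≤ (*-pos N>0 (D^>0 (suc d))) (begin
          N * Dᵈ * lam ≡⟨ solve 3 (λ N D l → N :* D :* l := (l :* N) :* D) refl N Dᵈ lam ⟩
          lam * N * Dᵈ ≤⟨ *-monoʳ Dᵈ (proj₁ (D^>0 (suc d))) lam≤ ⟩
          λᶜ * k * Dᵈ ≡⟨ trans (solve 4 (λ a i k D → a :* i :* k :* D := a :* k :* (i :* D)) refl dᵈ (Dᵈ ⁻¹) k Dᵈ) (trans (cong (dᵈ * k *_) (⁻¹-inverseˡ (proj₂ (D^>0 (suc d))))) (*-identityʳ _)) ⟩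
          dᵈ * k ≤⟨ *-monoˡ dᵈ (#-nonneg (d ℕ.^ d)) (*-cancel-≤ N>0 kN≤) ⟩
          dᵈ * (N * ((1# - y) * (1# - y))) ≡⟨ solve 3 (λ a N u → a :* (N :* (u :* u)) := N :* (u :* (a :* u))) refl dᵈ N (1# - y) ⟩
          N * ((1# - y) * (dᵈ * (1# - y))) ≤⟨ *-monoˡ N (proj₁ N>0) (*-monoˡ (1# - y) 1-y≥0 tangent) ⟩
          N * ((1# - y) * (# D * (1# + r)) ^ d) ≡⟨ cong₂ (λ s t → N * (s * t)) 1-y≡ (^-distrib (# D) (1# + r) d) ⟩
          N * (# D * r * ((# D) ^ d * (1# + r) ^ d)) ≡⟨ trans (solve 5 (λ N D r e w → N :* (D :* r :* (e :* w)) := N :* (D :* e) :* (r :* w)) refl N (# D) r ((# D) ^ d) ((1# + r) ^ d)) (cong (λ t → N * t * (r * (1# + r) ^ d)) (sym (#-^ D (suc d)))) ⟩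
          N * Dᵈ * (r * (1# + r) ^ d) ∎)
          where
          Dᵈ = # (D ℕ.^ suc d)
          dᵈ = # (d ℕ.^ d)
          1-y≡ : 1# - y ≡ # D * r
          1-y≡ = trans (cong (λ t → 1# - t) y≡) (solve 1 (λ t → lit 1 :- (lit 1 :- t) := t) refl (# D * r))
          1-y≥0 : 0# ≤ 1# - y
          1-y≥0 = subst (0# ≤_) (sym 1-y≡) (*-nonneg (#-nonneg D) r≥0)
          -- Here y = x / (2N), so (1 - y)² = k / N + y².
          kN≤ : N * k ≤ N * (N * ((1# - y) * (1# - y)))
          kN≤ = ≤-by (sq (N * y)) (sq-nonneg (N * y)) (trans (solve 2 (λ N y → N :* (N :* ((lit 1 :- y) :* (lit 1 :- y))) := N :* (N :- lit 2 :* N :* y) :+ (N :* y) :* (N :* y)) refl N y)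
            (cong (λ t → N * t + sq (N * y)) (trans (cong (λ t → N - t) 2Ny) (solve 2 (λ k x → (k :+ x) :- x := k) refl k x))))
          d-y : # d - y ≡ # D * (1# + r)
          d-y = trans (cong₂ _-_ (#-suc D) y≡) (solve 2 (λ D r → (lit 1 :+ D) :- (lit 1 :- D :* r) := D :* (lit 1 :+ r)) refl (# D) r)
          -- The base D (1 + r) is d - y, and the tangent of the power at d gives (d - y)^d ≥ d^d (1
          -- - y).
          tangent : dᵈ * (1# - y) ≤ (# D * (1# + r)) ^ d
          tangent = ≤-trans (≤-reflexive (trans (cong (_* (1# - y)) (#-^ d d)) (sym (trans (cong (λ t → (# d) ^ suc D + # d * (# d) ^ D * (t - # d)) (sym d-y)) (solve 3 (λ a y e → a :* e :+ a :* e :* ((a :- y) :- a) := (a :* e) :* (lit 1 :- y)) refl (# d) y ((# d) ^ D))))))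
            (pow-tangent (#-nonneg d) (*-nonneg (#-nonneg D) (+-nonneg 0≤1 r≥0)) D)
        c≤ : c ≤ # a * k * N ⁻¹
        c≤ = *-cancel-≤ N>0 (begin
          N * c ≤⟨ *-monoʳ c c≥0 large ⟩
          # 2 * # D * # Λ * k * c ≡⟨ trans (solve 5 (λ D L k s i → lit 2 :* D :* L :* k :* (s :* i) := lit 2 :* (s :* L) :* k :* (D :* i)) refl (# D) (# Λ) k (# suc d) ((# D) ⁻¹)) (cong₂ (λ s t → s * k * t) (sym a≡) (inverseʳ (proj₂ (#-pos D′)))) ⟩
          # a * k * 1# ≡⟨ cong (# a * k *_) (sym (inverseʳ (proj₂ N>0))) ⟩
          # a * k * (N * N ⁻¹) ≡⟨ solve 4 (λ a k N i → a :* k :* (N :* i) := N :* (a :* k :* i)) refl (# a) k N (N ⁻¹) ⟩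
          N * (# a * k * N ⁻¹) ∎)
        η≡ : # suc d * r * y ⁻¹ ≡ # 2 * c * k * x ⁻¹ + c
        η≡ = trans (cong (# suc d * r *_) y⁻¹≡) (trans (sym (*-identityʳ _)) (trans (cong (# suc d * r * (# 2 * N * x ⁻¹) *_) (sym (inverseʳ (proj₂ (#-pos D′)))))
          (trans (solve 6 (λ s r N xi D Di → s :* r :* (lit 2 :* N :* xi) :* (D :* Di) := s :* Di :* (lit 2 :* D :* N :* r) :* xi) refl (# suc d) r N (x ⁻¹) (# D) ((# D) ⁻¹))
            (trans (cong (λ t → c * t * x ⁻¹) (trans r-eq (solve 2 (λ k x → (k :+ x) :+ k := lit 2 :* k :+ x) refl k x)))
              (trans (solve 4 (λ c k x i → c :* (lit 2 :* k :+ x) :* i := lit 2 :* c :* k :* i :+ c :* (x :* i)) refl c k x (x ⁻¹)) (cong (# 2 * c * k * x ⁻¹ +_) (trans (cong (c *_) (inverseʳ (proj₂ x>0))) (*-identityʳ c))))))))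
        η≤ : 1# + # suc d * r * y ⁻¹ ≤ 1# + k * (# 2 * c * x ⁻¹ + # a * N ⁻¹)
        η≤ = +-mono ≤-refl (≤-trans (≤-reflexive η≡) (≤-trans (+-mono ≤-refl c≤) (≤-reflexive (solve 5 (λ c k i a j → lit 2 :* c :* k :* i :+ a :* k :* j := k :* (lit 2 :* c :* i :+ a :* j)) refl c k (x ⁻¹) (# a) (N ⁻¹)))))

  -- From sparse configurations to the critical fugacity

  module Iteration (D′ : ℕ) {n′ : ℕ} (G : Graph (suc n′)) (deg : ∀ v → degree G v ℕ.≤ suc (Critical.d D′)) where

    open Critical D′
    open Hardcore G

    -- N slots would give the critical fugacity. The iteration starts from k₀ (plus y spare) slots, where configurations are
    -- sparse, and stops q = N / 4n slots short of N, where the fugacity is still within a factor 1 - O(1/n) of λᶜ.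
    n H s S y k₀ q N L : ℕ
    n  = suc n′
    H  = n ℕ.* n ℕ.+ n
    s  = 24 ℕ.* n ℕ.+ a
    S  = suc s
    y  = S ℕ.+ H
    k₀ = 4 ℕ.* n ℕ.* y
    q  = Λ ℕ.* k₀
    N  = 4 ℕ.* n ℕ.* q
    L  = k₀ ℕ.+ y

    q>0 : Pos (# q)
    q>0 = #-pos _

    N>0 : Pos (# N)
    N>0 = #-pos _

    L>0 : Pos (# L)
    L>0 = #-pos _

    N≡ : # N ≡ # 4 * # n * # q
    N≡ = trans (#-* (4 ℕ.* n) q) (cong (_* # q) (#-* 4 n))

    k₀≡ : # k₀ ≡ # 4 * # n * # y
    k₀≡ = trans (#-* (4 ℕ.* n) y) (cong (_* # y) (#-* 4 n))

    -- Chosen so that k₀ + y slots together have fugacity exactly λᶜ k₀ / N.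
    ρ : Carrier
    ρ = λᶜ * # k₀ * (# N * # L) ⁻¹

    ρ≥0 : 0# ≤ ρ
    ρ≥0 = *-nonneg (*-nonneg (proj₁ λᶜ>0) (#-nonneg k₀)) (proj₁ (⁻¹-pos (*-pos N>0 L>0)))

    ρ≡ : ρ * (# N * # L) ≡ λᶜ * # k₀
    ρ≡ = trans (*-assoc _ _ _) (trans (cong (λᶜ * # k₀ *_) (⁻¹-inverseˡ (proj₂ (*-pos N>0 L>0)))) (*-identityʳ _))

    slots : ℕ → ℕ
    slots k = k ℕ.+ S ℕ.+ H

    slots≡ : ∀ k → # slots k ≡ # k + # y
    slots≡ k = trans (cong #_ (ℕₚ.+-assoc k S H)) (#-+ k y)

    -- From k₀ on, (k + y) / (k₀ + y) ≤ k / k₀: the share of the spare slots can only shrink.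
    fugacity : ∀ k → k₀ ℕ.≤ k → ρ * # slots k * # N ≤ λᶜ * # k
    fugacity k k₀≤k = *-cancel-≤ L>0 (begin
      # L * (ρ * # slots k * # N) ≡⟨ trans (solve 4 (λ L r m N → L :* (r :* m :* N) := r :* (N :* L) :* m) refl (# L) ρ (# slots k) (# N)) (cong₂ _*_ ρ≡ (slots≡ k)) ⟩
      λᶜ * # k₀ * (# k + # y) ≤⟨ ≤-by (λᶜ * (# y * (# k - # k₀))) (*-nonneg (proj₁ λᶜ>0) (*-nonneg (#-nonneg y) (≤⇒0≤- (#-mono k₀≤k))))
         (solve 4 (λ l k0 k y → (k0 :+ y) :* (l :* k) := l :* k0 :* (k :+ y) :+ l :* (y :* (k :- k0))) refl λᶜ (# k₀) (# k) (# y)) ⟩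
      (# k₀ + # y) * (λᶜ * # k) ≡⟨ cong (_* (λᶜ * # k)) (sym (#-+ k₀ y)) ⟩
      # L * (λᶜ * # k) ∎)

    -- This is (η - 1) / k for the η of `critical-SI` with x = N - k.
    h : ℕ → Carrier
    h k = # 2 * c * (# (N ℕ.∸ k)) ⁻¹ + # a * (# N) ⁻¹

    D*c : # D * c ≡ # suc d
    D*c = trans (solve 3 (λ D s i → D :* (s :* i) := s :* (D :* i)) refl (# D) (# suc d) ((# D) ⁻¹)) (trans (cong (# suc d *_) (inverseʳ (proj₂ (#-pos D′)))) (*-identityʳ _))

    b : ℕ → Carrier
    b zero    = # 8
    b (suc i) = b i * (1# + h (suc (i ℕ.+ k₀)))

    -- The quotient of (k + S) by the number of slots, with k = i + k₀, is an integrating factor: it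
    -- absorbs the ratio m / (m + 1) of `localise`, so that the recursion for `b` is a plain
    -- product.
    B : ℕ → Carrier
    B i = b i * # (i ℕ.+ k₀ ℕ.+ S) * (# slots (i ℕ.+ k₀)) ⁻¹

    module Room {k : ℕ} (room : k ℕ.+ q ℕ.≤ N) where

      k≤N : k ℕ.≤ N
      k≤N = ℕₚ.≤-trans (ℕₚ.m≤m+n k q) room

      q≤x : # q ≤ # (N ℕ.∸ k)
      q≤x = #-mono (subst (ℕ._≤ N ℕ.∸ k) (ℕₚ.m+n∸m≡n k q) (ℕₚ.∸-monoˡ-≤ k room))

      x>0 : Pos (# (N ℕ.∸ k))
      x>0 = pos-≤ q>0 q≤x

      N≡k+x : # N ≡ # k + # (N ℕ.∸ k)
      N≡k+x = trans (cong #_ (sym (ℕₚ.m+[n∸m]≡n k≤N))) (#-+ k (N ℕ.∸ k))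

      h≥0 : 0# ≤ h k
      h≥0 = +-nonneg (*-nonneg (*-nonneg (#-nonneg 2) c≥0) (proj₁ (⁻¹-pos x>0))) (*-nonneg (#-nonneg a) (proj₁ (⁻¹-pos N>0)))

      c≤3 : c ≤ # 3
      c≤3 = *-cancel-≤ (#-pos D′) (begin
        # D * c ≡⟨ D*c ⟩
        # suc d ≤⟨ #-mono {suc d} {D ℕ.* 3} (ℕ.s≤s (ℕ.s≤s (ℕ.s≤s (ℕₚ.m≤m*n D′ 3)))) ⟩
        # (D ℕ.* 3) ≡⟨ #-* D 3 ⟩
        # D * # 3 ∎)

      N/x≤ : # N * (# (N ℕ.∸ k)) ⁻¹ ≤ # 4 * # n
      N/x≤ = *-cancel-≤ x>0 (begin
        # (N ℕ.∸ k) * (# N * (# (N ℕ.∸ k)) ⁻¹) ≡⟨ trans (solve 3 (λ x N i → x :* (N :* i) := N :* (x :* i)) refl (# (N ℕ.∸ k)) (# N) ((# (N ℕ.∸ k)) ⁻¹)) (trans (cong (# N *_) (inverseʳ (proj₂ x>0))) (*-identityʳ _)) ⟩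
        # N ≡⟨ N≡ ⟩
        # 4 * # n * # q ≤⟨ *-monoˡ _ (*-nonneg (#-nonneg 4) (#-nonneg n)) q≤x ⟩
        # 4 * # n * # (N ℕ.∸ k) ≡⟨ *-comm _ _ ⟩
        # (N ℕ.∸ k) * (# 4 * # n) ∎)

      -- Origin of `s`: c ≤ 3 because Δ ≥ 3, and N / (N - k) ≤ 4n as long as N - k ≥ q, so k h ≤ 2 ·
      -- 3 · 4n + a.
      g≤s : # k * h k ≤ # s
      g≤s = begin
        # k * h k ≤⟨ *-monoʳ (h k) h≥0 (#-mono k≤N) ⟩
        # N * h k ≡⟨ trans (solve 5 (λ N c i a j → N :* (lit 2 :* c :* i :+ a :* j) := lit 2 :* c :* (N :* i) :+ a :* (N :* j)) refl (# N) c ((# (N ℕ.∸ k)) ⁻¹) (# a) ((# N) ⁻¹)) (cong (λ t → # 2 * c * (# N * (# (N ℕ.∸ k)) ⁻¹) + # a * t) (inverseʳ (proj₂ N>0))) ⟩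
        # 2 * c * (# N * (# (N ℕ.∸ k)) ⁻¹) + # a * 1# ≤⟨ +-monoˡ-≤ _ (*-mono (*-nonneg (#-nonneg 2) c≥0) (*-nonneg (#-nonneg 4) (#-nonneg n)) (*-monoˡ (# 2) (#-nonneg 2) c≤3) N/x≤) ⟩
        # 2 * # 3 * (# 4 * # n) + # a * 1# ≡⟨ solve 2 (λ n a → lit 2 :* lit 3 :* (lit 4 :* n) :+ a :* lit 1 := lit 24 :* n :+ a) refl (# n) (# a) ⟩
        # 24 * # n + # a ≡⟨ sym (trans (#-+ (24 ℕ.* n) a) (cong (_+ # a) (#-* 24 n))) ⟩
        # s ∎

    b≥0 : ∀ i → i ℕ.+ k₀ ℕ.+ q ℕ.≤ N → 0# ≤ b i
    b≥0 zero    room = #-nonneg 8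
    b≥0 (suc i) room = *-nonneg (b≥0 i (ℕₚ.≤-trans (ℕₚ.n≤1+n _) room)) (+-nonneg 0≤1 (Room.h≥0 {suc (i ℕ.+ k₀)} room))

    m>0 : ∀ k → Pos (# slots k)
    m>0 k = subst Pos (cong #_ (sym (trans (ℕₚ.+-assoc k S H) (ℕₚ.+-suc k (s ℕ.+ H))))) (#-pos _)

    -- Origin of N = 4 n Λ k₀: the initial fugacity is at most λᶜ k₀ / N ≤ 1 / (4n).
    sparse : ∀ j → # 4 * # n * slot ρ (slots k₀) (suc j) ≤ slot ρ (slots k₀) j
    sparse j = begin
      # 4 * # n * slot ρ (slots k₀) (suc j) ≡⟨ cong (# 4 * # n *_) (slot-sucʳ ρ (slots k₀) j) ⟩
      # 4 * # n * (ρ * (# slots k₀ - # j) * slot ρ (slots k₀) j) ≤⟨ *-monoˡ _ 4n≥0 (*-monoʳ _ (slot-nonneg ρ≥0 (slots k₀) j) (*-monoˡ ρ ρ≥0 (≤-by (# j) (#-nonneg j) (solve 2 (λ m j → m := m :- j :+ j) refl (# slots k₀) (# j))))) ⟩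
      # 4 * # n * (ρ * # slots k₀ * slot ρ (slots k₀) j) ≡⟨ sym (*-assoc _ _ _) ⟩
      # 4 * # n * (ρ * # slots k₀) * slot ρ (slots k₀) j ≤⟨ *-monoʳ _ (slot-nonneg ρ≥0 (slots k₀) j) 4nρm≤1 ⟩
      1# * slot ρ (slots k₀) j ≡⟨ *-identityˡ _ ⟩
      slot ρ (slots k₀) j ∎
      where
      4n≥0 = *-nonneg (#-nonneg 4) (#-nonneg n)
      4nρm≤1 : # 4 * # n * (ρ * # slots k₀) ≤ 1#
      4nρm≤1 = *-cancel-≤ N>0 (begin
        # N * (# 4 * # n * (ρ * # slots k₀)) ≡⟨ solve 4 (λ N a r m → N :* (a :* (r :* m)) := a :* (r :* m :* N)) refl (# N) (# 4 * # n) ρ (# slots k₀) ⟩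
        # 4 * # n * (ρ * # slots k₀ * # N) ≤⟨ *-monoˡ _ 4n≥0 (fugacity k₀ ℕₚ.≤-refl) ⟩
        # 4 * # n * (λᶜ * # k₀) ≤⟨ *-monoˡ _ 4n≥0 (*-monoʳ _ (#-nonneg k₀) λᶜ≤Λ) ⟩
        # 4 * # n * (# Λ * # k₀) ≡⟨ trans (cong (# 4 * # n *_) (sym (#-* Λ k₀))) (trans (sym N≡) (sym (*-identityʳ _))) ⟩
        # N * 1# ∎)

    -- The value 8 of `b` at 0 is twice the sparse constant 4, because H ≤ k₀ + S makes the quotient
    -- in `B` at least 1/2.
    base : ∀ A → Poincaré (wt (indep A) (slot ρ (slots k₀))) (B 0)
    base A = Poincaré-mono (wt-nonneg (indep A) (slot-nonneg ρ≥0 (slots k₀))) 4≤B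
      (poincaré-sparse (indep A) (indep-down A) (slot-nonneg ρ≥0 (slots k₀)) sparse)
      where
      H≤ : H ℕ.≤ k₀ ℕ.+ S
      H≤ = ℕₚ.≤-trans (ℕₚ.≤-trans (ℕₚ.m≤n+m H S) (ℕₚ.m≤n*m y (4 ℕ.* n))) (ℕₚ.m≤m+n k₀ S)
      4≤B : # 4 ≤ B 0
      4≤B = *-cancel-≤ (m>0 k₀) (begin
        # slots k₀ * # 4 ≡⟨ cong (_* # 4) (#-+ (k₀ ℕ.+ S) H) ⟩
        (# (k₀ ℕ.+ S) + # H) * # 4 ≤⟨ *-monoʳ (# 4) (#-nonneg 4) (+-mono ≤-refl (#-mono H≤)) ⟩
        (# (k₀ ℕ.+ S) + # (k₀ ℕ.+ S)) * # 4 ≡⟨ solve 1 (λ x → (x :+ x) :* lit 4 := lit 8 :* x :* lit 1) refl (# (k₀ ℕ.+ S)) ⟩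
        # 8 * # (k₀ ℕ.+ S) * 1# ≡⟨ trans (cong (# 8 * # (k₀ ℕ.+ S) *_) (sym (inverseʳ (proj₂ (m>0 k₀))))) (solve 3 (λ e m i → e :* (m :* i) := m :* (e :* i)) refl (# 8 * # (k₀ ℕ.+ S)) (# slots k₀) ((# slots k₀) ⁻¹)) ⟩
        # slots k₀ * B 0 ∎)

    link-Poincaré : ∀ {c B} → (∀ A → Poincaré (wt (indep A) c) B) → ∀ A v → Poincaré (wt (link (indep A) v) c) B
    link-Poincaré {c} pc A v with lookup A v in eq
    ... | true  = Poincaré-cong (λ σ → cong (λ t → 𝟙 t * c (size σ)) (sym (trans (indep-link A v σ) (cong (_∧ indep (shrink v A) σ) eq)))) (pc (shrink v A))
    ... | false = Poincaré-zero (λ σ → trans (cong (λ t → 𝟙 t * c (size σ)) (trans (indep-link A v σ) (cong (_∧ indep (shrink v A) σ) eq))) (zeroˡ _))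

    -- Slot weights inherit spectral independence from the hardcore model of fugacity ρ M by
    -- comparison, at the cost of a factor κ = 1 + n² / (k + S).
    iterate : ∀ i → i ℕ.+ k₀ ℕ.+ q ℕ.≤ N → ∀ A → Poincaré (wt (indep A) (slot ρ (slots (i ℕ.+ k₀)))) (B i)
    iterate zero    room = base
    iterate (suc i) room A = localise (indep A) ρ≥0 m {B i} {B (suc i)} {η * κ} Bi≥0 (*-pos η>0 κ>0) si
        (iterate i room′ A) (link-Poincaré {slot ρ m} (iterate i room′) A) Mn>0 (subst Pos (sym gapη≡) (*-pos κ>0 Y-g>0)) BB
      where
      room′ : i ℕ.+ k₀ ℕ.+ q ℕ.≤ N
      room′ = ℕₚ.≤-trans (ℕₚ.n≤1+n _) room
      k = suc (i ℕ.+ k₀)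
      m = slots (i ℕ.+ k₀)
      open Room {k} room
      g = # k * h k
      η = 1# + g
      Mn = # suc m - # n
      MH = # (k ℕ.+ S)
      Y = # (i ℕ.+ k₀ ℕ.+ S)
      κ = Mn * MH ⁻¹
      g≥0 = *-nonneg (#-nonneg k) h≥0
      η>0 : Pos η
      η>0 = +-pos 1-pos g≥0
      MH>0 : Pos MH
      MH>0 = #-pos _
      M≡ : # suc m ≡ MH + (# n * # n + # n)
      M≡ = trans (#-+ (k ℕ.+ S) H) (cong (MH +_) (trans (#-+ (n ℕ.* n) n) (cong (_+ # n) (#-* n n))))
      Mn≡ : Mn ≡ MH + # n * # n
      Mn≡ = trans (cong (_- # n) M≡) (solve 3 (λ a b n → (a :+ (b :+ n)) :- n := a :+ b) refl MH (# n * # n) (# n))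
      Mn>0 : Pos Mn
      Mn>0 = subst Pos (sym Mn≡) (+-pos MH>0 (*-nonneg (#-nonneg n) (#-nonneg n)))
      κ>0 : Pos κ
      κ>0 = *-pos Mn>0 (⁻¹-pos MH>0)
      κMH : κ * MH ≡ Mn
      κMH = trans (*-assoc _ _ _) (trans (cong (Mn *_) (⁻¹-inverseˡ (proj₂ MH>0))) (*-identityʳ _))
      MH≡ : MH ≡ 1# + Y
      MH≡ = #-suc (i ℕ.+ k₀ ℕ.+ S)
      -- Since M - n = κ (k + S), the factor κ comes out of the gap and cancels in the ratio (M - n)
      -- / (M - n - η κ): the comparison costs nothing here.
      gapη≡ : # suc m - # n - η * κ ≡ κ * (Y - g)
      gapη≡ = trans (cong (_- η * κ) (sym κMH)) (trans (cong (λ t → κ * t - η * κ) MH≡) (solve 3 (λ k Y g → k :* (lit 1 :+ Y) :- (lit 1 :+ g) :* k := k :* (Y :- g)) refl κ Y g))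
      Y≡ : Y ≡ # k + # s
      Y≡ = trans (cong #_ (ℕₚ.+-suc (i ℕ.+ k₀) s)) (#-+ k s)
      Y-g>0 : Pos (Y - g)
      Y-g>0 = pos-≤ (#-pos (i ℕ.+ k₀)) (≤-by (# s - g) (≤⇒0≤- g≤s) (trans (cong (_- g) Y≡) (+-assoc _ _ _)))
      Bi≥0 : 0# ≤ B i
      Bi≥0 = *-nonneg (*-nonneg (b≥0 i room′) (#-nonneg (i ℕ.+ k₀ ℕ.+ S))) (proj₁ (⁻¹-pos (m>0 (i ℕ.+ k₀))))
      -- After cancellation this is Y ≤ (1 + h)(Y - k h) with Y = k + s. The difference is h (s - k
      -- h), so the s spare slots absorb the second order term; S = s + 1 because one unit goes into
      -- η = 1 + g.
      BB : B i * # m * Mn ≤ B (suc i) * (# suc m * (# suc m - # n - η * κ))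
      BB = begin
        B i * # m * Mn ≡⟨ trans (solve 5 (λ b Y j m M → b :* Y :* j :* m :* M := b :* Y :* (m :* j) :* M) refl (b i) Y ((# m) ⁻¹) (# m) Mn) (trans (cong (λ t → b i * Y * t * Mn) (inverseʳ (proj₂ (m>0 (i ℕ.+ k₀))))) (solve 3 (λ b Y M → b :* Y :* lit 1 :* M := b :* M :* Y) refl (b i) Y Mn)) ⟩
        b i * Mn * Y ≤⟨ *-monoˡ _ (*-nonneg (b≥0 i room′) (proj₁ Mn>0)) (≤-by (h k * (# s - g)) (*-nonneg h≥0 (≤⇒0≤- g≤s)) (trans (cong (λ t → (1# + h k) * (t - g)) Y≡) (trans (solve 3 (λ h k s → (lit 1 :+ h) :* ((k :+ s) :- k :* h) := (k :+ s) :+ h :* (s :- k :* h)) refl (h k) (# k) (# s)) (cong (_+ h k * (# s - g)) (sym Y≡))))) ⟩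
        b i * Mn * ((1# + h k) * (Y - g)) ≡⟨ trans (cong (λ t → b i * t * ((1# + h k) * (Y - g))) (sym κMH)) (trans (solve 6 (λ b k H o y l → b :* (k :* H) :* (o :* y) := b :* o :* H :* (k :* y) :* lit 1) refl (b i) κ MH (1# + h k) (Y - g) 1#) (cong₂ (λ s t → b i * (1# + h k) * MH * s * t) (sym gapη≡) (sym (inverseʳ (proj₂ (m>0 k)))))) ⟩
        b i * (1# + h k) * MH * (# suc m - # n - η * κ) * (# suc m * (# suc m) ⁻¹) ≡⟨ solve 4 (λ e g M j → e :* g :* (M :* j) := e :* j :* (M :* g)) refl (b i * (1# + h k) * MH) (# suc m - # n - η * κ) (# suc m) ((# suc m) ⁻¹) ⟩
        B (suc i) * (# suc m * (# suc m - # n - η * κ)) ∎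
      lam≥0 : 0# ≤ ρ * # suc m
      lam≥0 = *-nonneg ρ≥0 (#-nonneg (suc m))
      si-hardcore : SpectrallyIndependent (μ lam≥0 A) η
      si-hardcore = critical-SI G deg lam≥0 (#-nonneg k) x>0 N≡k+x (fugacity k (ℕₚ.m≤n+m k₀ (suc i))) A
      n≤m : n ℕ.≤ suc m
      n≤m = ℕₚ.≤-trans (ℕₚ.m≤n+m n (n ℕ.* n)) (ℕₚ.m≤n+m H (k ℕ.+ S))
      -- Origin of H = n² + n: it covers n + j n for every size j ≤ n, leaving at least k + S on the
      -- left of `slot-≥`.
      upper : ∀ j → j ℕ.≤ n → (ρ * # suc m) ^ j ≤ κ * slot ρ (suc m) j
      upper j j≤n = *-cancel-≤ MH>0 (begin
        MH * (ρ * # suc m) ^ j ≤⟨ *-monoʳ _ (^-nonneg lam≥0 j) (≤-by (# n * # n - # j * # n) (≤⇒0≤- (*-monoʳ (# n) (#-nonneg n) (#-mono j≤n))) (trans (cong (_- # j * # n) Mn≡) (+-assoc _ _ _))) ⟩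
        (# suc m - # n - # j * # n) * (ρ * # suc m) ^ j ≤⟨ slot-≥ ρ≥0 n≤m j j≤n ⟩
        Mn * slot ρ (suc m) j ≡⟨ trans (cong (_* slot ρ (suc m) j) (sym κMH)) (solve 3 (λ k M s → k :* M :* s := M :* (k :* s)) refl κ MH (slot ρ (suc m) j)) ⟩
        MH * (κ * slot ρ (suc m) j) ∎)
      si : SpectrallyIndependent (wt (indep A) (slot ρ (suc m))) (η * κ)
      si = Compare.compare-SI (wt-nonneg (indep A) (slot-nonneg ρ≥0 (suc m)))
        (λ σ → *-monoˡ _ (𝟙-nonneg (indep A σ)) (slot-≤ ρ≥0 (suc m) (size σ)))
        (λ σ → ≤-trans (*-monoˡ _ (𝟙-nonneg (indep A σ)) (upper (size σ) (size≤n σ))) (≤-reflexive (solve 3 (λ x k s → x :* (k :* s) := k :* (x :* s)) refl (𝟙 (indep A σ)) κ (slot ρ (suc m) (size σ)))))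
        (proj₁ η>0) si-hardcore

    -- Growth of the Poincaré constant

    e₁ e₂ : ℕ
    e₁ = suc (suc D) ℕ.* 2
    e₂ = D ℕ.* (2 ℕ.* a)

    -- The exponent c is not an integer in general, but D c = D + 2. Two uses of AM-GM raise the
    -- exponent from D to D + 1 to D + 2, and the base ends as 1 + 2 y ≤ (1 + y)².
    singular-factor : ∀ {y} → 0# ≤ y → (1# + # 2 * c * y) ^ D ≤ (1# + y) ^ e₁
    singular-factor {y} y≥0 = begin
      x₀ ^ D ≤⟨ am-gm x₀≥0 m₁≥0 D m₁≡ ⟩
      m₁ ^ suc D ≤⟨ am-gm m₁≥0 m₂≥0 (suc D) m₂≡ ⟩
      (1# + # 2 * y) ^ suc (suc D) ≤⟨ ^-mono m₂≥0 (≤-by (sq y) (sq-nonneg y) (solve 1 (λ y → (lit 1 :+ y) :* ((lit 1 :+ y) :* lit 1) := lit 1 :+ lit 2 :* y :+ y :* y) refl y)) (suc (suc D)) ⟩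
      ((1# + y) ^ 2) ^ suc (suc D) ≡⟨ sym (^-* (1# + y) (suc (suc D)) 2) ⟩
      (1# + y) ^ e₁ ∎
      where
      x₀ = 1# + # 2 * c * y
      x₀≥0 = +-nonneg 0≤1 (*-nonneg (*-nonneg (#-nonneg 2) c≥0) y≥0)
      m₁ = (# D * x₀ + 1#) * (# suc D) ⁻¹
      m₁≥0 = *-nonneg (+-nonneg (*-nonneg (#-nonneg D) x₀≥0) 0≤1) (proj₁ (⁻¹-pos (#-pos D)))
      m₂≥0 = +-nonneg 0≤1 (*-nonneg (#-nonneg 2) y≥0)
      m₁≡ : # suc D * m₁ ≡ # D * x₀ + 1#
      m₁≡ = trans (solve 3 (λ a b i → a :* (b :* i) := b :* (a :* i)) refl (# suc D) (# D * x₀ + 1#) ((# suc D) ⁻¹)) (trans (cong ((# D * x₀ + 1#) *_) (inverseʳ (proj₂ (#-pos D)))) (*-identityʳ _))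
      m₂≡ : # suc (suc D) * (1# + # 2 * y) ≡ # suc D * m₁ + 1#
      m₂≡ = sym (trans (cong (_+ 1#) m₁≡) (trans (solve 3 (λ D c y → (D :* (lit 1 :+ lit 2 :* c :* y) :+ lit 1) :+ lit 1 := (D :+ lit 2) :+ lit 2 :* (D :* c) :* y) refl (# D) c y)
        (trans (cong₂ (λ s t → s + # 2 * t * y) (sym (trans (#-+ 2 D) (+-comm _ _))) D*c) (solve 2 (λ s y → s :+ lit 2 :* s :* y := s :* (lit 1 :+ lit 2 :* y)) refl (# suc d) y))))

    -- A substitute for an exponential bound: 1/N ≤ 2/(N + k) as k ≤ N, and the factors 1 + 1/(N +
    -- k) telescope.
    regular-factor : ∀ k → k ℕ.≤ N → (1# + # a * (# N) ⁻¹) ^ D ≤ (1# + (# (N ℕ.+ k)) ⁻¹) ^ e₂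
    regular-factor k k≤N = ≤-trans (^-mono (+-nonneg 0≤1 (*-nonneg (#-nonneg a) (proj₁ (⁻¹-pos N>0)))) step D) (≤-reflexive (sym (^-* (1# + v) D (2 ℕ.* a))))
      where
      v = (# (N ℕ.+ k)) ⁻¹
      N+k>0 : Pos (# (N ℕ.+ k))
      N+k>0 = pos-≤ N>0 (#-mono (ℕₚ.m≤m+n N k))
      v≥0 = proj₁ (⁻¹-pos N+k>0)
      N⁻¹≤ : (# N) ⁻¹ ≤ # 2 * v
      N⁻¹≤ = *-cancel-≤ N>0 (*-cancel-≤ N+k>0 (begin
        # (N ℕ.+ k) * (# N * (# N) ⁻¹) ≡⟨ trans (cong (# (N ℕ.+ k) *_) (inverseʳ (proj₂ N>0))) (*-identityʳ _) ⟩
        # (N ℕ.+ k) ≤⟨ #-mono (ℕₚ.+-monoʳ-≤ N k≤N) ⟩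
        # (N ℕ.+ N) ≡⟨ trans (#-+ N N) (solve 1 (λ N → N :+ N := N :* lit 2 :* lit 1) refl (# N)) ⟩
        # N * # 2 * 1# ≡⟨ trans (cong (# N * # 2 *_) (sym (inverseʳ (proj₂ N+k>0)))) (solve 3 (λ N x v → N :* lit 2 :* (x :* v) := x :* (N :* (lit 2 :* v))) refl (# N) (# (N ℕ.+ k)) v) ⟩
        # (N ℕ.+ k) * (# N * (# 2 * v)) ∎))
      step : 1# + # a * (# N) ⁻¹ ≤ (1# + v) ^ (2 ℕ.* a)
      step = ≤-trans (+-mono ≤-refl (≤-trans (*-monoˡ (# a) (#-nonneg a) N⁻¹≤) (≤-reflexive (trans (solve 2 (λ a v → a :* (lit 2 :* v) := lit 2 :* a :* v) refl (# a) v) (cong (_* v) (sym (#-* 2 a)))))))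
        (bernoulli (+-nonneg 0≤1 v≥0) (2 ℕ.* a))

    -- Both products telescope: the factors 1 + 1/(N - k) multiply to a quotient with denominator N
    -- - k, and the factors 1 + 1/(N + k) to one with numerator N + k. The ranges are extended down
    -- to k = 0.
    growth : ∀ i → i ℕ.+ k₀ ℕ.+ q ℕ.≤ N →
      b i ^ D * (# (N ℕ.∸ (i ℕ.+ k₀)) ^ e₁ * # N ^ e₂) ≤ # 8 ^ D * (# N ^ e₁ * # (N ℕ.+ (i ℕ.+ k₀)) ^ e₂)
    growth zero room = *-monoˡ _ (^-nonneg (#-nonneg 8) D) (*-mono (^-nonneg (#-nonneg _) e₁) (^-nonneg (#-nonneg _) e₂)
      (^-mono (#-nonneg _) (#-mono (ℕₚ.m∸n≤m N k₀)) e₁) (^-mono (#-nonneg _) (#-mono (ℕₚ.m≤m+n N k₀)) e₂))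
    growth (suc i) room = begin
      (b i * (1# + h k)) ^ D * (X ^ e₁ * # N ^ e₂) ≡⟨ cong (_* (X ^ e₁ * # N ^ e₂)) (^-distrib (b i) (1# + h k) D) ⟩
      b i ^ D * (1# + h k) ^ D * (X ^ e₁ * # N ^ e₂) ≤⟨ *-monoʳ _ (*-nonneg (^-nonneg (proj₁ x>0) e₁) (^-nonneg (#-nonneg N) e₂)) (*-monoˡ _ (^-nonneg (b≥0 i room′) D) factor) ⟩
      b i ^ D * ((1# + X ⁻¹) ^ e₁ * (1# + v) ^ e₂) * (X ^ e₁ * # N ^ e₂) ≡⟨ trans (solve 5 (λ b s t x N → b :* (s :* t) :* (x :* N) := b :* ((s :* x) :* N) :* t) refl (b i ^ D) ((1# + X ⁻¹) ^ e₁) ((1# + v) ^ e₂) (X ^ e₁) (# N ^ e₂))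
          (cong (λ t → b i ^ D * (t * # N ^ e₂) * (1# + v) ^ e₂) (trans (sym (^-distrib (1# + X ⁻¹) X e₁)) (cong (_^ e₁) X+1))) ⟩
      b i ^ D * (# (N ℕ.∸ (i ℕ.+ k₀)) ^ e₁ * # N ^ e₂) * (1# + v) ^ e₂ ≤⟨ *-monoʳ _ (^-nonneg (+-nonneg 0≤1 v≥0) e₂) (growth i room′) ⟩
      # 8 ^ D * (# N ^ e₁ * # (N ℕ.+ (i ℕ.+ k₀)) ^ e₂) * (1# + v) ^ e₂ ≡⟨ trans (solve 4 (λ a n x v → a :* (n :* x) :* v := a :* (n :* (x :* v))) refl (# 8 ^ D) (# N ^ e₁) (# (N ℕ.+ (i ℕ.+ k₀)) ^ e₂) ((1# + v) ^ e₂))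
          (cong (λ t → # 8 ^ D * (# N ^ e₁ * t)) (trans (sym (^-distrib (# (N ℕ.+ (i ℕ.+ k₀))) (1# + v) e₂)) (cong (_^ e₂) N+k+1))) ⟩
      # 8 ^ D * (# N ^ e₁ * # (N ℕ.+ k) ^ e₂) ∎
      where
      room′ : i ℕ.+ k₀ ℕ.+ q ℕ.≤ N
      room′ = ℕₚ.≤-trans (ℕₚ.n≤1+n _) room
      k = suc (i ℕ.+ k₀)
      open Room {k} room
      X = # (N ℕ.∸ k)
      v = (# (N ℕ.+ (i ℕ.+ k₀))) ⁻¹
      N+k>0 : Pos (# (N ℕ.+ (i ℕ.+ k₀)))
      N+k>0 = pos-≤ N>0 (#-mono (ℕₚ.m≤m+n N (i ℕ.+ k₀)))
      v≥0 = proj₁ (⁻¹-pos N+k>0)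
      X⁻¹≥0 = proj₁ (⁻¹-pos x>0)
      X+1 : (1# + X ⁻¹) * X ≡ # (N ℕ.∸ (i ℕ.+ k₀))
      X+1 = trans (solve 2 (λ j x → (lit 1 :+ j) :* x := x :+ j :* x) refl (X ⁻¹) X) (trans (cong (X +_) (⁻¹-inverseˡ (proj₂ x>0))) (trans (+-comm X 1#) (trans (sym (#-suc (N ℕ.∸ k))) (cong #_ (sym (ℕₚ.+-∸-assoc 1 k≤N))))))
      N+k+1 : # (N ℕ.+ (i ℕ.+ k₀)) * (1# + v) ≡ # (N ℕ.+ k)
      N+k+1 = trans (solve 2 (λ x v → x :* (lit 1 :+ v) := x :+ x :* v) refl (# (N ℕ.+ (i ℕ.+ k₀))) v) (trans (cong (# (N ℕ.+ (i ℕ.+ k₀)) +_) (inverseʳ (proj₂ N+k>0))) (trans (+-comm _ _) (trans (sym (#-suc _)) (cong #_ (sym (ℕₚ.+-suc N (i ℕ.+ k₀)))))))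
      factor : (1# + h k) ^ D ≤ (1# + X ⁻¹) ^ e₁ * (1# + v) ^ e₂
      factor = begin
        (1# + h k) ^ D ≤⟨ ^-mono (+-nonneg 0≤1 h≥0) (≤-by (# 2 * c * X ⁻¹ * (# a * (# N) ⁻¹)) (*-nonneg u≥0 w≥0) (solve 2 (λ u w → (lit 1 :+ u) :* (lit 1 :+ w) := lit 1 :+ (u :+ w) :+ u :* w) refl (# 2 * c * X ⁻¹) (# a * (# N) ⁻¹))) D ⟩
        ((1# + # 2 * c * X ⁻¹) * (1# + # a * (# N) ⁻¹)) ^ D ≡⟨ ^-distrib _ _ D ⟩
        (1# + # 2 * c * X ⁻¹) ^ D * (1# + # a * (# N) ⁻¹) ^ D ≤⟨ *-mono (^-nonneg (+-nonneg 0≤1 u≥0) D) (^-nonneg (+-nonneg 0≤1 v≥0) e₂) (singular-factor X⁻¹≥0) (regular-factor (i ℕ.+ k₀) (ℕₚ.≤-trans (ℕₚ.n≤1+n _) k≤N)) ⟩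
        (1# + X ⁻¹) ^ e₁ * (1# + v) ^ e₂ ∎
        where
        u≥0 = *-nonneg (*-nonneg (#-nonneg 2) c≥0) X⁻¹≥0
        w≥0 = *-nonneg (#-nonneg a) (proj₁ (⁻¹-pos N>0))

    -- The Poincaré inequality at the critical fugacity

    K iᵉ : ℕ
    K = N ℕ.∸ q
    iᵉ = K ℕ.∸ k₀

    2q≤N : q ℕ.+ q ℕ.≤ N
    2q≤N = ℕₚ.≤-trans (ℕₚ.≤-reflexive (cong (q ℕ.+_) (sym (ℕₚ.+-identityʳ q)))) (ℕₚ.*-monoˡ-≤ q {2} {4 ℕ.* n} (ℕₚ.≤-trans (ℕ.s≤s (ℕ.s≤s (ℕ.z≤n {2}))) (ℕₚ.m≤m*n 4 n)))

    q≤N : q ℕ.≤ N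
    q≤N = ℕₚ.≤-trans (ℕₚ.m≤m+n q q) 2q≤N

    k₀≤K : k₀ ℕ.≤ K
    k₀≤K = ℕₚ.≤-trans (ℕₚ.m≤n*m k₀ Λ) (subst (ℕ._≤ K) (ℕₚ.m+n∸m≡n q q) (ℕₚ.∸-monoˡ-≤ q 2q≤N))

    iᵉ+k₀ : iᵉ ℕ.+ k₀ ≡ K
    iᵉ+k₀ = ℕₚ.m∸n+n≡m k₀≤K

    roomᵉ : iᵉ ℕ.+ k₀ ℕ.+ q ℕ.≤ N
    roomᵉ = ℕₚ.≤-reflexive (trans (cong (ℕ._+ q) iᵉ+k₀) (ℕₚ.m∸n+n≡m q≤N))

    bᵉ : Carrier
    bᵉ = b iᵉ

    -- At the end N - k = q, so N / q = 4n carries the exponent e₁ = 2 (D + 2), which is D times 2 +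
    -- 4/D, while (N + k) / N ≤ 2.
    bᵉ-bound : bᵉ ^ D ≤ # 8 ^ D * (# 4 ^ e₁ * # 2 ^ e₂) * # n ^ e₁
    bᵉ-bound = *-cancel-≤ (*-pos (^-pos q>0 e₁) (^-pos N>0 e₂)) (begin
      # q ^ e₁ * # N ^ e₂ * bᵉ ^ D ≡⟨ *-comm _ _ ⟩
      bᵉ ^ D * (# q ^ e₁ * # N ^ e₂) ≡⟨ cong (λ t → bᵉ ^ D * (# t ^ e₁ * # N ^ e₂)) (sym (trans (cong (N ℕ.∸_) iᵉ+k₀) (ℕₚ.m∸[m∸n]≡n q≤N))) ⟩
      bᵉ ^ D * (# (N ℕ.∸ (iᵉ ℕ.+ k₀)) ^ e₁ * # N ^ e₂) ≤⟨ growth iᵉ roomᵉ ⟩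
      # 8 ^ D * (# N ^ e₁ * # (N ℕ.+ (iᵉ ℕ.+ k₀)) ^ e₂) ≤⟨ *-monoˡ _ (^-nonneg (#-nonneg 8) D) (*-monoˡ _ (^-nonneg (#-nonneg N) e₁) (^-mono (#-nonneg _) N+K≤ e₂)) ⟩
      # 8 ^ D * (# N ^ e₁ * (# 2 * # N) ^ e₂) ≡⟨ cong₂ (λ s t → # 8 ^ D * (s * t)) (trans (cong (_^ e₁) N≡) (trans (^-distrib (# 4 * # n) (# q) e₁) (cong (_* # q ^ e₁) (^-distrib (# 4) (# n) e₁)))) (^-distrib (# 2) (# N) e₂) ⟩
      # 8 ^ D * (# 4 ^ e₁ * # n ^ e₁ * # q ^ e₁ * (# 2 ^ e₂ * # N ^ e₂)) ≡⟨ solve 6 (λ e f n q t N → e :* (f :* n :* q :* (t :* N)) := q :* N :* (e :* (f :* t) :* n)) refl (# 8 ^ D) (# 4 ^ e₁) (# n ^ e₁) (# q ^ e₁) (# 2 ^ e₂) (# N ^ e₂) ⟩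
      # q ^ e₁ * # N ^ e₂ * (# 8 ^ D * (# 4 ^ e₁ * # 2 ^ e₂) * # n ^ e₁) ∎)
      where
      N+K≤ : # (N ℕ.+ (iᵉ ℕ.+ k₀)) ≤ # 2 * # N
      N+K≤ = ≤-trans (#-mono (ℕₚ.+-monoʳ-≤ N (subst (ℕ._≤ N) (sym iᵉ+k₀) (ℕₚ.m∸n≤m N q)))) (≤-reflexive (trans (#-+ N N) (solve 1 (λ N → N :+ N := lit 2 :* N) refl (# N))))

    1≤bᵉ : 1# ≤ bᵉ
    1≤bᵉ = go iᵉ roomᵉ
      where
      go : ∀ i → i ℕ.+ k₀ ℕ.+ q ℕ.≤ N → 1# ≤ b i
      go zero    room = #-mono {1} {8} (ℕ.s≤s ℕ.z≤n)
      go (suc i) room = ≤-trans (go i room′) (≤-by (b i * h (suc (i ℕ.+ k₀))) (*-nonneg (b≥0 i room′) (Room.h≥0 {suc (i ℕ.+ k₀)} room)) (solve 2 (λ b h → b :* (lit 1 :+ h) := b :+ b :* h) refl (b i) _))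
        where room′ = ℕₚ.≤-trans (ℕₚ.n≤1+n _) room

    t : Carrier
    t = (# 4 * # n + 1#) ⁻¹

    4n+1>0 : Pos (# 4 * # n + 1#)
    4n+1>0 = subst Pos (+-comm _ _) (+-pos 1-pos (*-nonneg (#-nonneg 4) (#-nonneg n)))

    4n+1*t : (# 4 * # n + 1#) * t ≡ 1#
    4n+1*t = inverseʳ (proj₂ 4n+1>0)

    -- K / N = 1 - 1/(4n) and k₀ / L = 4n / (4n + 1); their product is (4n - 1) / (4n + 1) = 1 - 2t.
    ρK≥ : λᶜ * (1# - # 2 * t) ≤ ρ * # K
    ρK≥ = *-cancel-≤ (*-pos N>0 L>0) (≤-reflexive (
        trans (cong (λ z → # N * z * (λᶜ * (1# - # 2 * t))) L≡) (trans (cong (λ z → z * (w * # y) * (λᶜ * (1# - # 2 * t))) N≡)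
          (trans (solve 6 (λ p q w y l t → p :* q :* (w :* y) :* (l :* (lit 1 :- lit 2 :* t)) := l :* (p :* y) :* ((w :- lit 2 :* (w :* t)) :* q)) refl (# 4 * # n) (# q) w (# y) λᶜ t)
            (trans (cong₂ (λ z u → λᶜ * z * ((w - # 2 * u) * # q)) (sym k₀≡) 4n+1*t)
              (trans (cong (λ z → λᶜ * # k₀ * z) (trans (solve 2 (λ p q → ((p :+ lit 1) :- lit 2 :* lit 1) :* q := p :* q :- q) refl (# 4 * # n) (# q)) (trans (cong (_- # q) (sym N≡)) (sym (#-∸ q≤N)))))
                (trans (cong (_* # K) (sym ρ≡)) (solve 3 (λ r x k → r :* x :* k := x :* (r :* k)) refl ρ (# N * # L) (# K)))))))))
      where
      w = # 4 * # n + 1#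
      L≡ : # L ≡ w * # y
      L≡ = trans (#-+ k₀ y) (trans (cong (_+ # y) k₀≡) (solve 2 (λ p y → p :* y :+ y := (p :+ lit 1) :* y) refl (# 4 * # n) (# y)))

    slot-≥-pow : ∀ j → j ℕ.≤ n → (ρ * # K) ^ j ≤ slot ρ (slots K) j
    slot-≥-pow zero    j≤n = ≤-refl
    slot-≥-pow (suc j) j≤n = subst ((ρ * # K) ^ suc j ≤_) (sym (slot-sucʳ ρ (slots K) j))
      (*-mono (*-nonneg ρ≥0 (#-nonneg K)) (slot-nonneg ρ≥0 (slots K) j) (*-monoˡ ρ ρ≥0 K≤) (slot-≥-pow j j≤n′))
      where
      j≤n′ = ℕₚ.≤-trans (ℕₚ.n≤1+n j) j≤n
      j≤H : j ℕ.≤ S ℕ.+ H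
      j≤H = ℕₚ.≤-trans j≤n′ (ℕₚ.≤-trans (ℕₚ.m≤n+m n (n ℕ.* n)) (ℕₚ.m≤n+m H S))
      K≤ : # K ≤ # slots K - # j
      K≤ = ≤-by (# y - # j) (≤⇒0≤- (#-mono j≤H)) (trans (cong (_- # j) (slots≡ K)) (+-assoc _ _ _))

    -- Each of at most n vertices loses a factor 1 - 2/(4n + 1), and by Bernoulli these losses
    -- multiply to at least 1/2.
    critical-≤-slot : ∀ j → j ℕ.≤ n → λᶜ ^ j ≤ # 2 * slot ρ (slots K) j
    critical-≤-slot j j≤n = begin
      λᶜ ^ j ≡⟨ sym (*-identityʳ _) ⟩
      λᶜ ^ j * 1# ≤⟨ *-monoˡ _ (^-nonneg (proj₁ λᶜ>0) j) half ⟩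
      λᶜ ^ j * (# 2 * u ^ j) ≡⟨ trans (solve 2 (λ a b → a :* (lit 2 :* b) := lit 2 :* (a :* b)) refl (λᶜ ^ j) (u ^ j)) (cong (# 2 *_) (sym (^-distrib λᶜ u j))) ⟩
      # 2 * (λᶜ * u) ^ j ≤⟨ *-monoˡ (# 2) (#-nonneg 2) (≤-trans (^-mono (*-nonneg (proj₁ λᶜ>0) u≥0) ρK≥ j) (slot-≥-pow j j≤n)) ⟩
      # 2 * slot ρ (slots K) j ∎
      where
      u = 1# - # 2 * t
      t≥0 = proj₁ (⁻¹-pos 4n+1>0)
      4nt≤1 : # 4 * # n * t ≤ 1#
      4nt≤1 = subst (# 4 * # n * t ≤_) 4n+1*t (*-monoʳ t t≥0 (≤-by 1# 0≤1 refl))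
      4jt≤1 : # 4 * # j * t ≤ 1#
      4jt≤1 = ≤-trans (*-monoʳ t t≥0 (*-monoˡ (# 4) (#-nonneg 4) (#-mono j≤n))) 4nt≤1
      4t≤1 : # 4 * # 1 * t ≤ 1#
      4t≤1 = ≤-trans (*-monoʳ t t≥0 (*-monoˡ (# 4) (#-nonneg 4) (#-mono {1} {n} (ℕ.s≤s ℕ.z≤n)))) 4nt≤1
      u≥0 : 0# ≤ u
      u≥0 = ≤⇒0≤- (≤-trans (≤-by (# 2 * t) (*-nonneg (#-nonneg 2) t≥0) (solve 1 (λ t → lit 4 :* lit 1 :* t := lit 2 :* t :+ lit 2 :* t) refl t)) 4t≤1)
      half : 1# ≤ # 2 * u ^ j
      half = ≤-trans (≤-by (1# - # 4 * # j * t) (≤⇒0≤- 4jt≤1) (solve 2 (λ j t → lit 2 :* (lit 1 :+ j :* (:- (lit 2 :* t))) := lit 1 :+ (lit 1 :- lit 4 :* j :* t)) refl (# j) t))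
        (*-monoˡ (# 2) (#-nonneg 2) (bernoulli u≥0 j))

    slot-≤-critical : ∀ j → slot ρ (slots K) j ≤ λᶜ ^ j
    slot-≤-critical j = ≤-trans (slot-≤ ρ≥0 (slots K) j) (^-mono (*-nonneg ρ≥0 (#-nonneg (slots K))) (*-cancel-≤ N>0 (begin
      # N * (ρ * # slots K) ≡⟨ *-comm _ _ ⟩
      ρ * # slots K * # N ≤⟨ fugacity K k₀≤K ⟩
      λᶜ * # K ≤⟨ *-monoˡ _ (proj₁ λᶜ>0) (#-mono (ℕₚ.m∸n≤m N q)) ⟩
      λᶜ * # N ≡⟨ *-comm _ _ ⟩
      # N * λᶜ ∎)) j)

    Bᵉ≤bᵉ : B iᵉ ≤ bᵉ
    Bᵉ≤bᵉ = *-cancel-≤ (m>0 (iᵉ ℕ.+ k₀)) (begin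
      # m * (bᵉ * # (iᵉ ℕ.+ k₀ ℕ.+ S) * (# m) ⁻¹) ≡⟨ trans (solve 3 (λ m e i → m :* (e :* i) := e :* (m :* i)) refl (# m) (bᵉ * # (iᵉ ℕ.+ k₀ ℕ.+ S)) ((# m) ⁻¹)) (trans (cong (bᵉ * # (iᵉ ℕ.+ k₀ ℕ.+ S) *_) (inverseʳ (proj₂ (m>0 (iᵉ ℕ.+ k₀))))) (*-identityʳ _)) ⟩
      bᵉ * # (iᵉ ℕ.+ k₀ ℕ.+ S) ≤⟨ *-monoˡ bᵉ (≤-trans 0≤1 1≤bᵉ) (#-mono (ℕₚ.m≤m+n (iᵉ ℕ.+ k₀ ℕ.+ S) H)) ⟩
      bᵉ * # m ≡⟨ *-comm _ _ ⟩
      # m * bᵉ ∎)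
      where m = slots (iᵉ ℕ.+ k₀)

    critical-Poincaré : Poincaré (wt (isIndep G) (λᶜ ^_)) (# 2 * bᵉ)
    critical-Poincaré = Poincaré-cong (λ σ → cong (λ z → 𝟙 z * λᶜ ^ size σ) (full σ))
      (Compare.compare-Poincaré (wt-nonneg (indep V) (slot-nonneg ρ≥0 (slots K)))
        (λ σ → *-monoˡ _ (𝟙-nonneg (indep V σ)) (slot-≤-critical (size σ)))
        (λ σ → ≤-trans (*-monoˡ _ (𝟙-nonneg (indep V σ)) (critical-≤-slot (size σ) (size≤n σ))) (≤-reflexive (solve 2 (λ x s → x :* (lit 2 :* s) := lit 2 :* (x :* s)) refl (𝟙 (indep V σ)) (slot ρ (slots K) (size σ)))))
        (#-nonneg 2) (≤-trans 0≤1 1≤bᵉ)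
        (Poincaré-mono (wt-nonneg (indep V) (slot-nonneg ρ≥0 (slots K))) Bᵉ≤bᵉ (subst (λ z → Poincaré (wt (indep V) (slot ρ (slots z))) (B iᵉ)) iᵉ+k₀ (iterate iᵉ roomᵉ V))))
      where
      V = replicate n true
      full : ∀ σ → indep V σ ≡ isIndep G σ
      full σ = bool-ext (λ p → proj₁ (∧-T⁻ p)) (λ p → indep-⁺ V σ (indep⁻ σ p) (λ u _ → Vec.lookup-replicate u true))

  -- Glauber dynamics

  sumC-zero : ∀ {n} {g : Config n → Carrier} → (∀ σ → g σ ≡ 0#) → sumC g ≡ 0#
  sumC-zero {n} eq = trans (sum-cong (allConfigs n) eq) (sum-0 (allConfigs n))

  sumC-pick : ∀ {n} (τ : Config n) {g : Config n → Carrier} → (∀ σ → σ ≢ τ → g σ ≡ 0#) → sumC g ≡ g τ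
  sumC-pick []          {g} eq = +-identityʳ (g [])
  sumC-pick {suc n} (false ∷ τ) {g} eq = trans (sumC-suc {n} g) (trans (cong₂ _+_ (sumC-pick τ (λ σ p → eq (false ∷ σ) (λ { refl → p refl }))) (sumC-zero (λ σ → eq (true ∷ σ) (λ ())))) (+-identityʳ _))
  sumC-pick {suc n} (true ∷ τ) {g} eq = trans (sumC-suc {n} g) (trans (cong₂ _+_ (sumC-zero (λ σ → eq (false ∷ σ) (λ ()))) (sumC-pick τ (λ σ p → eq (true ∷ σ) (λ { refl → p refl })))) (+-identityˡ _))

  sumC-const : ∀ n x → sumC {n} (λ _ → x) ≡ # 2 ^ n * x
  sumC-const zero    x = solve 1 (λ x → x :+ lit 0 := lit 1 :* x) refl x
  sumC-const (suc n) x = trans (sumC-suc {n} (λ _ → x)) (trans (cong₂ _+_ (sumC-const n x) (sumC-const n x)) (solve 2 (λ p x → p :* x :+ p :* x := lit 2 :* p :* x) refl (# 2 ^ n) x))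

  -- The inequality (1 - 1/(l + 1))^(l + 1) ≤ 1/2, from the tangent of the power at l.
  pow-half : ∀ l → # 2 * # l ^ suc l ≤ # suc l ^ suc l
  pow-half l = ≤-trans (≤-by (# l ^ l) (^-nonneg (#-nonneg l) l) (trans (cong (λ t → # l * # l ^ l + t * # l ^ l * (t - # l)) (#-suc l))
      (solve 2 (λ x y → x :* y :+ (lit 1 :+ x) :* y :* ((lit 1 :+ x) :- x) := lit 2 :* (x :* y) :+ y) refl (# l) (# l ^ l))))
    (pow-tangent (#-nonneg l) (#-nonneg (suc l)) l)

  pow-half-iter : ∀ l j → # 2 ^ j * # l ^ (j ℕ.* suc l) ≤ # suc l ^ (j ℕ.* suc l)
  pow-half-iter l j = begin
    # 2 ^ j * # l ^ (j ℕ.* suc l) ≡⟨ trans (cong (# 2 ^ j *_) (^-* (# l) j (suc l))) (sym (^-distrib (# 2) (# l ^ suc l) j)) ⟩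
    (# 2 * # l ^ suc l) ^ j ≤⟨ ^-mono (*-nonneg (#-nonneg 2) (^-nonneg (#-nonneg l) (suc l))) (pow-half l) j ⟩
    (# suc l ^ suc l) ^ j ≡⟨ sym (^-* (# suc l) j (suc l)) ⟩
    # suc l ^ (j ℕ.* suc l) ∎

  k≤2^k : ∀ k → # k ≤ # 2 ^ k
  k≤2^k k = ≤-trans (≤-by 1# 0≤1 (solve 1 (λ k → lit 1 :+ k :* lit 1 := k :+ lit 1) refl (# k))) (subst (λ t → 1# + # k * 1# ≤ t ^ k) (sym (#-suc 1)) (bernoulli (+-nonneg 0≤1 0≤1) k))

  -- The update probabilities and the division by n are parameters known through their equations.
  -- When they are instantiated with the total division of the statement, the chain built here
  -- unfolds to the given one.
  module Glauber {n′ : ℕ} (X : Family (suc n′)) (X-down : DownClosed X) {lam : Carrier} (lam>0 : Pos lam)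
    (α β : Carrier) (α≡ : (1# + lam) * α ≡ lam) (β≡ : (1# + lam) * β ≡ 1#)
    (avg : Carrier → Carrier) (avg≡ : ∀ x → # suc n′ * avg x ≡ x) where

    n : ℕ
    n = suc n′

    n>0 : Pos (# n)
    n>0 = #-pos n′

    w : Config n → Carrier
    w = wt X (lam ^_)

    w≥0 : ∀ σ → 0# ≤ w σ
    w≥0 = wt-nonneg X (^-nonneg (proj₁ lam>0))

    1+lam>0 : Pos (1# + lam)
    1+lam>0 = +-pos 1-pos (proj₁ lam>0)

    *-cancelˡ : ∀ {a x y} → Pos a → a * x ≡ a * y → x ≡ y
    *-cancelˡ p eq = ≤-antisym (*-cancel-≤ p (≤-reflexive eq)) (*-cancel-≤ p (≤-reflexive (sym eq)))

    α+β : α + β ≡ 1#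
    α+β = *-cancelˡ 1+lam>0 (trans (distribˡ _ _ _) (trans (cong₂ _+_ α≡ β≡) (solve 1 (λ l → l :+ lit 1 := (lit 1 :+ l) :* lit 1) refl lam)))

    β>0 : Pos β
    β>0 = pos-*⁻ 1+lam>0 (subst Pos (sym β≡) 1-pos)

    X-add⁻ : ∀ v σ → lookup σ v ≡ false → X (add v σ) ≡ true → X σ ≡ true
    X-add⁻ v σ p q = T⇒≡ (subst (T ∘ X) (remove-add v σ p) (X-down v (add v σ) (≡⇒T q)))

    Kᵥ : Fin n → (Config n → Carrier) → Config n → Carrier
    Kᵥ v f σ = if X (add v (remove v σ)) then α * f (add v (remove v σ)) + β * f (remove v σ) else f (remove v σ)

    I-pairs : ∀ v F → I w F ≡ sumC (λ σ → 𝟙 (not (lookup σ v)) * (w σ * F σ + w (add v σ) * F (add v σ)))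
    I-pairs v F = trans (split v (λ σ → w σ * F σ)) (trans (cong (sumC (λ σ → 𝟙 (not (lookup σ v)) * (w σ * F σ)) +_) (toggle v (λ σ → w σ * F σ)))
      (trans (sym (sum-+ (allConfigs n) _ _)) (sum-cong (allConfigs n) (λ σ → sym (distribˡ _ _ _)))))

    pairs-cong : ∀ v {F F′ : Config n → Carrier} →
      (∀ σ → lookup σ v ≡ false → w σ * F σ + w (add v σ) * F (add v σ) ≡ w σ * F′ σ + w (add v σ) * F′ (add v σ)) → I w F ≡ I w F′
    pairs-cong v {F} {F′} eq = trans (I-pairs v F) (trans (sum-cong (allConfigs n) pt) (sym (I-pairs v F′)))
      where
      pt : ∀ σ → 𝟙 (not (lookup σ v)) * (w σ * F σ + w (add v σ) * F (add v σ)) ≡ 𝟙 (not (lookup σ v)) * (w σ * F′ σ + w (add v σ) * F′ (add v σ))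
      pt σ with lookup σ v in p
      ... | true  = trans (zeroˡ _) (sym (zeroˡ _))
      ... | false = cong (1# *_) (eq σ p)

    remove-id : ∀ v (σ : Config n) → lookup σ v ≡ false → remove v σ ≡ σ
    remove-id v σ p = trans (cong (σ [ v ]≔_) (sym p)) (Vec.[]≔-lookup σ v)

    -- In a blocked pair the larger set has weight 0, so only the value of `Kᵥ` at the smaller set
    -- is recorded.
    data Toggle (v : Fin n) (σ : Config n) : Set where
      free    : w (add v σ) ≡ lam * w σ → (∀ f → Kᵥ v f σ ≡ α * f (add v σ) + β * f σ) → (∀ f → Kᵥ v f (add v σ) ≡ α * f (add v σ) + β * f σ) → Toggle v σ
      blocked : w (add v σ) ≡ 0# → (∀ f → Kᵥ v f σ ≡ f σ) → Toggle v σ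

    toggle-view : ∀ v σ → lookup σ v ≡ false → Toggle v σ
    toggle-view v σ p with X (add v σ) in q
    ... | true  = free eq (λ f → trans (K≡ (remove-id v σ p) f) (choose f)) (λ f → trans (K≡ (remove-add v σ p) f) (choose f))
      where
      K≡ : ∀ {τ} → remove v τ ≡ σ → ∀ (f : Config n → Carrier) → Kᵥ v f τ ≡ (if X (add v σ) then α * f (add v σ) + β * f σ else f σ)
      K≡ e f = cong (λ s → if X (add v s) then α * f (add v s) + β * f s else f s) e
      choose : ∀ (f : Config n → Carrier) → (if X (add v σ) then α * f (add v σ) + β * f σ else f σ) ≡ α * f (add v σ) + β * f σ
      choose f = cong (λ b → if b then α * f (add v σ) + β * f σ else f σ) q
      eq : w (add v σ) ≡ lam * w σ
      eq rewrite q | X-add⁻ v σ p q | size-add v σ p = solve 2 (λ l L → lit 1 :* (l :* L) := l :* (lit 1 :* L)) refl lam (lam ^ size σ)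
    ... | false = blocked (trans (cong (λ t → 𝟙 t * lam ^ size (add v σ)) q) (zeroˡ _)) (λ f → trans (cong (λ s → if X (add v s) then α * f (add v s) + β * f s else f s) (remove-id v σ p)) (choose f))
      where
      choose : ∀ (f : Config n → Carrier) → (if X (add v σ) then α * f (add v σ) + β * f σ else f σ) ≡ f σ
      choose f = cong (λ b → if b then α * f (add v σ) + β * f σ else f σ) q

    -- On a free pair σ, σ + v the operator replaces both values by their average with weights 1 :
    -- λ, the ratio of the two measures; so it is an orthogonal projection there.
    Kᵥ-selfadjoint : ∀ v h g → I w (λ σ → h σ * Kᵥ v g σ) ≡ I w (λ σ → Kᵥ v h σ * g σ)
    Kᵥ-selfadjoint v h g = pairs-cong v eq
      where
      eq : ∀ σ → lookup σ v ≡ false → w σ * (h σ * Kᵥ v g σ) + w (add v σ) * (h (add v σ) * Kᵥ v g (add v σ)) ≡ w σ * (Kᵥ v h σ * g σ) + w (add v σ) * (Kᵥ v h (add v σ) * g (add v σ))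
      eq σ p with toggle-view v σ p
      ... | blocked w0 K0 = trans (cong₂ (λ a b → w σ * (h σ * a) + b * (h (add v σ) * Kᵥ v g (add v σ))) (K0 g) w0)
          (trans (solve 5 (λ w h g a b → w :* (h :* g) :+ lit 0 :* a := w :* (h :* g) :+ lit 0 :* b) refl (w σ) (h σ) (g σ) _ _)
            (sym (cong₂ (λ a b → w σ * (a * g σ) + b * (Kᵥ v h (add v σ) * g (add v σ))) (K0 h) w0)))
      ... | free w1 K0 K1 = trans (trans (cong₂ (λ a b → w σ * (h σ * a) + w (add v σ) * (h (add v σ) * b)) (K0 g) (K1 g)) (half h g))
          (trans (solve 4 (λ L o x y → L :* (o :* x :* y) := L :* (o :* y :* x)) refl (w σ) (1# + lam) (k h) (k g))
            (sym (trans (cong₂ (λ a b → w σ * (a * g σ) + w (add v σ) * (b * g (add v σ))) (K0 h) (K1 h)) (trans (cong₂ (λ a b → w σ * a + w (add v σ) * b) (*-comm _ _) (*-comm _ _)) (half g h)))))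
        where
        k : (Config n → Carrier) → Carrier
        k f = α * f (add v σ) + β * f σ
        half : ∀ f f′ → w σ * (f σ * k f′) + w (add v σ) * (f (add v σ) * k f′) ≡ w σ * ((1# + lam) * k f * k f′)
        half f f′ = trans (cong (λ t → w σ * (f σ * k f′) + t * (f (add v σ) * k f′)) w1)
          (trans (solve 5 (λ L l x x′ y → L :* (x :* y) :+ (l :* L) :* (x′ :* y) := L :* ((l :* x′ :+ lit 1 :* x) :* y)) refl (w σ) lam (f σ) (f (add v σ)) (k f′))
            (cong (λ t → w σ * (t * k f′)) (trans (cong₂ (λ s t → s * f (add v σ) + t * f σ) (sym α≡) (sym β≡)) (solve 5 (λ o a b x y → o :* a :* y :+ o :* b :* x := o :* (a :* y :+ b :* x)) refl (1# + lam) α β (f σ) (f (add v σ))))))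

    ∇ : Fin n → (Config n → Carrier) → Config n → Carrier
    ∇ v f σ = occ v σ * sq (f σ - f (remove v σ))

    α≡lamβ : α ≡ lam * β
    α≡lamβ = *-cancelˡ 1+lam>0 (trans α≡ (trans (sym (*-identityʳ lam)) (trans (cong (lam *_) (sym β≡)) (solve 3 (λ l o b → l :* (o :* b) := o :* (l :* b)) refl lam (1# + lam) β))))

    -- Pythagoras for this projection: with masses w and λ w on a pair, the variance is λ w (y - x)²
    -- / (1 + λ), that is β times the Dirichlet term of the larger set.
    Kᵥ-energy : ∀ v f → I w (sq ∘ f) ≡ I w (sq ∘ Kᵥ v f) + β * I w (∇ v f)
    Kᵥ-energy v f = trans (pairs-cong v eq) (trans (I-+ w _ _) (cong (I w (sq ∘ Kᵥ v f) +_) (I-*ˡ w β _)))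
      where
      ∇0 : ∀ σ → lookup σ v ≡ false → ∇ v f σ ≡ 0#
      ∇0 σ p = trans (cong (λ b → 𝟙 b * sq (f σ - f (remove v σ))) p) (zeroˡ _)
      ∇1 : ∀ σ → lookup σ v ≡ false → ∇ v f (add v σ) ≡ sq (f (add v σ) - f σ)
      ∇1 σ p = trans (cong₂ (λ b τ → 𝟙 b * sq (f (add v σ) - f τ)) (lookup-add v σ) (remove-add v σ p)) (*-identityˡ _)
      eq : ∀ σ → lookup σ v ≡ false → w σ * sq (f σ) + w (add v σ) * sq (f (add v σ)) ≡ w σ * (sq (Kᵥ v f σ) + β * ∇ v f σ) + w (add v σ) * (sq (Kᵥ v f (add v σ)) + β * ∇ v f (add v σ))
      eq σ p with toggle-view v σ p
      ... | blocked w0 K0 = trans (cong (λ t → w σ * sq (f σ) + t * sq (f (add v σ))) w0)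
          (trans (solve 5 (λ w x a b c → w :* (x :* x) :+ lit 0 :* a := w :* (x :* x :+ b :* lit 0) :+ lit 0 :* c) refl (w σ) (f σ) _ β _)
            (sym (trans (cong₂ (λ a b → w σ * (sq a + β * b) + w (add v σ) * (sq (Kᵥ v f (add v σ)) + β * ∇ v f (add v σ))) (K0 f) (∇0 σ p))
              (cong (λ t → w σ * (sq (f σ) + β * 0#) + t * (sq (Kᵥ v f (add v σ)) + β * ∇ v f (add v σ))) w0))))
      ... | free w1 K0 K1 = trans (cong (λ t → w σ * sq x + t * sq y) w1) (trans (trans (sym (*-identityˡ _)) (trans (cong (_* (w σ * sq x + lam * w σ * sq y)) (sym β≡))
            (trans (solve 5 (λ l b w x y → (lit 1 :+ l) :* b :* (w :* (x :* x) :+ l :* w :* (y :* y)) := lit 1 :* (w :* b :* ((l :* y :+ x) :* (l :* y :+ x))) :+ w :* l :* b :* ((y :- x) :* (y :- x))) refl lam β (w σ) x y)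
              (trans (cong (λ t → t * (w σ * β * sq (lam * y + x)) + w σ * lam * β * sq (y - x)) (sym β≡))
                (trans (solve 5 (λ l b w x y → (lit 1 :+ l) :* b :* (w :* b :* ((l :* y :+ x) :* (l :* y :+ x))) :+ w :* l :* b :* ((y :- x) :* (y :- x)) := w :* ((l :* b :* y :+ b :* x) :* (l :* b :* y :+ b :* x) :+ b :* lit 0) :+ l :* w :* ((l :* b :* y :+ b :* x) :* (l :* b :* y :+ b :* x) :+ b :* ((y :- x) :* (y :- x)))) refl lam β (w σ) x y)
                  (cong (λ t → w σ * (sq (t * y + β * x) + β * 0#) + lam * w σ * (sq (t * y + β * x) + β * sq (y - x))) (sym α≡lamβ)))))))
            (sym (trans (cong₂ (λ a b → w σ * (sq a + β * b) + w (add v σ) * (sq (Kᵥ v f (add v σ)) + β * ∇ v f (add v σ))) (K0 f) (∇0 σ p))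
              (trans (cong₂ (λ a b → w σ * (sq k + β * 0#) + w (add v σ) * (sq a + β * b)) (K1 f) (∇1 σ p)) (cong (λ t → w σ * (sq k + β * 0#) + t * (sq k + β * sq (y - x))) w1)))))
        where
        x = f σ
        y = f (add v σ)
        k = α * y + β * x

    P : (Config n → Carrier) → Config n → Carrier
    P f σ = avg (sumF (λ v → Kᵥ v f σ))

    I-P : ∀ (h f : Config n → Carrier) → # n * I w (λ σ → h σ * P f σ) ≡ sumF (λ v → I w (λ σ → h σ * Kᵥ v f σ))
    I-P h f = trans (sym (I-*ˡ w (# n) _)) (trans (I-cong w (λ σ → trans (solve 3 (λ n h p → n :* (h :* p) := h :* (n :* p)) refl (# n) (h σ) (P f σ)) (trans (cong (h σ *_) (avg≡ _)) (sym (sum-*ˡ (allFin n) (h σ) _))))) (I-sum w (allFin n) _))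

    P-selfadjoint : ∀ (h f : Config n → Carrier) → I w (λ σ → h σ * P f σ) ≡ I w (λ σ → P h σ * f σ)
    P-selfadjoint h f = *-cancelˡ n>0 (trans (I-P h f) (trans (sum-cong (allFin n) (λ v → trans (Kᵥ-selfadjoint v h f) (I-cong w (λ σ → *-comm _ _)))) (trans (sym (I-P f h)) (cong (# n *_) (I-cong w (λ σ → *-comm _ _))))))

    Kᵥ-shift : ∀ v f c σ → Kᵥ v (λ τ → f τ + c) σ ≡ Kᵥ v f σ + c
    Kᵥ-shift v f c σ with X (add v (remove v σ))
    ... | false = refl
    ... | true  = trans (solve 5 (λ a b x y c → a :* (x :+ c) :+ b :* (y :+ c) := (a :* x :+ b :* y) :+ (a :+ b) :* c) refl α β _ _ c) (cong (_ +_) (trans (cong (_* c) α+β) (*-identityˡ c)))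

    P-shift : ∀ f c σ → P (λ τ → f τ + c) σ ≡ P f σ + c
    P-shift f c σ = *-cancelˡ n>0 (trans (avg≡ _) (trans (trans (sum-cong (allFin n) (λ v → Kᵥ-shift v f c σ)) (trans (sum-+ (allFin n) _ _) (cong₂ _+_ (sym (avg≡ _)) (sumF-const n c)))) (sym (distribˡ _ _ _))))

    P-0 : ∀ σ → P (λ _ → 0#) σ ≡ 0#
    P-0 σ = *-cancelˡ n>0 (trans (avg≡ _) (trans (trans (sum-cong (allFin n) K0) (sum-0 (allFin n))) (sym (zeroʳ (# n)))))
      where
      K0 : ∀ v → Kᵥ v (λ _ → 0#) σ ≡ 0#
      K0 v with X (add v (remove v σ))
      ... | false = refl
      ... | true  = solve 2 (λ a b → a :* lit 0 :+ b :* lit 0 := lit 0) refl α β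

    P-mean : ∀ f → I w (P f) ≡ I w f
    P-mean f = trans (I-cong w (λ σ → sym (*-identityˡ _))) (trans (P-selfadjoint (λ _ → 1#) f) (I-cong w (λ σ → trans (cong (_* f σ) P1) (*-identityˡ _))))
      where
      P1 : ∀ {σ} → P (λ _ → 1#) σ ≡ 1#
      P1 {σ} = trans (cong (λ g → avg g) (sum-cong (allFin n) (λ v → cong₂ (λ a b → if X (add v (remove v σ)) then α * a + β * a else b) one one))) (trans (P-shift (λ _ → 0#) 1# σ) (trans (cong (_+ 1#) (P-0 σ)) (+-identityˡ 1#)))
        where one : 1# ≡ 0# + 1#
              one = sym (+-identityˡ 1#)

    -- Jensen for the average of the `Kᵥ`, then `Kᵥ-energy`. The square norm of P f itself is
    -- bounded, so the bottom of the spectrum of P needs no separate treatment.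
    P-energy : ∀ f → # n * I w (sq ∘ P f) + β * I w (grad f) ≤ # n * I w (sq ∘ f)
    P-energy f = begin
      # n * I w (sq ∘ P f) + β * I w (grad f) ≡⟨ cong₂ _+_ (sym (I-*ˡ w (# n) _)) (trans (cong (β *_) (I-sum w (allFin n) (λ v → ∇ v f))) (sym (sum-*ˡ (allFin n) β _))) ⟩
      I w (λ σ → # n * sq (P f σ)) + sumF (λ v → β * I w (∇ v f)) ≤⟨ +-monoˡ-≤ _ (I-mono w≥0 jensen) ⟩
      I w (λ σ → sumF (λ v → sq (Kᵥ v f σ))) + sumF (λ v → β * I w (∇ v f)) ≡⟨ trans (cong (_+ sumF (λ v → β * I w (∇ v f))) (I-sum w (allFin n) _)) (trans (sym (sum-+ (allFin n) _ _)) (trans (sum-cong (allFin n) (λ v → sym (Kᵥ-energy v f))) (sumF-const n _))) ⟩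
      # n * I w (sq ∘ f) ∎
      where
      jensen : ∀ σ → # n * sq (P f σ) ≤ sumF (λ v → sq (Kᵥ v f σ))
      jensen σ = ≤-by _ (sum-nonneg (allFin n) (λ v → sq-nonneg (Kᵥ v f σ - m))) (sym (trans (cong (# n * sq m +_)
          (trans (sum-cong (allFin n) (λ v → solve 2 (λ x m → (x :- m) :* (x :- m) := x :* x :+ ((:- (lit 2 :* m)) :* x :+ m :* m)) refl (Kᵥ v f σ) m))
            (trans (sum-+ (allFin n) _ _) (cong (sumF (λ v → sq (Kᵥ v f σ)) +_) (trans (sum-+ (allFin n) _ _) (cong₂ _+_ (trans (sum-*ˡ (allFin n) (- (# 2 * m)) _) (cong (- (# 2 * m) *_) (sym (avg≡ _)))) (sumF-const n (m * m))))))))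
          (solve 3 (λ n m s → n :* (m :* m) :+ (s :+ ((:- (lit 2 :* m)) :* (n :* m) :+ n :* (m :* m))) := s) refl (# n) m (sumF (λ v → sq (Kᵥ v f σ))))))
        where m = P f σ

    -- The rate is 1 - 1/(n B (1 + λ)), as β (1 + λ) = 1. It is weakened to l / (l + 1) so that its
    -- powers are quotients of powers of natural numbers.
    contraction : ∀ {B} → 0# ≤ B → Poincaré w B → ∀ l → # n * B * (1# + lam) ≤ # suc l →
      ∀ f → I w f ≡ 0# → # suc l * I w (sq ∘ P f) ≤ # l * I w (sq ∘ f)
    contraction {B} B≥0 pc l l≥ f cen = begin
      # suc l * E′ ≡⟨ solve 3 (λ L T e → L :* e := T :* e :+ (L :- T) :* e) refl (# suc l) gap E′ ⟩
      gap * E′ + (# suc l - gap) * E′ ≤⟨ +-mono main (*-monoˡ _ (≤⇒0≤- l≥) E′≤E) ⟩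
      (gap * E - E) + (# suc l - gap) * E ≡⟨ trans (cong (λ t → (gap * E - E) + (t - gap) * E) (#-suc l)) (solve 3 (λ g E l → (g :* E :- E) :+ ((lit 1 :+ l) :- g) :* E := l :* E) refl gap E (# l)) ⟩
      # l * E ∎
      where
      gap = # n * B * (1# + lam)
      E = I w (sq ∘ f)
      E′ = I w (sq ∘ P f)
      Dg = I w (grad f)
      E≤ : E ≤ B * Dg
      E≤ = ≤-trans (I-sq-centered w≥0 f (proj₁ (pc f)) cen) (proj₂ (pc f))
      E′≤E : E′ ≤ E
      E′≤E = *-cancel-≤ n>0 (≤-trans (≤-by (β * Dg) (*-nonneg (proj₁ β>0) (I-nonneg w≥0 (grad-nonneg f))) refl) (P-energy f))
      main : gap * E′ ≤ gap * E - E
      main = 0≤-⇒≤ (subst (0# ≤_) eq (+-nonneg (*-nonneg (*-nonneg B≥0 (proj₁ 1+lam>0)) (≤⇒0≤- (P-energy f))) (≤⇒0≤- E≤)))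
        where
        eq : B * (1# + lam) * (# n * E - (# n * E′ + β * Dg)) + (B * Dg - E) ≡ (gap * E - E) - gap * E′
        eq = trans (solve 7 (λ B o n E E′ b D → B :* o :* (n :* E :- (n :* E′ :+ b :* D)) :+ (B :* D :- E) := ((n :* B :* o :* E :- E) :- n :* B :* o :* E′) :+ (B :* D :- (o :* b) :* (B :* D))) refl B (1# + lam) (# n) E E′ β Dg)
          (trans (cong (λ t → ((gap * E - E) - gap * E′) + (B * Dg - t * (B * Dg))) β≡) (solve 2 (λ x y → x :+ (y :- lit 1 :* y) := x) refl ((gap * E - E) - gap * E′) (B * Dg)))

    Z : Carrier
    Z = mass w

    -- Law of the chain and its convergence in L²

    module Start (σ₀ : Config n) (σ₀∈X : X σ₀ ≡ true) (ind : Config n → Config n → Carrier)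
      (ind-refl : ∀ σ → ind σ σ ≡ 1#) (ind-≢ : ∀ {σ τ} → σ ≢ τ → ind σ τ ≡ 0#) where

      w₀ : Carrier
      w₀ = w σ₀

      w₀≡ : w₀ ≡ lam ^ size σ₀
      w₀≡ = trans (cong (λ b → 𝟙 b * lam ^ size σ₀) σ₀∈X) (*-identityˡ _)

      w₀>0 : Pos w₀
      w₀>0 = subst Pos (sym w₀≡) (^-pos lam>0 (size σ₀))

      Z>0 : Pos Z
      Z>0 = pos-≤ w₀>0 (sumC-single w≥0 σ₀)

      h₀ : Config n → Carrier
      h₀ τ = ind σ₀ τ * w₀ ⁻¹

      -- err t is the density of the law at time t with respect to w, minus its limit 1/Z.
      err : ℕ → Config n → Carrier
      err zero    τ = h₀ τ - Z ⁻¹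
      err (suc t) = P (err t)

      law : ℕ → Config n → Carrier
      law zero    τ = ind σ₀ τ
      law (suc t) τ = sumC (λ σ → law t σ * P (λ x → ind x τ) σ)

      I-pick : ∀ f τ → (∀ σ → σ ≢ τ → f σ ≡ 0#) → I w f ≡ w τ * f τ
      I-pick f τ eq = sumC-pick τ (λ σ p → trans (cong (w σ *_) (eq σ p)) (zeroʳ _))

      -- By reversibility the density of the law evolves under the same operator `P` that acts on
      -- functions.
      law-err : ∀ t τ → law t τ ≡ w τ * (err t τ + Z ⁻¹)
      law-err zero τ = sym (trans (cong (w τ *_) (solve 2 (λ a b → (a :- b) :+ b := a) refl (h₀ τ) (Z ⁻¹))) (h (Vec.≡-dec Bool._≟_ σ₀ τ)))
        where
        h : Dec (σ₀ ≡ τ) → w τ * h₀ τ ≡ ind σ₀ τ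
        h (yes refl) = trans (cong (λ t → w₀ * (t * w₀ ⁻¹)) (ind-refl σ₀)) (trans (cong (w₀ *_) (*-identityˡ _)) (trans (inverseʳ (proj₂ w₀>0)) (sym (ind-refl σ₀))))
        h (no ¬p)    = trans (cong (λ t → w τ * (t * w₀ ⁻¹)) (ind-≢ ¬p)) (trans (solve 2 (λ a b → a :* (lit 0 :* b) := lit 0) refl (w τ) (w₀ ⁻¹)) (sym (ind-≢ ¬p)))
      law-err (suc t) τ = trans (sum-cong (allConfigs n) (λ σ → trans (cong (_* P (λ x → ind x τ) σ) (law-err t σ)) (*-assoc _ _ _)))
        (trans (P-selfadjoint (λ σ → err t σ + Z ⁻¹) (λ x → ind x τ))
          (trans (I-pick (λ σ → P (λ x → err t x + Z ⁻¹) σ * ind σ τ) τ (λ σ p → trans (cong (P (λ x → err t x + Z ⁻¹) σ *_) (ind-≢ p)) (zeroʳ _)))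
            (cong (w τ *_) (trans (cong₂ _*_ (P-shift (err t) (Z ⁻¹) τ) (ind-refl τ)) (*-identityʳ _)))))

      I-h₀ : ∀ (f : Config n → Carrier) → I w (λ σ → h₀ σ * f σ) ≡ f σ₀
      I-h₀ f = trans (I-pick (λ σ → h₀ σ * f σ) σ₀ (λ σ p → trans (cong (λ t → t * w₀ ⁻¹ * f σ) (ind-≢ (p ∘ sym))) (solve 2 (λ a b → lit 0 :* a :* b := lit 0) refl (w₀ ⁻¹) (f σ))))
        (trans (cong (λ t → w₀ * (t * w₀ ⁻¹ * f σ₀)) (ind-refl σ₀)) (trans (solve 3 (λ w i f → w :* (lit 1 :* i :* f) := (w :* i) :* f) refl w₀ (w₀ ⁻¹) (f σ₀)) (trans (cong (_* f σ₀) (inverseʳ (proj₂ w₀>0))) (*-identityˡ _))))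

      I-h₀-1 : I w h₀ ≡ 1#
      I-h₀-1 = trans (I-cong w (λ σ → sym (*-identityʳ (h₀ σ)))) (I-h₀ (λ _ → 1#))

      err-mean : ∀ t → I w (err t) ≡ 0#
      err-mean zero = trans (I-+ w h₀ (λ _ → - Z ⁻¹)) (trans (cong₂ _+_ I-h₀-1 (I-const w (- Z ⁻¹))) (trans (solve 2 (λ z i → lit 1 :+ z :* (:- i) := lit 1 :- z :* i) refl Z (Z ⁻¹)) (trans (cong (λ t → 1# - t) (inverseʳ (proj₂ Z>0))) (-‿inverseʳ 1#))))
      err-mean (suc t) = trans (P-mean (err t)) (err-mean t)

      E : ℕ → Carrier
      E t = I w (sq ∘ err t)

      E₀≤ : E 0 ≤ w₀ ⁻¹
      E₀≤ = ≤-by (Z ⁻¹) (proj₁ (⁻¹-pos Z>0)) (sym (trans (cong (_+ Z ⁻¹) (trans (I-sq-shift w h₀ (Z ⁻¹)) (cong₂ (λ a b → a - # 2 * Z ⁻¹ * b + Z * sq (Z ⁻¹)) (trans (I-h₀ h₀) (trans (cong (_* w₀ ⁻¹) (ind-refl σ₀)) (*-identityˡ _))) I-h₀-1)))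
        (trans (solve 3 (λ a z i → ((a :- lit 2 :* i :* lit 1) :+ z :* (i :* i)) :+ i := a :+ ((z :* i) :* i :- i)) refl (w₀ ⁻¹) Z (Z ⁻¹)) (trans (cong (λ t → w₀ ⁻¹ + (t * Z ⁻¹ - Z ⁻¹)) (inverseʳ (proj₂ Z>0))) (solve 2 (λ a i → a :+ (lit 1 :* i :- i) := a) refl (w₀ ⁻¹) (Z ⁻¹))))))

      module _ {B : Carrier} (B≥0 : 0# ≤ B) (pc : Poincaré w B) (l : ℕ) (l≥ : # n * B * (1# + lam) ≤ # suc l) where

        decay : ∀ t → # suc l ^ t * E t ≤ # l ^ t * E 0
        decay zero    = ≤-refl
        decay (suc t) = begin
          # suc l * # suc l ^ t * E (suc t) ≡⟨ solve 3 (λ a b e → a :* b :* e := b :* (a :* e)) refl (# suc l) (# suc l ^ t) (E (suc t)) ⟩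
          # suc l ^ t * (# suc l * E (suc t)) ≤⟨ *-monoˡ _ (^-nonneg (#-nonneg (suc l)) t) (contraction B≥0 pc l l≥ (err t) (err-mean t)) ⟩
          # suc l ^ t * (# l * E t) ≡⟨ solve 3 (λ a b e → b :* (a :* e) := a :* (b :* e)) refl (# l) (# suc l ^ t) (E t) ⟩
          # l * (# suc l ^ t * E t) ≤⟨ *-monoˡ _ (#-nonneg l) (decay t) ⟩
          # l * (# l ^ t * E 0) ≡⟨ sym (*-assoc _ _ _) ⟩
          # l * # l ^ t * E 0 ∎

        decay-half : ∀ j → # 2 ^ j * E (j ℕ.* suc l) ≤ w₀ ⁻¹
        decay-half j = *-cancel-≤ (^-pos (#-pos l) t) (begin
          # suc l ^ t * (# 2 ^ j * E t) ≡⟨ solve 3 (λ a b e → a :* (b :* e) := b :* (a :* e)) refl (# suc l ^ t) (# 2 ^ j) (E t) ⟩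
          # 2 ^ j * (# suc l ^ t * E t) ≤⟨ *-monoˡ _ (^-nonneg (#-nonneg 2) j) (decay t) ⟩
          # 2 ^ j * (# l ^ t * E 0) ≡⟨ sym (*-assoc _ _ _) ⟩
          # 2 ^ j * # l ^ t * E 0 ≤⟨ *-mono (*-nonneg (^-nonneg (#-nonneg 2) j) (^-nonneg (#-nonneg l) t)) (proj₁ (⁻¹-pos w₀>0)) (pow-half-iter l j) E₀≤ ⟩
          # suc l ^ t * w₀ ⁻¹ ∎)
          where t = j ℕ.* suc l

        -- The L¹ norm is bounded by the L² norm without a square root, by integrating 4 Z |e| ≤ 4
        -- Z² e² + 1. The choice of j makes 4 Z E at most 1 after j periods of l + 1 steps, each of
        -- which halves the bound on E.
        total-variation : ∀ j → # 4 * (Z * w₀ ⁻¹) ≤ # 2 ^ j → ∀ (π : Config n → Carrier) → (∀ τ → Z * π τ ≡ w τ) →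
          # 2 * sumC (λ τ → abs (law (j ℕ.* suc l) τ - π τ)) ≤ 1#
        total-variation j j≥ π π≡ = *-cancel-≤ (#-pos 1) (≤-trans (≤-reflexive (trans (solve 1 (λ s → lit 2 :* (lit 2 :* s) := lit 4 :* s) refl _) (cong (# 4 *_) (sum-cong (allConfigs n) dev)))) bound)
          where
          t = j ℕ.* suc l
          dev : ∀ τ → abs (law t τ - π τ) ≡ w τ * abs (err t τ)
          dev τ = trans (cong abs (trans (cong₂ _-_ (law-err t τ) π-eq) (solve 3 (λ w e i → w :* (e :+ i) :- w :* i := w :* e) refl (w τ) (err t τ) (Z ⁻¹)))) (abs-*-nonneg (w≥0 τ) (err t τ))
            where
            π-eq : π τ ≡ w τ * Z ⁻¹
            π-eq = *-cancelˡ Z>0 (trans (π≡ τ) (trans (sym (*-identityʳ (w τ))) (trans (cong (w τ *_) (sym (inverseʳ (proj₂ Z>0)))) (solve 3 (λ w z i → w :* (z :* i) := z :* (w :* i)) refl (w τ) Z (Z ⁻¹)))))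
          4ZE≤1 : # 4 * Z * E t ≤ 1#
          4ZE≤1 = *-cancel-≤ (*-pos (^-pos (#-pos 1) j) w₀>0) (begin
            # 2 ^ j * w₀ * (# 4 * Z * E t) ≡⟨ solve 4 (λ p w z e → p :* w :* (lit 4 :* z :* e) := lit 4 :* z :* w :* (p :* e)) refl (# 2 ^ j) w₀ Z (E t) ⟩
            # 4 * Z * w₀ * (# 2 ^ j * E t) ≤⟨ *-monoˡ _ (*-nonneg (*-nonneg (#-nonneg 4) (proj₁ Z>0)) (proj₁ w₀>0)) (decay-half j) ⟩
            # 4 * Z * w₀ * w₀ ⁻¹ ≡⟨ solve 3 (λ z w i → lit 4 :* z :* w :* i := lit 4 :* (z :* i) :* w) refl Z w₀ (w₀ ⁻¹) ⟩
            # 4 * (Z * w₀ ⁻¹) * w₀ ≤⟨ *-monoʳ w₀ (proj₁ w₀>0) j≥ ⟩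
            # 2 ^ j * w₀ ≡⟨ sym (*-identityʳ _) ⟩
            # 2 ^ j * w₀ * 1# ∎)
          sq-abs : ∀ x → abs x * abs x ≡ x * x
          sq-abs x with ≤-total 0# x
          ... | inj₁ _ = refl
          ... | inj₂ _ = solve 1 (λ x → (:- x) :* (:- x) := x :* x) refl x
          amgm : ∀ σ → # 4 * Z * abs (err t σ) ≤ # 4 * Z * Z * sq (err t σ) + 1#
          amgm σ = ≤-by (sq (# 2 * Z * abs (err t σ) - 1#)) (sq-nonneg _) (trans (cong (λ s → # 4 * Z * Z * s + 1#) (sym (sq-abs (err t σ))))
            (solve 2 (λ z a → lit 4 :* z :* z :* (a :* a) :+ lit 1 := lit 4 :* z :* a :+ (lit 2 :* z :* a :- lit 1) :* (lit 2 :* z :* a :- lit 1)) refl Z (abs (err t σ))))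
          bound : # 4 * I w (λ τ → abs (err t τ)) ≤ # 2 * 1#
          bound = *-cancel-≤ Z>0 (begin
            Z * (# 4 * I w (λ τ → abs (err t τ))) ≡⟨ trans (solve 2 (λ z s → z :* (lit 4 :* s) := lit 4 :* z :* s) refl Z _) (sym (I-*ˡ w (# 4 * Z) _)) ⟩
            I w (λ σ → # 4 * Z * abs (err t σ)) ≤⟨ I-mono w≥0 amgm ⟩
            I w (λ σ → # 4 * Z * Z * sq (err t σ) + 1#) ≡⟨ trans (I-+ w _ _) (cong₂ _+_ (I-*ˡ w (# 4 * Z * Z) _) (I-const w 1#)) ⟩
            # 4 * Z * Z * E t + Z * 1# ≡⟨ solve 2 (λ z e → lit 4 :* z :* z :* e :+ z :* lit 1 := z :* (lit 4 :* z :* e :+ lit 1)) refl Z (E t) ⟩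
            Z * (# 4 * Z * E t + 1#) ≤⟨ *-monoˡ Z (proj₁ Z>0) (+-monoˡ-≤ 1# 4ZE≤1) ⟩
            Z * (1# + 1#) ≡⟨ cong (Z *_) (solve 0 (lit 1 :+ lit 1 := lit 2 :* lit 1) refl) ⟩
            Z * (# 2 * 1#) ∎)

      -- As A bounds both λ and 1/λ, Z ≤ 2^n A^n and 1/w₀ ≤ A^n; with 4 ≤ 4^n the product is at most
      -- (8 A²)^n, and k ≤ 2^k does the rest. The number of halvings is thus linear in n.
      start-bound : ∀ A → lam ≤ # A → 1# ≤ # A * lam → 1# ≤ # A → # 4 * (Z * w₀ ⁻¹) ≤ # 2 ^ (n ℕ.* (8 ℕ.* (A ℕ.* A)))
      start-bound A lam≤A 1≤Alam 1≤A = begin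
        # 4 * (Z * w₀ ⁻¹) ≤⟨ *-monoˡ (# 4) (#-nonneg 4) (*-mono (proj₁ Z>0) (^-nonneg (#-nonneg A) n) Z≤ w₀⁻¹≤) ⟩
        # 4 * (# 2 ^ n * # A ^ n * # A ^ n) ≤⟨ *-monoʳ _ (*-nonneg (*-nonneg (^-nonneg (#-nonneg 2) n) (^-nonneg (#-nonneg A) n)) (^-nonneg (#-nonneg A) n)) 4≤4^n ⟩
        # 4 ^ n * (# 2 ^ n * # A ^ n * # A ^ n) ≡⟨ sym (trans (^-distrib (# 4) (# 2 * # A * # A) n) (cong (# 4 ^ n *_) (trans (^-distrib (# 2 * # A) (# A) n) (cong (_* # A ^ n) (^-distrib (# 2) (# A) n))))) ⟩
        (# 4 * (# 2 * # A * # A)) ^ n ≡⟨ cong (_^ n) (trans (solve 1 (λ a → lit 4 :* (lit 2 :* a :* a) := lit 8 :* (a :* a)) refl (# A)) (sym (trans (#-* 8 (A ℕ.* A)) (cong (# 8 *_) (#-* A A))))) ⟩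
        # (8 ℕ.* (A ℕ.* A)) ^ n ≤⟨ ^-mono (#-nonneg _) (k≤2^k (8 ℕ.* (A ℕ.* A))) n ⟩
        (# 2 ^ (8 ℕ.* (A ℕ.* A))) ^ n ≡⟨ sym (^-* (# 2) n (8 ℕ.* (A ℕ.* A))) ⟩
        # 2 ^ (n ℕ.* (8 ℕ.* (A ℕ.* A))) ∎
        where
        1≤4 : 1# ≤ # 4
        1≤4 = #-mono {1} {4} (ℕ.s≤s ℕ.z≤n)
        4≤4^n : # 4 ≤ # 4 ^ n
        4≤4^n = subst (_≤ # 4 * # 4 ^ n′) (*-identityʳ (# 4)) (*-monoˡ (# 4) (#-nonneg 4) (1≤^ 1≤4 n′))
        ^-≤ : ∀ {j} → j ℕ.≤ n → # A ^ j ≤ # A ^ n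
        ^-≤ {j} j≤n = subst₂ _≤_ (*-identityʳ _) (trans (sym (^-+ (# A) j (n ℕ.∸ j))) (cong (# A ^_) (ℕₚ.m+[n∸m]≡n j≤n))) (*-monoˡ (# A ^ j) (^-nonneg (#-nonneg A) j) (1≤^ 1≤A (n ℕ.∸ j)))
        w≤ : ∀ σ → w σ ≤ # A ^ n
        w≤ σ = ≤-trans (*-monoʳ _ (^-nonneg (proj₁ lam>0) (size σ)) (𝟙-≤1 (X σ))) (≤-trans (≤-reflexive (*-identityˡ _)) (≤-trans (^-mono (proj₁ lam>0) lam≤A (size σ)) (^-≤ (size≤n σ))))
        Z≤ : Z ≤ # 2 ^ n * # A ^ n
        Z≤ = ≤-trans (sum-mono (allConfigs n) w≤) (≤-reflexive (sumC-const n (# A ^ n)))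
        w₀⁻¹≤ : w₀ ⁻¹ ≤ # A ^ n
        w₀⁻¹≤ = *-cancel-≤ w₀>0 (begin
          w₀ * w₀ ⁻¹ ≡⟨ inverseʳ (proj₂ w₀>0) ⟩
          1# ≤⟨ 1≤^ 1≤Alam (size σ₀) ⟩
          (# A * lam) ^ size σ₀ ≡⟨ trans (^-distrib (# A) lam (size σ₀)) (trans (*-comm _ _) (cong (_* # A ^ size σ₀) (sym w₀≡))) ⟩
          w₀ * # A ^ size σ₀ ≤⟨ *-monoˡ w₀ (proj₁ w₀>0) (^-≤ (size≤n σ₀)) ⟩
          w₀ * # A ^ n ∎)

  -- Explicit constants and the mixing time

  ceiling : ∀ {x} → 0# ≤ x → ∃ λ l → x ≤ # suc l × # suc l ≤ x + 1#
  ceiling {x} x≥0 = search (proj₁ (archimedean x)) (proj₂ (archimedean x))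
    where
    search : ∀ k → x ≤ # k → ∃ λ l → x ≤ # suc l × # suc l ≤ x + 1#
    search zero    p = 0 , ≤-trans p 0≤1 , subst (_≤ x + 1#) (+-identityˡ 1#) (+-monoˡ-≤ 1# x≥0)
    search (suc k) p with ≤-total x (# k)
    ... | inj₁ q = search k q
    ... | inj₂ q = k , p , subst (_≤ x + 1#) (trans (+-comm (# k) 1#) (sym (#-suc k))) (+-monoˡ-≤ 1# q)

  module Constants (D′ : ℕ) where

    open Critical D′

    A κ : ℕ
    A = suc (proj₁ (archimedean λᶜ) ℕ.+ proj₁ (archimedean (λᶜ ⁻¹)))
    κ = 8 ℕ.* (A ℕ.* A)

    λᶜ≤A : λᶜ ≤ # A
    λᶜ≤A = ≤-trans (proj₂ (archimedean λᶜ)) (#-mono (ℕₚ.≤-trans (ℕₚ.m≤m+n _ _) (ℕₚ.n≤1+n _)))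

    1≤A : 1# ≤ # A
    1≤A = #-mono {1} {A} (ℕ.s≤s ℕ.z≤n)

    1≤Aλᶜ : 1# ≤ # A * λᶜ
    1≤Aλᶜ = subst (_≤ # A * λᶜ) (⁻¹-inverseˡ (proj₂ λᶜ>0)) (*-monoʳ λᶜ (proj₁ λᶜ>0) (≤-trans (proj₂ (archimedean (λᶜ ⁻¹))) (#-mono (ℕₚ.≤-trans (ℕₚ.m≤n+m _ (proj₁ (archimedean λᶜ))) (ℕₚ.n≤1+n _)))))

    e₁ e₂ : ℕ
    e₁ = suc (suc D) ℕ.* 2
    e₂ = D ℕ.* (2 ℕ.* a)

    c₁ c₂ : Carrier
    c₁ = # 4 * # κ * (1# + λᶜ)
    c₂ = # 8 ^ D * (# 4 ^ e₁ * # 2 ^ e₂)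

    C : ℕ
    C = suc (proj₁ (archimedean (c₁ ^ D * c₂)))

    -- No D-th root is taken: C exceeds the left side itself, and C ≤ C^D since C and D are at least
    -- 1.
    C≥ : c₁ ^ D * c₂ ≤ # C ^ D
    C≥ = ≤-trans (≤-trans (proj₂ (archimedean (c₁ ^ D * c₂))) (#-mono (ℕₚ.n≤1+n _)))
      (subst (_≤ # C ^ D) (*-identityʳ (# C)) (*-monoˡ (# C) (#-nonneg C) (1≤^ (#-mono {1} {C} (ℕ.s≤s ℕ.z≤n)) D′)))

    module Time {n′ : ℕ} (G : Graph (suc n′)) (deg : ∀ v → degree G v ℕ.≤ suc d) where

      open Iteration D′ G deg using (bᵉ; 1≤bᵉ; bᵉ-bound)

      n : ℕ
      n = suc n′

      B x : Carrier
      B = # 2 * bᵉ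
      x = # n * B * (1# + λᶜ)

      1≤2 : 1# ≤ # 2
      1≤2 = #-mono {1} {2} (ℕ.s≤s ℕ.z≤n)

      1≤* : ∀ {x y} → 1# ≤ x → 1# ≤ y → 1# ≤ x * y
      1≤* {x} {y} p q = ≤-trans q (subst (_≤ x * y) (*-identityˡ y) (*-monoʳ y (≤-trans 0≤1 q) p))

      B≥0 : 0# ≤ B
      B≥0 = ≤-trans 0≤1 (1≤* 1≤2 1≤bᵉ)

      1≤x : 1# ≤ x
      1≤x = 1≤* (1≤* (#-mono {1} {n} (ℕ.s≤s ℕ.z≤n)) (1≤* 1≤2 1≤bᵉ)) (≤-by λᶜ (proj₁ λᶜ>0) refl)

      l : ℕ
      l = proj₁ (ceiling (≤-trans 0≤1 1≤x))

      l≥ : x ≤ # suc l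
      l≥ = proj₁ (proj₂ (ceiling (≤-trans 0≤1 1≤x)))

      l≤ : # suc l ≤ # 2 * x
      l≤ = ≤-trans (proj₂ (proj₂ (ceiling (≤-trans 0≤1 1≤x)))) (≤-trans (+-mono ≤-refl 1≤x) (≤-reflexive (solve 1 (λ x → x :+ x := lit 2 :* x) refl x)))

      tmix : ℕ
      tmix = n ℕ.* κ ℕ.* suc l

      tmix≤ : # tmix ≤ c₁ * ((# n * # n) * bᵉ)
      tmix≤ = begin
        # tmix ≡⟨ trans (#-* (n ℕ.* κ) (suc l)) (cong (_* # suc l) (#-* n κ)) ⟩
        # n * # κ * # suc l ≤⟨ *-monoˡ _ (*-nonneg (#-nonneg n) (#-nonneg κ)) l≤ ⟩
        # n * # κ * (# 2 * x) ≡⟨ solve 4 (λ n k b o → n :* k :* (lit 2 :* (n :* (lit 2 :* b) :* o)) := lit 4 :* k :* o :* ((n :* n) :* b)) refl (# n) (# κ) bᵉ (1# + λᶜ) ⟩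
        c₁ * ((# n * # n) * bᵉ) ∎

      -- After raising to the power D, n² comes from the number of halvings and from the factor n in
      -- the length of a period, and n^e₁ from the Poincaré constant.
      exponent : D ℕ.* 2 ℕ.+ e₁ ≡ 4 ℕ.* suc d ℕ.∸ 4
      exponent = trans (sym (ℕₚ.m+n∸m≡n 4 (D ℕ.* 2 ℕ.+ e₁))) (cong (ℕ._∸ 4) (ℕsolve 1 (λ k → ncon 4 ⊕ ((ncon 1 ⊕ k) ⊗ ncon 2 ⊕ (ncon 3 ⊕ k) ⊗ ncon 2) ⊜ ncon 4 ⊗ (ncon 3 ⊕ k)) refl D′))
        where open Data.Nat.Solver.+-*-Solver renaming (solve to ℕsolve; con to ncon; _:+_ to _⊕_; _:*_ to _⊗_; _:=_ to _⊜_)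

      tmix-bound : tmix ℕ.^ D ℕ.≤ C ℕ.^ D ℕ.* n ℕ.^ (4 ℕ.* suc d ℕ.∸ 4)
      tmix-bound = #-≤-cancel _ _ (begin
        # (tmix ℕ.^ D) ≡⟨ #-^ tmix D ⟩
        # tmix ^ D ≤⟨ ^-mono (#-nonneg tmix) tmix≤ D ⟩
        (c₁ * ((# n * # n) * bᵉ)) ^ D ≡⟨ trans (^-distrib c₁ _ D) (cong (c₁ ^ D *_) (^-distrib (# n * # n) bᵉ D)) ⟩
        c₁ ^ D * ((# n * # n) ^ D * bᵉ ^ D) ≤⟨ *-monoˡ _ (^-nonneg c₁≥0 D) (*-monoˡ _ (^-nonneg (*-nonneg (#-nonneg n) (#-nonneg n)) D) bᵉ-bound) ⟩
        c₁ ^ D * ((# n * # n) ^ D * (c₂ * # n ^ e₁)) ≡⟨ trans (solve 4 (λ a n c m → a :* (n :* (c :* m)) := a :* c :* (n :* m)) refl (c₁ ^ D) ((# n * # n) ^ D) c₂ (# n ^ e₁)) (cong (c₁ ^ D * c₂ *_) nn) ⟩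
        c₁ ^ D * c₂ * # n ^ (D ℕ.* 2 ℕ.+ e₁) ≤⟨ *-monoʳ _ (^-nonneg (#-nonneg n) (D ℕ.* 2 ℕ.+ e₁)) C≥ ⟩
        # C ^ D * # n ^ (D ℕ.* 2 ℕ.+ e₁) ≡⟨ trans (cong₂ _*_ (sym (#-^ C D)) (trans (cong (# n ^_) exponent) (sym (#-^ n (4 ℕ.* suc d ℕ.∸ 4))))) (sym (#-* (C ℕ.^ D) (n ℕ.^ (4 ℕ.* suc d ℕ.∸ 4)))) ⟩
        # (C ℕ.^ D ℕ.* n ℕ.^ (4 ℕ.* suc d ℕ.∸ 4)) ∎)
        where
        c₁≥0 = *-nonneg (*-nonneg (#-nonneg 4) (#-nonneg κ)) (+-nonneg 0≤1 (proj₁ λᶜ>0))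
        nn : (# n * # n) ^ D * # n ^ e₁ ≡ # n ^ (D ℕ.* 2 ℕ.+ e₁)
        nn = sym (trans (^-+ (# n) (D ℕ.* 2) e₁) (cong (_* # n ^ e₁) (trans (^-* (# n) D 2) (cong (λ t → (# n * t) ^ D) (*-identityʳ (# n))))))

-- The field of rationals

÷′-inverse : ∀ {q} → q ≢ 0ℚ → ∀ p → q ℚ.* (p ÷' q) ≡ p
÷′-inverse {q} q≢0 p with q ℚₚ.≟ 0ℚ
... | yes eq = ⊥-elim (q≢0 eq)
... | no neq = trans (ℚₚ.*-comm q _) (trans (ℚₚ.*-assoc p _ q) (trans (cong (p ℚ.*_) (ℚₚ.*-inverseˡ q {{ℚ.≢-nonZero neq}})) (ℚₚ.*-identityʳ p)))

fromℤℚ : ℤ → ℚ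
fromℤℚ i = i ℚ./ 1

toℚᵘ-fromℤ : ∀ i → ℚ.toℚᵘ (fromℤℚ i) ℚᵘ.≃ mkℚᵘ i 0
toℚᵘ-fromℤ i = ℚₚ.toℚᵘ-fromℚᵘ (mkℚᵘ i 0)

fromℤℚ-+ : ∀ i j → fromℤℚ (i ℤ.+ j) ≡ fromℤℚ i ℚ.+ fromℤℚ j
fromℤℚ-+ i j = ℚₚ.toℚᵘ-injective (ℚᵘₚ.≃-trans (toℚᵘ-fromℤ (i ℤ.+ j)) (ℚᵘₚ.≃-trans (*≡* eq)
  (ℚᵘₚ.≃-sym (ℚᵘₚ.≃-trans (ℚₚ.toℚᵘ-homo-+ (fromℤℚ i) (fromℤℚ j)) (ℚᵘₚ.+-cong (toℚᵘ-fromℤ i) (toℚᵘ-fromℤ j))))))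
  where
  open Data.Integer.Solver.+-*-Solver
  eq : (i ℤ.+ j) ℤ.* ℤ.1ℤ ≡ (i ℤ.* ℤ.1ℤ ℤ.+ j ℤ.* ℤ.1ℤ) ℤ.* ℤ.1ℤ
  eq = solve 2 (λ i j → (i :+ j) :* con ℤ.1ℤ := (i :* con ℤ.1ℤ :+ j :* con ℤ.1ℤ) :* con ℤ.1ℤ) refl i j

fromℤℚ-* : ∀ i j → fromℤℚ (i ℤ.* j) ≡ fromℤℚ i ℚ.* fromℤℚ j
fromℤℚ-* i j = ℚₚ.toℚᵘ-injective (ℚᵘₚ.≃-trans (toℚᵘ-fromℤ (i ℤ.* j))
  (ℚᵘₚ.≃-sym (ℚᵘₚ.≃-trans (ℚₚ.toℚᵘ-homo-* (fromℤℚ i) (fromℤℚ j)) (ℚᵘₚ.*-cong (toℚᵘ-fromℤ i) (toℚᵘ-fromℤ j)))))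

fromℤℚ-neg : ∀ i → fromℤℚ (ℤ.- i) ≡ ℚ.- fromℤℚ i
fromℤℚ-neg i = ℚₚ.toℚᵘ-injective (ℚᵘₚ.≃-trans (toℚᵘ-fromℤ (ℤ.- i))
  (ℚᵘₚ.≃-sym (ℚᵘₚ.≃-trans (ℚₚ.toℚᵘ-homo‿- (fromℤℚ i)) (ℚᵘₚ.-‿cong (toℚᵘ-fromℤ i)))))

archimedeanℚ : ∀ x → ∃ λ k → x ℚ.≤ fromℤℚ (ℤ.+ k)
archimedeanℚ x@(mkℚ i e _) = ℤ.∣ i ∣ , ℚₚ.toℚᵘ-cancel-≤ (ℚᵘₚ.≤-trans (*≤* num≤) (ℚᵘₚ.≤-reflexive (ℚᵘₚ.≃-sym (toℚᵘ-fromℤ (ℤ.+ ℤ.∣ i ∣)))))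
  where
  i≤∣i∣ : ∀ i → i ℤ.≤ ℤ.+ ℤ.∣ i ∣
  i≤∣i∣ (ℤ.+ k)       = ℤₚ.≤-refl
  i≤∣i∣ ℤ.-[1+ k ] = ℤ.-≤+
  num≤ : i ℤ.* ℤ.1ℤ ℤ.≤ ℤ.+ ℤ.∣ i ∣ ℤ.* ℤ.+ suc e
  num≤ = ℤₚ.≤-trans (ℤₚ.≤-reflexive (ℤₚ.*-identityʳ i)) (ℤₚ.≤-trans (i≤∣i∣ i) (subst (ℤ.+ ℤ.∣ i ∣ ℤ.≤_) (ℤₚ.pos-* ℤ.∣ i ∣ (suc e)) (ℤ.+≤+ (ℕₚ.m≤m*n ℤ.∣ i ∣ (suc e)))))

-- The inverse is built from the division of the statement, so that `λᶜ` and the update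
-- probabilities can be matched with those of the graph model.
ℚ-orderedField : OrderedField
ℚ-orderedField = record
  { Carrier = ℚ ; _+_ = ℚ._+_ ; _*_ = ℚ._*_ ; -_ = ℚ.-_ ; _⁻¹ = 1ℚ ÷'_ ; fromℤ = fromℤℚ ; _≤_ = ℚ._≤_
  ; isCommutativeRing = ℚₚ.+-*-isCommutativeRing
  ; _≟_ = ℚₚ._≟_
  ; inverseʳ = λ x≢0 → ÷′-inverse x≢0 1ℚ
  ; 1≢0 = λ ()
  ; fromℤ-+ = fromℤℚ-+ ; fromℤ-* = fromℤℚ-* ; fromℤ-neg = fromℤℚ-neg
  ; ≤-refl = ℚₚ.≤-refl ; ≤-trans = ℚₚ.≤-trans ; ≤-antisym = ℚₚ.≤-antisym ; ≤-total = ℚₚ.≤-total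
  ; +-monoˡ-≤ = λ z → ℚₚ.+-monoˡ-≤ z
  ; *-nonneg = λ {x} {y} p q → ℚₚ.nonNegative⁻¹ (x ℚ.* y) {{ℚₚ.nonNeg*nonNeg⇒nonNeg x {{ℚ.nonNegative p}} y {{ℚ.nonNegative q}}}}
  ; 0≤1 = ℚₚ.nonNegative⁻¹ 1ℚ
  ; archimedean = archimedeanℚ
  }

-- Transfer to the chain and distance of the statement

open Analysis ℚ-orderedField using (Pos; wt; abs; sum-cong; sum-mono; sumC; T⇒≡; x≤abs; -x≤abs; *-cancel-≤; *-monoˡ; #-pos; #-nonneg; +-pos; 1-pos; _^_; DownClosed; Poincaré; remove; module Hardcore; module Glauber; module Critical; module Constants; module Iteration)

∣∣≤abs : ∀ x → ℚ.∣ x ∣ ℚ.≤ abs x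
∣∣≤abs x with ℚₚ.∣p∣≡p∨∣p∣≡-p x
... | inj₁ eq = subst (ℚ._≤ abs x) (sym eq) (x≤abs x)
... | inj₂ eq = subst (ℚ._≤ abs x) (sym eq) (-x≤abs x)

indicator-refl : ∀ {n} (σ : Config n) → indicator σ σ ≡ 1ℚ
indicator-refl σ with Vec.≡-dec Bool._≟_ σ σ
... | yes _ = refl
... | no ¬p = ⊥-elim (¬p refl)

indicator-≢ : ∀ {n} {σ τ : Config n} → σ ≢ τ → indicator σ τ ≡ 0ℚ
indicator-≢ {σ = σ} {τ} σ≢τ with Vec.≡-dec Bool._≟_ σ τ
... | yes p = ⊥-elim (σ≢τ p)
... | no _  = refl

÷′-* : ∀ p q → p ÷' q ≡ p ℚ.* (1ℚ ÷' q)
÷′-* p q with q ℚₚ.≟ 0ℚ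
... | yes _ = sym (ℚₚ.*-zeroʳ p)
... | no q≢0 = cong (p ℚ.*_) (sym (ℚₚ.*-identityˡ _))

weight≡wt : ∀ {n} (G : Graph n) lam σ → weight G lam σ ≡ wt (isIndep G) (λ j → lam ^ j) σ
weight≡wt G lam σ with isIndep G σ
... | true  = trans (pow (size σ)) (sym (ℚₚ.*-identityˡ _))
  where
  pow : ∀ j → lam ^ℚ j ≡ lam ^ j
  pow zero    = refl
  pow (suc j) = cong (lam ℚ.*_) (pow j)
... | false = sym (ℚₚ.*-zeroˡ (lam ^ size σ))

module _ {n′ : ℕ} (G : Graph (suc n′)) {lam : ℚ} (lam>0 : Pos lam) where

  private
    n : ℕ
    n = suc n′

  1+lam>0 : Pos (1ℚ ℚ.+ lam)
  1+lam>0 = +-pos 1-pos (proj₁ lam>0)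

  isIndep-down : DownClosed (isIndep G)
  isIndep-down v σ p = indep⁺ (remove v σ) (λ x y a s t → indep⁻ σ p x y a (remove-⊆ v σ x s) (remove-⊆ v σ y t))
    where open Hardcore G

  open Glauber (isIndep G) isIndep-down lam>0 (lam ÷' (1ℚ ℚ.+ lam)) (1ℚ ÷' (1ℚ ℚ.+ lam))
    (÷′-inverse (proj₂ 1+lam>0) lam) (÷′-inverse (proj₂ 1+lam>0) 1ℚ)
    (_÷' fromℕ n) (÷′-inverse (proj₂ (#-pos n′))) using (w; Z; module Start)

  Z≡ : partitionFn G lam ≡ Z
  Z≡ = sum-cong (allConfigs n) (weight≡wt G lam)

  mixing : ∀ {B} → 0ℚ ℚ.≤ B → Poincaré w B → ∀ l → fromℕ n ℚ.* B ℚ.* (1ℚ ℚ.+ lam) ℚ.≤ fromℕ (suc l) →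
    ∀ A → lam ℚ.≤ fromℕ A → 1ℚ ℚ.≤ fromℕ A ℚ.* lam → 1ℚ ℚ.≤ fromℕ A →
    MixingTimeAtMost G lam (n ℕ.* (8 ℕ.* (A ℕ.* A)) ℕ.* suc l)
  mixing {B} B≥0 pc l l≥ A lam≤A 1≤Alam 1≤A σ₀ indep₀ = t , ℕₚ.≤-refl , tv
    where
    open Start σ₀ (T⇒≡ indep₀) indicator indicator-refl indicator-≢
    j = n ℕ.* (8 ℕ.* (A ℕ.* A))
    t = j ℕ.* suc l
    -- `P` applied to an indicator unfolds to `glauber`, so the two recursions have the same
    -- transition term.
    law≡ : ∀ t τ → law t τ ≡ glauberPow G lam t σ₀ τ
    law≡ zero    τ = refl
    law≡ (suc t) τ = sum-cong (allConfigs n) (λ σ → cong (ℚ._* glauber G lam σ τ) (law≡ t σ))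
    gibbs≡ : ∀ τ → Z ℚ.* gibbs G lam τ ≡ w τ
    gibbs≡ τ = trans (cong (ℚ._* gibbs G lam τ) (sym Z≡)) (trans (÷′-inverse (subst (_≢ 0ℚ) (sym Z≡) (proj₂ Z>0)) (weight G lam τ)) (weight≡wt G lam τ))
    S = Σ[ allConfigs n ] (λ τ → ℚ.∣ glauberPow G lam t σ₀ τ ℚ.- gibbs G lam τ ∣)
    S≤ : S ℚ.≤ sumC (λ τ → abs (law t τ ℚ.- gibbs G lam τ))
    S≤ = sum-mono (allConfigs n) (λ τ → subst (λ x → ℚ.∣ x ℚ.- gibbs G lam τ ∣ ℚ.≤ abs (law t τ ℚ.- gibbs G lam τ)) (law≡ t τ) (∣∣≤abs _))
    2S≤1 : fromℕ 2 ℚ.* S ℚ.≤ 1ℚ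
    2S≤1 = ℚₚ.≤-trans (*-monoˡ (fromℕ 2) (#-nonneg 2) S≤) (total-variation B≥0 pc l l≥ j (start-bound A lam≤A 1≤Alam 1≤A) (gibbs G lam) gibbs≡)
    tv : dTV (glauberPow G lam t σ₀) (gibbs G lam) ℚ.≤ ℤ.1ℤ ℚ./ 4
    -- Multiplied by 4: both 4 · ½ = 2 and 4 · (1/4) = 1 hold by evaluation.
    tv = *-cancel-≤ (#-pos 3) (subst (ℚ._≤ 1ℚ) (ℚₚ.*-assoc (fromℕ 4) ℚ.½ S) 2S≤1)

λc≡λᶜ : ∀ D′ → λc (suc (suc (suc D′))) ≡ Critical.λᶜ D′
λc≡λᶜ D′ = ÷′-* (fromℕ (suc (suc D′) ℕ.^ suc (suc D′))) (fromℕ (suc D′ ℕ.^ suc (suc (suc D′))))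

-- The constant is chosen after Δ, so a bound with `C` alone passes to one with `C` times the
-- logarithm as soon as the logarithm is at least 1.
log≥1 : ∀ Δ → 2 ℕ.≤ Δ → 1 ℕ.≤ ⌈log₂ Δ ⌉
log≥1 Δ p = ⌈log₂⌉-mono-≤ p

open import Data.Nat using (_≤_)

theorem1p1 : (Δ : ℕ) → 3 ≤ Δ →
    Σ ℕ λ C → (n : ℕ) (G : Graph n) → HasMaxDegree G Δ →
    Σ ℕ λ T → MixingTimeAtMost G (λc Δ) T × BoundedBy Δ C n T
theorem1p1 (suc (suc (suc D′))) (ℕ.s≤s (ℕ.s≤s (ℕ.s≤s ℕ.z≤n))) = C , bound
  where
  open Critical D′ using (λᶜ; λᶜ>0; D; d)
  open Constants D′ using (C; A; λᶜ≤A; 1≤A; 1≤Aλᶜ; module Time)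
  bound : (n : ℕ) (G : Graph n) → HasMaxDegree G (suc d) → Σ ℕ λ T → MixingTimeAtMost G (λc (suc d)) T × BoundedBy (suc d) C n T
  bound zero     G (_ , () , _)
  bound (suc n′) G (deg , _) = tmix , subst (λ z → MixingTimeAtMost G z tmix) (sym (λc≡λᶜ D′)) (mixing G λᶜ>0 B≥0 (Iteration.critical-Poincaré D′ G deg) l l≥ A λᶜ≤A 1≤Aλᶜ 1≤A)
    , ℕₚ.≤-trans tmix-bound (ℕₚ.*-monoˡ-≤ (suc n′ ℕ.^ (4 ℕ.* suc d ℕ.∸ 4)) (ℕₚ.^-monoˡ-≤ D (ℕₚ.m≤m*n C ⌈log₂ suc d ⌉ {{ℕ.>-nonZero (log≥1 (suc d) (ℕ.s≤s (ℕ.s≤s ℕ.z≤n)))}})))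
    where open Time G deg
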